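{- Let $p\ge 3$ be a prime, let $N$ be a positive integer coprime to $p$, and let $\alpha\ge 0$ be an integer. (1) If $p\equiv 1\pmod 7$, then $\overline{p}_3(7p^{14\alpha+13}N)\equiv 0\pmod 7$. (2) If $p\equiv 2,3,4,5,6\pmod 7$, then $\overline{p}_3(7p^{12\alpha+11}N)\equiv 0\pmod 7$. (3) If $p\equiv 6\pmod 7$, then $\overline{p}_3(7p^{3}N)\equiv 0\pmod 7$.
   Context: An overpartition of $n$ is a partition of $n$ in which the first occurrence of each distinct part may (or may not) be overlined. An overpartition triple of $n$ is a triple of overpartitions whose parts together sum to $n$. $\overline{p}_3(n)$ denotes the number of overpartition triples of $n$, with $\overline{p}_3(0)=1$; equivalently $\sum_{n\ge0}\overline{p}_3(n)q^n=\big((-q;q)_\infty/(q;q)_\infty\big)^3$, where $(a;q)_\infty=\prod_{n\ge0}(1-aq^n)$. -}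

module Defs where

open import Data.Nat using (ℕ; zero; suc; _+_; _*_; _∸_; _≤ᵇ_)
open import Data.Bool using (if_then_else_)
open import Data.List using (List; map; upTo)
open import Data.Nat.ListAction using (sum)

-- ovBounded n m : number of overpartitions of n all of whose parts are ≤ m.
-- Recursion on the largest allowed part m: either part m does not occur,
-- or it occurs with multiplicity k ≥ 1, and its first occurrence is either
-- overlined or not (factor 2).
ovBounded : ℕ → ℕ → ℕ
multTerms : ℕ → ℕ → ℕ → ℕ → ℕ

ovBounded zero    _       = 1
ovBounded (suc n) zero    = 0
ovBounded (suc n) (suc m) = ovBounded (suc n) m + multTerms (suc n) m (suc n) 1

multTerms n m zero       k = 0
multTerms n m (suc fuel) k =
  (if k * suc m ≤ᵇ n then 2 * ovBounded (n ∸ k * suc m) m else 0)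
  + multTerms n m fuel (suc k)

overpartitions : ℕ → ℕ
overpartitions n = ovBounded n n

-- p̄₃(n): number of overpartition triples of n
-- = Σ_{a+b+c=n} p̄(a) p̄(b) p̄(c)
pbar3 : ℕ → ℕ
pbar3 n = sum (map (λ a → sum (map (λ b →
            overpartitions a * overpartitions b * overpartitions (n ∸ a ∸ b))
            (upTo (suc (n ∸ a))))) (upTo (suc n)))

{-# OPTIONS --safe #-}
module Submission where

-- Gauss' identity φ(−q) = Σ (−1)ⁿ q^(n²) = ∏ (1 − qᵏ)/(1 + qᵏ) gives P̄ = 1/φ(−q) for the
-- overpartition series, so P̄³ = P̄⁷ φ(−q)⁴ ≡ P̄(q⁷) φ(−q)⁴ (mod 7). Since r₄(7n) ≡ r₄(n) (mod 7),
-- taking the coefficients of q^(7n) yields p̄₃(7n) ≡ (−1)ⁿ r₃(n) (mod 7).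
--
-- Let p be an odd prime. If p ∣ n, then r₃(p²n) + p r₃(n/p²) = (p + 1) r₃(n), hence
-- r₃(p^(2j+1) N) = (1 + p + ⋯ + pʲ) r₃(pN) for p ∤ N, and the geometric sum vanishes modulo 7
-- in each of the cases considered.
--
-- Both facts about r₃ and r₄ come from counting, in the ring of integral (Lipschitz)
-- quaternions, the pairs (α , x) with α of norm p through the maps x ↦ αx and x ↦ αxᾱ. The
-- fibres are controlled by one lemma: if p divides the norm of y but not y, there are exactly
-- 8 quaternions α of norm p with p ∣ ᾱy. Existence is Lagrange's descent within the right ideal
-- generated by y and p, uniqueness up to units is immediate. Counting the left ideal generated
-- by a + bi + j with a² + b² + 1 ≡ 0 (mod p), which has p + 1 lines, gives r₄(p) = 8(p + 1).

-- Modulo an odd prime p the quaternions become the 2 by 2 matrices over the field of p elements,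
-- though the code never passes to them. An α of norm p becomes a matrix of rank one, and p ∣ ᾱy
-- says that the columns of y lie in the column line of α. A nonzero singular y has exactly one
-- column line, whence one generator up to the 8 units. A pure y has trace 0; if it is singular and
-- nonzero modulo p it is nilpotent, its only invariant line is its image, and p ∣ ᾱyα already
-- forces p ∣ ᾱy. If y = pz with nm z = n prime to p, the invariant lines of z would be eigenlines,
-- and their number would depend on whether -n is a square modulo p: this is the Legendre symbol in
-- the general recurrence for r₃(p²n). Hence the restriction to p ∣ n, where a fibre has either 8
-- points or all 8(p + 1). The recurrence starts at pN, where n/p² is not an integer, and runs
-- through p^(2j+1) N. Blocks of 7, 6 and 2 terms of the geometric sum therefore produce the
-- exponents 13, 11 and 3.

open import Defs

-- Counting by duplicate-free enumeration.

module Cardinality where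
  open import Data.Empty using (⊥; ⊥-elim)
  open import Data.List using (List; []; _∷_; length; map; _++_; filter)
  open import Data.List.Properties using (length-map; length-++)
  open import Data.List.Membership.Propositional using (_∈_)
  open import Data.List.Membership.Propositional.Properties using (∈-map⁺; ∈-map⁻; ∈-++⁺ˡ; ∈-++⁺ʳ; ∈-++⁻; ∈-∃++; ∈-filter⁺; ∈-filter⁻)
  open import Data.List.Relation.Unary.Any using (here; there)
  open import Data.List.Relation.Unary.All as All using (All; []; _∷_)
  open import Data.List.Relation.Unary.AllPairs using ([]; _∷_)
  open import Data.List.Relation.Unary.Unique.Propositional using (Unique)
  open import Data.Nat using (ℕ; suc; _+_; _*_; _≤_; z≤n; s≤s)
  open import Data.Nat.Properties using (≤-antisym; +-suc)
  open import Data.Product using (_×_; _,_; ∃; ∃₂)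
  open import Data.Sum using (inj₁; inj₂; _⊎_)
  open import Function using (_∘_)
  open import Relation.Nullary using (¬_; Dec; yes; no; ¬?)
  open import Relation.Binary.PropositionalEquality
  import Data.List.Relation.Unary.All.Properties as All
  import Data.List.Relation.Unary.Unique.Propositional.Properties as Uniq

  -- Elements of `A` are enumerated, not pairs of an element with a proof, so `P` may have many
  -- proofs and one set can be described by several predicates.
  record Card {A : Set} (P : A → Set) (n : ℕ) : Set where
    constructor card
    field
      elems    : List A
      unique   : Unique elems
      sound    : ∀ {x} → x ∈ elems → P x
      complete : ∀ {x} → P x → x ∈ elems
      size     : length elems ≡ n

  private variable
    A B : Set
    P : A → Set
    Q : B → Set
    m n : ℕ

  length-mono : ∀ {xs ys : List A} → Unique xs → (∀ {x} → x ∈ xs → x ∈ ys) → length xs ≤ length ys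
  length-mono {xs = []} _ _ = z≤n
  length-mono {xs = x ∷ xs} (x∉ ∷ u) sub with ∈-∃++ (sub (here refl))
  ... | ls , rs , refl = subst (suc (length xs) ≤_) (sym len) (s≤s (length-mono u sub′))
    where
    len : length (ls ++ x ∷ rs) ≡ suc (length (ls ++ rs))
    len = trans (length-++ ls) (trans (+-suc (length ls) (length rs)) (cong suc (sym (length-++ ls))))
    sub′ : ∀ {y} → y ∈ xs → y ∈ ls ++ rs
    sub′ y∈ with ∈-++⁻ ls (sub (there y∈))
    ... | inj₁ q = ∈-++⁺ˡ q
    ... | inj₂ (there q) = ∈-++⁺ʳ ls q
    ... | inj₂ (here refl) = ⊥-elim (All.lookup x∉ y∈ refl)

  -- The source of the numerical identities on quaternions: one set enumerated in two ways.
  Card-unique : Card P m → Card P n → m ≡ n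
  Card-unique (card xs u s c refl) (card ys u′ s′ c′ refl) =
    ≤-antisym (length-mono u (c′ ∘ s)) (length-mono u′ (c ∘ s′))

  Card-cong : {P Q : A → Set} → (∀ {x} → P x → Q x) → (∀ {x} → Q x → P x) → Card P n → Card Q n
  Card-cong f g (card xs u s c l) = card xs u (f ∘ s) (c ∘ g) l

  Card-∅ : (∀ {x} → ¬ P x) → Card P 0
  Card-∅ e = card [] [] (λ ()) (⊥-elim ∘ e) refl

  Card-singleton : (x : A) → Card (x ≡_) 1
  Card-singleton x = card (x ∷ []) ([] ∷ []) (λ { (here refl) → refl }) (λ { refl → here refl }) refl

  Card-⊎ : {P Q : A → Set} → (∀ {x} → P x → Q x → ⊥) → Card P m → Card Q n → Card (λ x → P x ⊎ Q x) (m + n)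
  Card-⊎ dis (card xs u s c refl) (card ys u′ s′ c′ refl) = card (xs ++ ys)
    (Uniq.++⁺ u u′ (λ (p , q) → dis (s p) (s′ q)))
    (λ i → Data.Sum.map s s′ (∈-++⁻ xs i))
    (λ { (inj₁ p) → ∈-++⁺ˡ (c p) ; (inj₂ q) → ∈-++⁺ʳ xs (c′ q) })
    (length-++ xs)

  Card-bijection : (f : A → B) → (∀ {x} → P x → Q (f x)) →
    (∀ {x y} → P x → P y → f x ≡ f y → x ≡ y) → (∀ {y} → Q y → ∃ λ x → P x × f x ≡ y) →
    Card P n → Card Q n
  Card-bijection {P = P} {Q = Q} f to inj surj (card xs u s c l) = card (map f xs)
    (uniq xs u s)
    (λ i → let x , x∈ , eq = ∈-map⁻ f i in subst Q (sym eq) (to (s x∈)))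
    (λ q → let x , p , eq = surj q in subst (_∈ map f xs) eq (∈-map⁺ f (c p)))
    (trans (length-map f xs) l)
    where
    uniq : ∀ zs → Unique zs → (∀ {x} → x ∈ zs → P x) → Unique (map f zs)
    uniq [] _ _ = []
    uniq (z ∷ zs) (z∉ ∷ v) t =
      All.map⁺ (All.tabulate (λ i eq → All.lookup z∉ i (inj (t (here refl)) (t (there i)) eq)))
      ∷ uniq zs v (t ∘ there)


  Card-fibres : {R : A → B → Set} → Card P m → (∀ {x} → P x → Card (R x) n) →
    Card (λ (x , y) → P x × R x y) (m * n)
  Card-fibres {A = A} {B = B} {P = P} {n = n} {R = R} (card xs u s c refl) fib =
    Card-cong (λ (i , r) → s i , r) (λ (p , r) → c p , r) (go xs u (fib ∘ s))
    where
    Over : List A → A × B → Set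
    Over zs (x , y) = x ∈ zs × R x y
    At : A → A × B → Set
    At z (x , y) = z ≡ x × R x y
    go : ∀ zs → Unique zs → (∀ {x} → x ∈ zs → Card (R x) n) → Card (Over zs) (length zs * n)
    go [] _ _ = Card-∅ (λ ())
    go (z ∷ zs) (z∉ ∷ v) fib′ = Card-cong {P = λ w → At z w ⊎ Over zs w} {Q = Over (z ∷ zs)}
      (λ { (inj₁ (refl , r)) → here refl , r ; (inj₂ (i , r)) → there i , r })
      (λ { (here refl , r) → inj₁ (refl , r) ; (there i , r) → inj₂ (i , r) })
      (Card-⊎ {P = At z} {Q = Over zs} (λ { (refl , _) (i , _) → All.lookup z∉ i refl })
        (Card-bijection {Q = At z} (z ,_) (refl ,_) (λ { _ _ refl → refl })
          (λ { (refl , r) → _ , r , refl }) (fib′ (here refl)))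
        (go zs v (fib′ ∘ there)))

  Card-× : Card P m → Card Q n → Card (λ (x , y) → P x × Q y) (m * n)
  Card-× p q = Card-fibres p (λ _ → q)

  Card-split : {P Q : A → Set} → (∀ x → Dec (Q x)) → Card P n →
    ∃₂ λ k l → Card (λ x → P x × Q x) k × Card (λ x → P x × ¬ Q x) l × k + l ≡ n
  Card-split {A = A} {P = P} {Q = Q} Q? (card xs u s c refl) = _ , _ ,
    card (filter Q? xs) (Uniq.filter⁺ Q? u) (λ i → let j , q = ∈-filter⁻ Q? i in s j , q)
      (λ (p , q) → ∈-filter⁺ Q? (c p) q) refl ,
    card (filter ¬Q? xs) (Uniq.filter⁺ ¬Q? u) (λ i → let j , q = ∈-filter⁻ ¬Q? i in s j , q)
      (λ (p , q) → ∈-filter⁺ ¬Q? (c p) q) refl ,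
    count xs
    where
    ¬Q? : ∀ x → Dec (¬ Q x)
    ¬Q? x = ¬? (Q? x)
    count : ∀ zs → length (filter Q? zs) + length (filter ¬Q? zs) ≡ length zs
    count [] = refl
    count (z ∷ zs) with Q? z
    ... | yes _ = cong suc (count zs)
    ... | no  _ = trans (+-suc _ _) (cong suc (count zs))

-- Numbers of representations by sums of squares.

module ThetaCoefficients where
  open Cardinality
  open import Data.Bool using (true; false; if_then_else_)
  open import Data.Integer using (ℤ; +_; -[1+_]; ∣_∣)
  open import Data.Nat
  open import Data.Nat.Properties
  open import Data.Product using (_×_; _,_; proj₁; proj₂)
  open import Data.Sum using (inj₁; inj₂; _⊎_)
  open import Function using (_∘_)
  open import Relation.Binary.PropositionalEquality

  conv : (ℕ → ℕ) → (ℕ → ℕ) → ℕ → ℕ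
  conv f g zero    = f 0 * g 0
  conv f g (suc n) = f 0 * g (suc n) + conv (f ∘ suc) g n

  Counts : {A : Set} → (A → ℕ) → (ℕ → ℕ) → Set
  Counts w f = ∀ n → Card (λ a → w a ≡ n) (f n)

  module _ {A B : Set} {w : A → ℕ} {v : B → ℕ} {g : ℕ → ℕ} (G : Counts v g) where
    private
      T : ℕ → ℕ → A × B → Set
      T s n (a , b) = s ≤ w a × w a + v b ≡ s + n

      -- `conv` peels off the first coefficient of `f`, so the induction runs over the pairs whose
      -- first weight is at least `s`, with `f` shifted accordingly.
      counts-from : ∀ n s (f : ℕ → ℕ) → (∀ i → Card (λ a → w a ≡ s + i) (f i)) → Card (T s n) (conv f g n)
      counts-from zero s f F = Card-cong {Q = T s 0}
        (λ { {a , b} (p , q) → ≤-reflexive (sym (trans p (+-identityʳ s))) , cong₂ _+_ (trans p (+-identityʳ s)) q })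
        (λ { {a , b} (p , q) → let e = trans q (+-identityʳ s) ; l = ≤-antisym (≤-trans (m≤m+n (w a) (v b)) (≤-reflexive e)) p in
            trans l (sym (+-identityʳ s)) ,
                +-cancelˡ-≡ (w a) (v b) 0 (trans e (trans (sym l) (sym (+-identityʳ (w a))))) })
        (Card-× (F 0) (G 0))
      counts-from (suc n) s f F = Card-cong {Q = T s (suc n)}
        (λ { {a , b} (inj₁ (p , q)) → ≤-reflexive (sym (trans p (+-identityʳ s))) , cong₂ _+_ (trans p (+-identityʳ s)) q
           ; {a , b} (inj₂ (p , q)) → <⇒≤ p , trans q (sym (+-suc s n)) })
        back
        (Card-⊎ {P = λ (a , b) → w a ≡ s + 0 × v b ≡ suc n} {Q = T (suc s) n}
          (λ { {a , b} (p , _) (q , _) → <-irrefl (sym (trans p (+-identityʳ s))) q })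
          (Card-× (F 0) (G (suc n)))
          (counts-from n (suc s) (f ∘ suc)
              (λ i → subst (λ k → Card (λ a → w a ≡ k) (f (suc i))) (+-suc s i) (F (suc i)))))
        where
        back : ∀ {x} → T s (suc n) x → (w (proj₁ x) ≡ s + 0 × v (proj₂ x) ≡ suc n) ⊎ T (suc s) n x
        back {a , b} (p , q) with m≤n⇒m<n∨m≡n p
        ... | inj₁ s<w = inj₂ (s<w , trans q (+-suc s n))
        ... | inj₂ refl = inj₁ (sym (+-identityʳ s) , +-cancelˡ-≡ s (v b) (suc n) q)

    Counts-conv : ∀ {f} → Counts w f → Counts (λ (a , b) → w a + v b) (conv f g)
    Counts-conv {f} F n = Card-cong (λ (_ , q) → q) (λ q → z≤n , q) (counts-from n 0 f F)

  -- Coefficient of q^i in the theta series summed over |x| ≤ n. The cutoff is a parameter because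
  -- Gauss' identity is proved for the partial sums.
  squaresUpTo : ℕ → ℕ → ℕ
  squaresUpTo zero    i = if 0 ≡ᵇ i then 1 else 0
  squaresUpTo (suc n) i = (if suc n * suc n ≡ᵇ i then 2 else 0) + squaresUpTo n i

  -- The cutoff `i` loses nothing, since x² = i forces |x| ≤ i.
  θ : ℕ → ℕ
  θ i = squaresUpTo i i

  sq : ℤ → ℕ
  sq x = ∣ x ∣ * ∣ x ∣

  Card-if : ∀ {A : Set} (P : A → Set) {n} (a b : ℕ) → Card P n → Card (λ x → P x × a ≡ b) (if a ≡ᵇ b then n else 0)
  Card-if P a b C with a ≡ᵇ b | ≡ᵇ⇒≡ a b | ≡⇒≡ᵇ a b
  ... | true  | f | _ = Card-cong (λ p → p , f _) proj₁ C
  ... | false | _ | g = Card-∅ (λ (_ , e) → g e)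

  Card-± : ∀ n → Card (λ x → ∣ x ∣ ≡ suc n) 2
  Card-± n = Card-cong {P = λ x → + suc n ≡ x ⊎ -[1+ n ] ≡ x}
    (λ { (inj₁ refl) → refl ; (inj₂ refl) → refl })
    (λ { {+ _} refl → inj₁ refl ; { -[1+ _ ]} refl → inj₂ refl })
    (Card-⊎ (λ { refl () }) (Card-singleton (+ suc n)) (Card-singleton -[1+ n ]))

  Card-squaresUpTo : ∀ n i → Card (λ x → ∣ x ∣ ≤ n × sq x ≡ i) (squaresUpTo n i)
  Card-squaresUpTo zero i = Card-cong {P = λ x → + 0 ≡ x × 0 ≡ i}
    (λ { (refl , e) → z≤n , e }) (λ { {+ 0} (_ , e) → refl , e })
    (Card-if (+ 0 ≡_) 0 i (Card-singleton (+ 0)))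
  Card-squaresUpTo (suc n) i = Card-cong
    (λ { {x} (inj₁ (p , e)) → ≤-reflexive p , trans (cong (λ k → k * k) p) e ; (inj₂ (p , e)) → m≤n⇒m≤1+n p , e })
    (λ {x} → back {x})
    (Card-⊎ {P = λ x → ∣ x ∣ ≡ suc n × suc n * suc n ≡ i} {Q = λ x → ∣ x ∣ ≤ n × sq x ≡ i}
      (λ {x} (p , _) (q , _) → <-irrefl p (s≤s q))
      (Card-if (λ x → ∣ x ∣ ≡ suc n) (suc n * suc n) i (Card-± n)) (Card-squaresUpTo n i))
    where
    back : ∀ {x} → ∣ x ∣ ≤ suc n × sq x ≡ i → (∣ x ∣ ≡ suc n × suc n * suc n ≡ i) ⊎ (∣ x ∣ ≤ n × sq x ≡ i)
    back {x} (p , e) with m≤n⇒m<n∨m≡n p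
    ... | inj₁ (s≤s q) = inj₂ (q , e)
    ... | inj₂ q = inj₁ (q , trans (cong (λ k → k * k) (sym q)) e)

  sq-bound : ∀ a {i} → a * a ≡ i → a ≤ i
  sq-bound zero e = z≤n
  sq-bound (suc a) refl = m≤m+n (suc a) (a * suc a)

  Counts-θ : Counts sq θ
  Counts-θ i = Card-cong proj₂ (λ {x} e → sq-bound ∣ x ∣ e , e) (Card-squaresUpTo i i)

  -- As convolutions these can be evaluated and correspond to products of power series; the two
  -- lemmas below give their counting meaning.
  r₃ r₄ : ℕ → ℕ
  r₃ = conv θ (conv θ θ)
  r₄ = conv θ r₃

  Counts-r₃ : Counts (λ (a , b , c) → sq a + (sq b + sq c)) r₃
  Counts-r₃ = Counts-conv (Counts-conv Counts-θ Counts-θ) Counts-θ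

  Counts-r₄ : Counts (λ (a , b , c , d) → sq a + (sq b + (sq c + sq d))) r₄
  Counts-r₄ = Counts-conv Counts-r₃ Counts-θ

-- Integral quaternions and their identities.

module Quaternions where
  open import Data.Integer using (ℤ; +_; _+_; _*_; -_; 0ℤ; 1ℤ)
  open import Data.Integer.Properties using (*-cancelˡ-≡)
  open import Data.Integer.Solver using (module +-*-Solver)
  open import Data.Fin.Patterns
  open import Data.Product using (_×_; _,_; proj₁; proj₂; ∃)
  open import Data.Vec using (Vec; []; _∷_)
  open import Relation.Binary.PropositionalEquality
  import Data.Integer as ℤ
  import Data.Fin as Fin
  open +-*-Solver using (Polynomial; con; var; _:+_; _:*_; :-_; prove; ⟦_⟧; ⟦_⟧↓)

  infix 4 _∣ℍ_
  infixl 6 _⊕_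
  infixl 7 _⊗_ _•_

  record Quat (A : Set) : Set where
    constructor quat
    field re im jm km : A
  open Quat public

  -- Parametrised by the ring operations, so that the same formulas apply to
  -- integers and to the polynomial expressions of the ring solver.
  module QuatOps {A : Set} (_+_ _*_ : A → A → A) (-_ : A → A) where
    mul add : Quat A → Quat A → Quat A
    mul (quat a b c d) (quat e f g h) = quat
      (((a * e) + (- (b * f))) + ((- (c * g)) + (- (d * h))))
      (((a * f) + (b * e)) + ((c * h) + (- (d * g))))
      (((a * g) + (- (b * h))) + ((c * e) + (d * f)))
      (((a * h) + (b * g)) + ((- (c * f)) + (d * e)))
    add (quat a b c d) (quat e f g h) = quat (a + e) (b + f) (c + g) (d + h)

    cnj : Quat A → Quat A
    cnj (quat a b c d) = quat a (- b) (- c) (- d)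

    scl : A → Quat A → Quat A
    scl k (quat a b c d) = quat (k * a) (k * b) (k * c) (k * d)

    nrm : Quat A → A
    nrm (quat a b c d) = ((a * a) + (b * b)) + ((c * c) + (d * d))

  ℍ : Set
  ℍ = Quat ℤ

  open QuatOps _+_ _*_ (-_)
  module P {n} = QuatOps {Polynomial n} _:+_ _:*_ :-_

  -- Opaque, so that terms stay in quaternion form and coordinates appear only where they are
  -- unfolded on purpose.
  opaque
    _⊗_ _⊕_ : ℍ → ℍ → ℍ
    _⊗_ = mul
    _⊕_ = add

    _•_ : ℤ → ℍ → ℍ
    _•_ = scl

    conj : ℍ → ℍ
    conj = cnj

    nm : ℍ → ℤ
    nm = nrm

  1ℍ 0ℍ : ℍ
  1ℍ = quat 1ℤ 0ℤ 0ℤ 0ℤ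
  0ℍ = quat 0ℤ 0ℤ 0ℤ 0ℤ

  quat≡ : ∀ {A : Set} {a b c d a′ b′ c′ d′ : A} → a ≡ a′ → b ≡ b′ → c ≡ c′ → d ≡ d′ →
    quat a b c d ≡ quat a′ b′ c′ d′
  quat≡ refl refl refl refl = refl

  infix 4 _≋_
  _≋_ : ∀ {n} → Quat (Polynomial n) → Quat (Polynomial n) → Quat (Polynomial n) × Quat (Polynomial n)
  _≋_ = _,_

  -- One scalar and three quaternions, 13 variables, cover every identity below; slots left over
  -- repeat an argument, and a further scalar travels as a coordinate of a quaternion.
  module _ (k : ℤ) (x y z : ℍ) where
    private
      env : Vec ℤ 13
      env = k ∷ re x ∷ im x ∷ jm x ∷ km x ∷ re y ∷ im y ∷ jm y ∷ km y ∷ re z ∷ im z ∷ jm z ∷ km z ∷ []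
      K : Polynomial 13
      K = var 0F
      X Y Z : Quat (Polynomial 13)
      X = quat (var 1F) (var 2F) (var 3F) (var 4F)
      Y = quat (var 5F) (var 6F) (var 7F) (var 8F)
      Z = quat (var 9F) (var (Fin.suc 9F)) (var (Fin.suc (Fin.suc 9F))) (var (Fin.suc (Fin.suc (Fin.suc 9F))))

      eval : Quat (Polynomial 13) → ℍ
      eval (quat a b c d) = quat (⟦ a ⟧ env) (⟦ b ⟧ env) (⟦ c ⟧ env) (⟦ d ⟧ env)

    solveℍ : (f : Polynomial 13 → (x y z : Quat (Polynomial 13)) → Quat (Polynomial 13) × Quat (Polynomial 13)) →
      let e = f K X Y Z; l = proj₁ e; r = proj₂ e in
      ⟦ re l ⟧↓ env ≡ ⟦ re r ⟧↓ env → ⟦ im l ⟧↓ env ≡ ⟦ im r ⟧↓ env →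
      ⟦ jm l ⟧↓ env ≡ ⟦ jm r ⟧↓ env → ⟦ km l ⟧↓ env ≡ ⟦ km r ⟧↓ env →
      eval l ≡ eval r
    solveℍ f p q r s = let e₁ , e₂ = f K X Y Z in
      quat≡ (prove env (re e₁) (re e₂) p) (prove env (im e₁) (im e₂) q)
            (prove env (jm e₁) (jm e₂) r) (prove env (km e₁) (km e₂) s)

    solveℤ : (f : Polynomial 13 → (x y z : Quat (Polynomial 13)) → Polynomial 13 × Polynomial 13) →
      let e = f K X Y Z; l = proj₁ e; r = proj₂ e in
      ⟦ l ⟧↓ env ≡ ⟦ r ⟧↓ env → ⟦ l ⟧ env ≡ ⟦ r ⟧ env
    solveℤ f p = prove env (proj₁ (f K X Y Z)) (proj₂ (f K X Y Z)) p

  ⟨_⟩ : ∀ {n} → Polynomial n → Quat (Polynomial n)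
  ⟨ k ⟩ = quat k (con 0ℤ) (con 0ℤ) (con 0ℤ)

  opaque
    unfolding _⊗_

    ⊗-assoc : ∀ x y z → (x ⊗ y) ⊗ z ≡ x ⊗ (y ⊗ z)
    ⊗-assoc x y z = solveℍ 0ℤ x y z
      (λ k x y z → P.mul (P.mul x y) z ≋ P.mul x (P.mul y z)) refl refl refl refl

    ⊗-distribˡ-⊕ : ∀ x y z → x ⊗ (y ⊕ z) ≡ x ⊗ y ⊕ x ⊗ z
    ⊗-distribˡ-⊕ x y z = solveℍ 0ℤ x y z
      (λ k x y z → P.mul x (P.add y z) ≋ P.add (P.mul x y) (P.mul x z)) refl refl refl refl

    ⊗-distribʳ-⊕ : ∀ x y z → (y ⊕ z) ⊗ x ≡ y ⊗ x ⊕ z ⊗ x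
    ⊗-distribʳ-⊕ x y z = solveℍ 0ℤ x y z
      (λ k x y z → P.mul (P.add y z) x ≋ P.add (P.mul y x) (P.mul z x)) refl refl refl refl

    ⊗-identityʳ : ∀ x → x ⊗ 1ℍ ≡ x
    ⊗-identityʳ x = solveℍ 0ℤ x x x (λ k x y z → P.mul x ⟨ con 1ℤ ⟩ ≋ x) refl refl refl refl

    conj-⊗ : ∀ x y → conj (x ⊗ y) ≡ conj y ⊗ conj x
    conj-⊗ x y = solveℍ 0ℤ x y y
      (λ k x y z → P.cnj (P.mul x y) ≋ P.mul (P.cnj y) (P.cnj x)) refl refl refl refl

    conj-⊕ : ∀ x y → conj (x ⊕ y) ≡ conj x ⊕ conj y
    conj-⊕ x y = solveℍ 0ℤ x y y
      (λ k x y z → P.cnj (P.add x y) ≋ P.add (P.cnj x) (P.cnj y)) refl refl refl refl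

    conj-• : ∀ k x → conj (k • x) ≡ k • conj x
    conj-• k x = solveℍ k x x x (λ k x y z → P.cnj (P.scl k x) ≋ P.scl k (P.cnj x)) refl refl refl refl

    •-⊗ˡ : ∀ k x y → (k • x) ⊗ y ≡ k • (x ⊗ y)
    •-⊗ˡ k x y = solveℍ k x y y
      (λ k x y z → P.mul (P.scl k x) y ≋ P.scl k (P.mul x y)) refl refl refl refl

    •-⊗ʳ : ∀ k x y → x ⊗ (k • y) ≡ k • (x ⊗ y)
    •-⊗ʳ k x y = solveℍ k x y y
      (λ k x y z → P.mul x (P.scl k y) ≋ P.scl k (P.mul x y)) refl refl refl refl

    •-distrib-⊕ : ∀ k x y → k • (x ⊕ y) ≡ k • x ⊕ k • y
    •-distrib-⊕ k x y = solveℍ k x y y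
      (λ k x y z → P.scl k (P.add x y) ≋ P.add (P.scl k x) (P.scl k y)) refl refl refl refl

    •-assoc : ∀ k l x → (k * l) • x ≡ k • (l • x)
    •-assoc k l x = solveℍ k (quat l l l l) x x
      (λ k l x z → P.scl (k :* re l) x ≋ P.scl k (P.scl (re l) x)) refl refl refl refl

    •-identity : ∀ x → 1ℤ • x ≡ x
    •-identity x = solveℍ 0ℤ x x x (λ k x y z → P.scl (con 1ℤ) x ≋ x) refl refl refl refl

    conj-⊗-⊗ : ∀ x y → conj x ⊗ (x ⊗ y) ≡ nm x • y
    conj-⊗-⊗ x y = solveℍ 0ℤ x y y
      (λ k x y z → P.mul (P.cnj x) (P.mul x y) ≋ P.scl (P.nrm x) y) refl refl refl refl

    ⊗-conj-⊗ : ∀ x y → x ⊗ (conj x ⊗ y) ≡ nm x • y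
    ⊗-conj-⊗ x y = solveℍ 0ℤ x y y
      (λ k x y z → P.mul x (P.mul (P.cnj x) y) ≋ P.scl (P.nrm x) y) refl refl refl refl

    ⊗-⊗-conj : ∀ x y → (y ⊗ x) ⊗ conj x ≡ nm x • y
    ⊗-⊗-conj x y = solveℍ 0ℤ x y y
      (λ k x y z → P.mul (P.mul y x) (P.cnj x) ≋ P.scl (P.nrm x) y) refl refl refl refl

    ⊗-conj-⊗ʳ : ∀ x y → (y ⊗ conj x) ⊗ x ≡ nm x • y
    ⊗-conj-⊗ʳ x y = solveℍ 0ℤ x y y
      (λ k x y z → P.mul (P.mul y (P.cnj x)) x ≋ P.scl (P.nrm x) y) refl refl refl refl

    nm-⊗ : ∀ x y → nm (x ⊗ y) ≡ nm x * nm y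
    nm-⊗ x y = solveℤ 0ℤ x y y (λ k x y z → P.nrm (P.mul x y) , P.nrm x :* P.nrm y) refl

    nm-• : ∀ k x → nm (k • x) ≡ k * k * nm x
    nm-• k x = solveℤ k x x x (λ k x y z → P.nrm (P.scl k x) , (k :* k) :* P.nrm x) refl

    nm-conj : ∀ x → nm (conj x) ≡ nm x
    nm-conj x = solveℤ 0ℤ x x x (λ k x y z → P.nrm (P.cnj x) , P.nrm x) refl

    •-cancelˡ : ∀ k .{{_ : ℤ.NonZero k}} {x y} → k • x ≡ k • y → x ≡ y
    •-cancelˡ k {x} {y} eq = quat≡
      (*-cancelˡ-≡ k (re x) (re y) (cong re eq)) (*-cancelˡ-≡ k (im x) (im y) (cong im eq))
      (*-cancelˡ-≡ k (jm x) (jm y) (cong jm eq)) (*-cancelˡ-≡ k (km x) (km y) (cong km eq))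

  _∣ℍ_ : ℤ → ℍ → Set
  k ∣ℍ x = ∃ λ z → x ≡ k • z

  ∣ℍ-⊕ : ∀ {k x y} → k ∣ℍ x → k ∣ℍ y → k ∣ℍ x ⊕ y
  ∣ℍ-⊕ {k} (a , refl) (b , refl) = a ⊕ b , sym (•-distrib-⊕ k a b)

  ∣ℍ-⊗ˡ : ∀ {k} x {y} → k ∣ℍ y → k ∣ℍ x ⊗ y
  ∣ℍ-⊗ˡ {k} x (b , refl) = x ⊗ b , •-⊗ʳ k x b

  ∣ℍ-⊗ʳ : ∀ {k x} y → k ∣ℍ x → k ∣ℍ x ⊗ y
  ∣ℍ-⊗ʳ {k} y (b , refl) = b ⊗ y , •-⊗ˡ k b y

  ∣ℍ-• : ∀ k x → k ∣ℍ k • x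
  ∣ℍ-• k x = x , refl

  ∣ℍ-conj : ∀ {k x} → k ∣ℍ x → k ∣ℍ conj x
  ∣ℍ-conj {k} (b , refl) = conj b , conj-• k b

-- Centred residues of quaternions.

module Residues where
  open Cardinality
  open ThetaCoefficients
  open Quaternions
  open import Data.Empty using (⊥-elim)
  open import Data.Integer using (ℤ; +_; -[1+_]; ∣_∣; 0ℤ; 1ℤ)
  open import Data.Integer.DivMod using (_/ℕ_; _%ℕ_; n%ℕd<d; a≡a%ℕn+[a/ℕn]*n)
  open import Data.Integer.Solver using (module +-*-Solver)
  open import Data.Nat
  open import Data.Nat.Properties
  open import Data.Nat.Solver using () renaming (module +-*-Solver to ℕ-Solver)
  open import Data.Product using (_×_; _,_; ∃₂)
  open import Data.Sum using (inj₁; inj₂)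
  open import Relation.Nullary using (yes; no)
  open import Relation.Binary.PropositionalEquality
  open import Relation.Binary.Definitions using (tri<; tri≈; tri>)
  import Data.Integer as ℤ
  import Data.Integer.Properties as ℤ

  sq-ℤ : ∀ x → x ℤ.* x ≡ + sq x
  sq-ℤ (+ n) = sym (ℤ.pos-* n n)
  sq-ℤ -[1+ n ] = refl

  nmℕ : ℍ → ℕ
  nmℕ x = sq (re x) + (sq (im x) + (sq (jm x) + sq (km x)))

  opaque
    unfolding _⊗_

    nm-nmℕ : ∀ x → nm x ≡ + nmℕ x
    nm-nmℕ (quat a b c d) = trans
      (cong₂ ℤ._+_ (cong₂ ℤ._+_ (sq-ℤ a) (sq-ℤ b)) (cong₂ ℤ._+_ (sq-ℤ c) (sq-ℤ d)))
      (cong +_ (+-assoc (sq a) (sq b) (sq c + sq d)))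

  nmℕ-nm : ∀ {x n} → nm x ≡ + n → nmℕ x ≡ n
  nmℕ-nm {x} e = ℤ.+-injective (trans (sym (nm-nmℕ x)) e)

  Card-nm : ∀ n → Card (λ x → nm x ≡ + n) (r₄ n)
  Card-nm n = Card-bijection (λ (a , b , c , d) → quat a b c d)
    (λ { {a , b , c , d} e → trans (nm-nmℕ (quat a b c d)) (cong +_ e) })
    (λ { _ _ refl → refl }) (λ {x} e → _ , nmℕ-nm {x} e , refl) (Counts-r₄ n)

  sq-0 : ∀ x → sq x ≡ 0 → x ≡ 0ℤ
  sq-0 (+ 0) _ = refl

  nm≡0⇒0ℍ : ∀ x → nm x ≡ 0ℤ → x ≡ 0ℍ
  nm≡0⇒0ℍ x e = quat≡ (sq-0 (re x) (m+n≡0⇒m≡0 (sq (re x)) e′)) (sq-0 (im x) (m+n≡0⇒m≡0 (sq (im x)) e₁))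
    (sq-0 (jm x) (m+n≡0⇒m≡0 (sq (jm x)) e₂)) (sq-0 (km x) (m+n≡0⇒n≡0 (sq (jm x)) e₂))
    where
    e′ = nmℕ-nm {x} e
    e₁ = m+n≡0⇒n≡0 (sq (re x)) e′
    e₂ = m+n≡0⇒n≡0 (sq (im x)) e₁

  private
    module S = +-*-Solver

    round-down : ∀ {a} r q m → a ≡ r ℤ.+ q ℤ.* m → r ≡ a ℤ.+ m ℤ.* ℤ.- q
    round-down r q m refl = S.solve 3
      (λ r q m → r S.:= (r S.:+ q S.:* m) S.:+ m S.:* (S.:- q)) refl r q m

    round-up : ∀ {a m} r q d → a ≡ r ℤ.+ q ℤ.* m → m ≡ r ℤ.+ d → ℤ.- d ≡ a ℤ.+ m ℤ.* ℤ.- (1ℤ ℤ.+ q)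
    round-up r q d refl refl = S.solve 3
      (λ r q d → S.:- d S.:= (r S.:+ q S.:* (r S.:+ d)) S.:+ (r S.:+ d) S.:* (S.:- (S.con 1ℤ S.:+ q))) refl r q d

  -- Ties are resolved upwards: a residue with 2|r| = m is +m/2. This leaves a single extremal
  -- residue in `centerℍ`.
  center : ∀ m .{{_ : NonZero m}} a → ∃₂ λ r g →
    r ≡ a ℤ.+ + m ℤ.* g × 2 * ∣ r ∣ ≤ m × (2 * ∣ r ∣ ≡ m → + 2 ℤ.* r ≡ + m)
  center m a with 2 * (a %ℕ m) ≤? m
  ... | yes le = + (a %ℕ m) , ℤ.- (a /ℕ m) ,
    round-down (+ (a %ℕ m)) (a /ℕ m) (+ m) (a≡a%ℕn+[a/ℕn]*n a m) ,
    le , λ e → trans (sym (ℤ.pos-* 2 (a %ℕ m))) (cong +_ e)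
  ... | no ¬le = ℤ.- + d , ℤ.- (1ℤ ℤ.+ a /ℕ m) ,
    round-up (+ r₀) (a /ℕ m) (+ d) (a≡a%ℕn+[a/ℕn]*n a m) (cong +_ (sym r+d)) ,
    <⇒≤ lt , λ e → ⊥-elim (<-irrefl e lt)
    where
    r₀ = a %ℕ m
    d = m ∸ r₀
    r+d : r₀ + d ≡ m
    r+d = m+[n∸m]≡n (<⇒≤ (n%ℕd<d a m))
    lt : 2 * ∣ ℤ.- + d ∣ < m
    lt rewrite ℤ.∣-i∣≡∣i∣ (+ d) = +-cancelˡ-< (2 * r₀) (2 * d) m (begin-strict
      2 * r₀ + 2 * d ≡⟨ sym (*-distribˡ-+ 2 r₀ d) ⟩
      2 * (r₀ + d)   ≡⟨ cong (2 *_) r+d ⟩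
      2 * m          ≡⟨ cong (λ k → m + k) (+-identityʳ m) ⟩
      m + m          <⟨ +-monoˡ-< m (≰⇒> ¬le) ⟩
      2 * r₀ + m     ∎)
      where open ≤-Reasoning

  +-≤-equality : ∀ {a b M K} → a ≤ M → b ≤ K → a + b ≡ M + K → a ≡ M × b ≡ K
  +-≤-equality {a} {b} {M} {K} p q e with m≤n⇒m<n∨m≡n p
  ... | inj₁ a<M = ⊥-elim (<-irrefl e (+-mono-<-≤ a<M q))
  ... | inj₂ refl = refl , +-cancelˡ-≡ a b K e

  square-injective : ∀ {a b} → a * a ≡ b * b → a ≡ b
  square-injective {a} {b} e with <-cmp a b
  ... | tri< lt _ _ = ⊥-elim (<-irrefl e (*-mono-< lt lt))
  ... | tri≈ _ eq _ = eq
  ... | tri> _ _ gt = ⊥-elim (<-irrefl (sym e) (*-mono-< gt gt))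

  Jℍ : ℍ
  Jℍ = quat 1ℤ 1ℤ 1ℤ 1ℤ

  opaque
    unfolding _⊗_

    -- With 2|r| ≤ m in each coordinate, four times the norm is a sum of four squares, each at most
    -- m². Equality of the sums forces equality in every coordinate, and then every coordinate is
    -- m/2.
    centerℍ : ∀ m .{{_ : NonZero m}} α → ∃₂ λ β γ → β ≡ α ⊕ + m • γ × nmℕ β ≤ m * m ×
      (nmℕ β ≡ m * m → + 2 • β ≡ + m • Jℍ)
    centerℍ m α with center m (re α) | center m (im α) | center m (jm α) | center m (km α)
    ... | a , a′ , ea , la , qa | b , b′ , eb , lb , qb | c , c′ , ec , lc , qc | d , d′ , ed , ld , qd =
      quat a b c d , quat a′ b′ c′ d′ , quat≡ ea eb ec ed ,
      *-cancelˡ-≤ 4 (subst₂ _≤_ four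
          (ℕ-Solver.solve 1 (λ s → s :+′ (s :+′ (s :+′ s)) :=′ con′ 4 :*′ s) refl (m * m)) bound) ,
      λ e → let
        s≡ = trans four (trans (cong (4 *_) e)
            (ℕ-Solver.solve 1 (λ s → con′ 4 :*′ s :=′ s :+′ (s :+′ (s :+′ s))) refl (m * m)))
        ea , r₁ = +-≤-equality (*-mono-≤ la la)
            (+-mono-≤ (*-mono-≤ lb lb) (+-mono-≤ (*-mono-≤ lc lc) (*-mono-≤ ld ld))) s≡
        eb , r₂ = +-≤-equality (*-mono-≤ lb lb) (+-mono-≤ (*-mono-≤ lc lc) (*-mono-≤ ld ld)) r₁
        ec , ed = +-≤-equality (*-mono-≤ lc lc) (*-mono-≤ ld ld) r₂
        m1 = sym (ℤ.*-identityʳ (+ m))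
        in quat≡ (trans (qa (square-injective ea)) m1) (trans (qb (square-injective eb)) m1)
            (trans (qc (square-injective ec)) m1) (trans (qd (square-injective ed)) m1)
      where
      open ℕ-Solver using () renaming (_:+_ to _:+′_; _:*_ to _:*′_; _:=_ to _:=′_; con to con′)
      dbl : ℤ → ℕ
      dbl x = 2 * ∣ x ∣ * (2 * ∣ x ∣)
      bound : dbl a + (dbl b + (dbl c + dbl d)) ≤ m * m + (m * m + (m * m + m * m))
      bound = +-mono-≤ (*-mono-≤ la la) (+-mono-≤ (*-mono-≤ lb lb) (+-mono-≤ (*-mono-≤ lc lc) (*-mono-≤ ld ld)))
      four : dbl a + (dbl b + (dbl c + dbl d)) ≡ 4 * nmℕ (quat a b c d)
      four = ℕ-Solver.solve 4
          (λ a b c d → (con′ 2 :*′ a :*′ (con′ 2 :*′ a)) :+′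
          ((con′ 2 :*′ b :*′ (con′ 2 :*′ b)) :+′
          ((con′ 2 :*′ c :*′ (con′ 2 :*′ c)) :+′ (con′ 2 :*′ d :*′ (con′ 2 :*′ d))))
        :=′ con′ 4 :*′ (a :*′ a :+′ (b :*′ b :+′ (c :*′ c :+′ d :*′ d)))) refl (∣ a ∣) (∣ b ∣) (∣ c ∣) (∣ d ∣)

-- Lagrange's descent in a right ideal.

module LagrangeDescent where
  open Cardinality
  open ThetaCoefficients
  open Quaternions
  open Residues
  open import Data.Empty using (⊥-elim)
  open import Data.Integer using (ℤ; +_; ∣_∣; 0ℤ; 1ℤ)
  open import Data.Integer.Solver using (module +-*-Solver)
  open import Data.Nat
  open import Data.Nat.Divisibility using (m∣m*n) renaming (_∣_ to _∣ℕ_)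
  open import Data.Nat.Induction using (<-rec)
  open import Data.Nat.Primality using (Prime; prime⇒irreducible; prime⇒nonZero)
  open import Data.Nat.Properties
  open import Data.Product using (_×_; _,_; ∃; ∃₂; proj₁; proj₂)
  open import Data.Sum using (inj₁; inj₂)
  open import Relation.Nullary using (¬_)
  open import Relation.Binary.PropositionalEquality
  import Data.Integer as ℤ
  import Data.Integer.Properties as ℤ
  open +-*-Solver using (con; _:+_; _:*_; :-_)

  pos-factor : ∀ m {n} .{{_ : NonZero m}} {k} → + n ≡ + m ℤ.* k → ∃ λ q → k ≡ + q × n ≡ m * q
  pos-factor m {n} {k} e = ∣ k ∣ , ℤ.*-cancelˡ-≡ (+ m) k (+ ∣ k ∣)
      (trans (sym e) (trans (cong +_ n≡) (ℤ.pos-* m ∣ k ∣))) , n≡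
    where
    n≡ : n ≡ m * ∣ k ∣
    n≡ = trans (cong ∣_∣ e) (ℤ.abs-* (+ m) k)

  module _ {p : ℕ} (pr : Prime p) where

    no-factor : ∀ {m} → 1 < m → m < p → ∀ k → + p ≢ + m ℤ.* k
    no-factor {m} 1<m m<p k e with prime⇒irreducible pr
        (subst (m ∣ℕ_) (sym (trans (cong ∣_∣ e) (ℤ.abs-* (+ m) k))) (m∣m*n ∣ k ∣))
    ... | inj₁ refl = <-irrefl refl 1<m
    ... | inj₂ refl = <-irrefl refl m<p

  opaque
    unfolding _⊗_

    nm-shift : ∀ m α γ → nm (α ⊕ m • γ) ≡
      nm α ℤ.+ m ℤ.* (+ 2 ℤ.* re (α ⊗ conj γ) ℤ.+ m ℤ.* nm γ)
    nm-shift m α γ = solveℤ m α γ γ (λ m α γ _ → P.nrm (P.add α (P.scl m γ)) ,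
      P.nrm α :+ m :* (con (+ 2) :* re (P.mul α (P.cnj γ)) :+ m :* P.nrm γ)) refl

    •-collect : ∀ k a b → k • 1ℍ ⊕ (a ⊕ k • b) ≡ a ⊕ k • (1ℍ ⊕ b)
    •-collect k a b = solveℍ k a b b (λ k a b _ →
      P.add (P.scl k ⟨ con 1ℤ ⟩) (P.add a (P.scl k b)) ≋ P.add a (P.scl k (P.add ⟨ con 1ℤ ⟩ b))) refl refl refl refl

    ⊕-•-cancel : ∀ k a b → (a ⊕ k • b) ⊕ k • ((ℤ.- 1ℤ) • b) ≡ a
    ⊕-•-cancel k a b = solveℍ k a b b (λ k a b _ →
      P.add (P.add a (P.scl k b)) (P.scl k (P.scl (:- con 1ℤ) b)) ≋ a) refl refl refl refl

    ⊕-identityˡ : ∀ a → 0ℍ ⊕ a ≡ a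
    ⊕-identityˡ a = solveℍ 0ℤ a a a (λ _ a _ _ → P.add ⟨ con 0ℤ ⟩ a ≋ a) refl refl refl refl

    ⊗-conj-shift : ∀ m α γ → α ⊗ conj (α ⊕ m • γ) ≡ nm α • 1ℍ ⊕ m • (α ⊗ conj γ)
    ⊗-conj-shift m α γ = solveℍ m α γ γ (λ m α γ _ → P.mul α (P.cnj (P.add α (P.scl m γ)))
      ≋ P.add (P.scl (P.nrm α) ⟨ con 1ℤ ⟩) (P.scl m (P.mul α (P.cnj γ)))) refl refl refl refl

    nm-zero-shift : ∀ m γ → nm (0ℍ ⊕ m • ((ℤ.- 1ℤ) • γ)) ≡ m ℤ.* (m ℤ.* nm γ)
    nm-zero-shift m γ = solveℤ m γ γ γ (λ m γ _ _ →
      P.nrm (P.add ⟨ con 0ℤ ⟩ (P.scl m (P.scl (:- con 1ℤ) γ))) , m :* (m :* P.nrm γ)) refl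

    nm-double-shift : ∀ m α γ → + 4 ℤ.* nm α ≡ nm (+ 2 • (α ⊕ m • γ) ⊕ (ℤ.- (+ 2 ℤ.* m)) • γ)
    nm-double-shift m α γ = solveℤ m α γ γ (λ m α γ _ → con (+ 4) :* P.nrm α ,
      P.nrm (P.add (P.scl (con (+ 2)) (P.add α (P.scl m γ))) (P.scl (:- (con (+ 2) :* m)) γ))) refl

    nm-half : ∀ m γ → nm (m • Jℍ ⊕ (ℤ.- (+ 2 ℤ.* m)) • γ) ≡
      + 4 ℤ.* (m ℤ.* (m ℤ.* (1ℤ ℤ.+ ℤ.- (re γ ℤ.+ im γ ℤ.+ jm γ ℤ.+ km γ) ℤ.+ nm γ)))
    nm-half m γ = solveℤ m γ γ γ (λ m γ _ _ →
      P.nrm (P.add (P.scl m (quat (con 1ℤ) (con 1ℤ) (con 1ℤ) (con 1ℤ))) (P.scl (:- (con (+ 2) :* m)) γ)) ,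
      con (+ 4) :* (m :* (m :* (con 1ℤ :+ :- (re γ :+ im γ :+ jm γ :+ km γ) :+ P.nrm γ)))) refl

    half-re : ∀ {m x} → + 2 • x ≡ m • Jℍ → + 2 ℤ.* re x ≡ m
    half-re {m} e = trans (cong re e) (ℤ.*-identityʳ m)

  -- The quaternion is αβ̄/m for the residue β = α + mγ: since αβ̄ = nm(α) + m αγ̄ and m divides
  -- nm(α), the division is exact.
  quotient-nm : ∀ m .{{_ : ℤ.NonZero m}} α γ {k k′} → nm α ≡ m ℤ.* k → nm (α ⊕ m • γ) ≡ m ℤ.* k′ →
    nm (k • 1ℍ ⊕ α ⊗ conj γ) ≡ k ℤ.* k′
  quotient-nm m α γ {k} {k′} e e′ = ℤ.*-cancelˡ-≡ m _ _ (ℤ.*-cancelˡ-≡ m _ _ (begin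
    m ℤ.* (m ℤ.* nm δ)                   ≡⟨ sym (ℤ.*-assoc m m (nm δ)) ⟩
    m ℤ.* m ℤ.* nm δ                     ≡⟨ sym (nm-• m δ) ⟩
    nm (m • δ)                           ≡⟨ cong nm mδ ⟩
    nm (α ⊗ conj (α ⊕ m • γ))            ≡⟨ nm-⊗ α (conj (α ⊕ m • γ)) ⟩
    nm α ℤ.* nm (conj (α ⊕ m • γ))       ≡⟨ cong₂ ℤ._*_ e (trans (nm-conj (α ⊕ m • γ)) e′) ⟩
    (m ℤ.* k) ℤ.* (m ℤ.* k′)             ≡⟨
        S.solve 3 (λ m k k′ → (m S.:* k) S.:* (m S.:* k′) S.:= m S.:* (m S.:* (k S.:* k′))) refl m k k′ ⟩
    m ℤ.* (m ℤ.* (k ℤ.* k′))             ∎))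
    where
    open ≡-Reasoning
    module S = +-*-Solver
    δ = k • 1ℍ ⊕ α ⊗ conj γ
    mδ : m • δ ≡ α ⊗ conj (α ⊕ m • γ)
    mδ = begin
      m • δ ≡⟨ trans (•-distrib-⊕ m (k • 1ℍ) _) (cong (_⊕ m • (α ⊗ conj γ)) (sym (•-assoc m k 1ℍ))) ⟩
      (m ℤ.* k) • 1ℍ ⊕ m • (α ⊗ conj γ) ≡⟨ cong (λ t → t • 1ℍ ⊕ m • (α ⊗ conj γ)) (sym e) ⟩
      nm α • 1ℍ ⊕ m • (α ⊗ conj γ) ≡⟨ sym (⊗-conj-shift m α γ) ⟩
      α ⊗ conj (α ⊕ m • γ) ∎

  -- A residue of α modulo m with coordinates in (−m/2, m/2] has norm at most m², with
  -- equality only if all of them are m/2. That case forces m² ∣ nm α just as the zero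
  -- residue does, so that even m needs no separate step in the descent.
  module _ (m : ℤ) .{{_ : ℤ.NonZero m}} (α γ : ℍ) {k : ℤ} (e : nm α ≡ m ℤ.* k) where
    private module S = +-*-Solver

    residue-zero : α ⊕ m • γ ≡ 0ℍ → ∃ λ t → k ≡ m ℤ.* t
    residue-zero z = nm γ , ℤ.*-cancelˡ-≡ m _ _ (trans (sym e) (begin
      nm α ≡⟨ cong nm (sym (⊕-•-cancel m α γ)) ⟩
      nm ((α ⊕ m • γ) ⊕ m • ((ℤ.- 1ℤ) • γ)) ≡⟨ cong (λ t → nm (t ⊕ m • ((ℤ.- 1ℤ) • γ))) z ⟩
      nm (0ℍ ⊕ m • ((ℤ.- 1ℤ) • γ)) ≡⟨ nm-zero-shift m γ ⟩
      m ℤ.* (m ℤ.* nm γ) ∎))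
      where open ≡-Reasoning

    residue-half : + 2 • (α ⊕ m • γ) ≡ m • Jℍ → ∃ λ t → k ≡ m ℤ.* t
    residue-half z = _ , ℤ.*-cancelˡ-≡ m _ _ (trans (sym e) (ℤ.*-cancelˡ-≡ (+ 4) _ _ (begin
      + 4 ℤ.* nm α ≡⟨ nm-double-shift m α γ ⟩
      nm (+ 2 • (α ⊕ m • γ) ⊕ (ℤ.- (+ 2 ℤ.* m)) • γ) ≡⟨ cong (λ t → nm (t ⊕ (ℤ.- (+ 2 ℤ.* m)) • γ)) z ⟩
      nm (m • Jℍ ⊕ (ℤ.- (+ 2 ℤ.* m)) • γ) ≡⟨ nm-half m γ ⟩
      + 4 ℤ.* (m ℤ.* (m ℤ.* (1ℤ ℤ.+ ℤ.- (re γ ℤ.+ im γ ℤ.+ jm γ ℤ.+ km γ) ℤ.+ nm γ))) ∎)))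
      where open ≡-Reasoning

  -- By `nm-shift` the norm of the residue is still a multiple of m, and it is at most m², so its
  -- cofactor is at most m.
  centered-norm : ∀ m .{{_ : NonZero m}} α {k} → nm α ≡ + m ℤ.* k →
    ∃₂ λ γ m′ → nm (α ⊕ + m • γ) ≡ + m ℤ.* + m′ × m′ ≤ m × (m′ ≡ m → + 2 • (α ⊕ + m • γ) ≡ + m • Jℍ)
  centered-norm m α {k} e with centerℍ m α
  ... | β , γ , β≡ , le , half = γ , q , trans (cong nm (sym β≡)) (trans (nm-nmℕ β) (trans (cong +_ e′) (ℤ.pos-* m q))) ,
    *-cancelˡ-≤ {q} {m} m (subst (_≤ m * m) e′ le) ,
    λ q≡m → subst (λ b → + 2 • b ≡ + m • Jℍ) β≡ (half (trans e′ (cong (m *_) q≡m)))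
    where
    t = + 2 ℤ.* re (α ⊗ conj γ) ℤ.+ + m ℤ.* nm γ
    nβ : + nmℕ β ≡ + m ℤ.* (k ℤ.+ t)
    nβ = begin
      + nmℕ β                      ≡⟨ sym (nm-nmℕ β) ⟩
      nm β                         ≡⟨ cong nm β≡ ⟩
      nm (α ⊕ + m • γ)             ≡⟨ nm-shift (+ m) α γ ⟩
      nm α ℤ.+ + m ℤ.* t           ≡⟨ cong (ℤ._+ + m ℤ.* t) e ⟩
      + m ℤ.* k ℤ.+ + m ℤ.* t      ≡⟨ sym (ℤ.*-distribˡ-+ (+ m) k t) ⟩
      + m ℤ.* (k ℤ.+ t)            ∎
      where open ≡-Reasoning
    fac = pos-factor m {nmℕ β} {k ℤ.+ t} nβ
    q = proj₁ fac
    e′ : nmℕ β ≡ m * q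
    e′ = proj₂ (proj₂ fac)

  module Descent {p : ℕ} (pr : Prime p) (p≥3 : p ≥ 3) (y : ℍ) where
    private instance
      p≢0 : NonZero p
      p≢0 = prime⇒nonZero pr

    Ideal : ℍ → Set
    Ideal α = ∃₂ λ u v → α ≡ y ⊗ u ⊕ + p • v

    -- When nm α = mp, the quotient αβ̄/m is p + αγ̄. In this form it visibly lies in the ideal,
    -- although it arose from a division.
    Ideal-⊗ : ∀ {α} w → Ideal α → Ideal (+ p • 1ℍ ⊕ α ⊗ w)
    Ideal-⊗ w (u , v , refl) = u ⊗ w , 1ℍ ⊕ v ⊗ w , (begin
      + p • 1ℍ ⊕ (y ⊗ u ⊕ + p • v) ⊗ w
          ≡⟨ cong (+ p • 1ℍ ⊕_) (trans (⊗-distribʳ-⊕ w (y ⊗ u) (+ p • v)) (cong₂ _⊕_ (⊗-assoc y u w) (•-⊗ˡ (+ p) v w))) ⟩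
      + p • 1ℍ ⊕ (y ⊗ (u ⊗ w) ⊕ + p • (v ⊗ w)) ≡⟨ •-collect (+ p) (y ⊗ (u ⊗ w)) (v ⊗ w) ⟩
      y ⊗ (u ⊗ w) ⊕ + p • (1ℍ ⊕ v ⊗ w) ∎)
      where open ≡-Reasoning

    Found : Set
    Found = ∃ λ α → Ideal α × nm α ≡ + p

    -- The zero and the extremal residue would both give m ∣ p, which 1 < m < p excludes; for every
    -- other residue the cofactor drops strictly.
    descend : ∀ m → 0 < m → m < p → ∀ α → Ideal α → nm α ≡ + m ℤ.* + p → Found
    descend = <-rec _ step
      where
      step : ∀ m → (∀ {m′} → m′ < m → 0 < m′ → m′ < p → ∀ α → Ideal α → nm α ≡ + m′ ℤ.* + p → Found) →
        0 < m → m < p → ∀ α → Ideal α → nm α ≡ + m ℤ.* + p → Found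
      step 1 _ _ _ α I e = α , I , trans e (ℤ.*-identityˡ (+ p))
      step m@(2+ _) rec _ m<p α I e with centered-norm m α {+ p} e
      ... | γ , zero , e′ , _ , _ = let t , e″ = residue-zero (+ m) α γ {+ p} e (nm≡0⇒0ℍ (α ⊕ + m • γ) (trans e′ (ℤ.*-zeroʳ (+ m)))) in
              ⊥-elim (no-factor pr (s≤s (s≤s z≤n)) m<p t e″)
      ... | γ , m′@(suc _) , e′ , le , half with m≤n⇒m<n∨m≡n le
      ...   | inj₂ m′≡m = let t , e″ = residue-half (+ m) α γ {+ p} e (half m′≡m) in ⊥-elim (no-factor pr (s≤s (s≤s z≤n)) m<p t e″)
      ...   | inj₁ m′<m = rec m′<m (s≤s z≤n) (<-trans m′<m m<p) (+ p • 1ℍ ⊕ α ⊗ conj γ) (Ideal-⊗ (conj γ) I)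
                (trans (quotient-nm (+ m) α γ {+ p} {+ m′} e e′) (ℤ.*-comm (+ p) (+ m′)))

    p-odd : ∀ r → + 2 ℤ.* r ≢ + p
    p-odd r e with prime⇒irreducible pr (subst (2 ∣ℕ_) (trans (sym (ℤ.abs-* (+ 2) r)) (cong ∣_∣ e)) (m∣m*n ∣ r ∣))
    ... | inj₂ refl = <-irrefl refl p≥3

    opaque
      -- One reduction of y modulo p starts the descent. Cofactor 0 would mean p ∣ y; cofactor p
      -- would make every coordinate p/2, impossible for odd p.
      exists-generator : ∀ {k} → nm y ≡ + p ℤ.* k → ¬ (+ p ∣ℍ y) → Found
      exists-generator e p∤y with centered-norm p y e
      ... | γ , zero , e′ , _ , _ = ⊥-elim (p∤y ((ℤ.- 1ℤ) • γ , (begin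
          y ≡⟨ sym (⊕-•-cancel (+ p) y γ) ⟩
          (y ⊕ + p • γ) ⊕ + p • ((ℤ.- 1ℤ) • γ)
              ≡⟨ cong (_⊕ + p • ((ℤ.- 1ℤ) • γ)) (nm≡0⇒0ℍ (y ⊕ + p • γ) (trans e′ (ℤ.*-zeroʳ (+ p)))) ⟩
          0ℍ ⊕ + p • ((ℤ.- 1ℤ) • γ) ≡⟨ ⊕-identityˡ _ ⟩
          + p • ((ℤ.- 1ℤ) • γ) ∎)))
          where open ≡-Reasoning
      ... | γ , m′@(suc _) , e′ , le , half with m≤n⇒m<n∨m≡n le
      ...   | inj₂ m′≡p = ⊥-elim (p-odd _ (half-re (half m′≡p)))
      ...   | inj₁ m′<p = descend m′ (s≤s z≤n) m′<p (y ⊕ + p • γ) (1ℍ , γ , cong (_⊕ + p • γ) (sym (⊗-identityʳ y)))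
                  (trans e′ (ℤ.*-comm (+ p) (+ m′)))

-- Quaternions of norm p that divide a given one.

module NormDivisors where
  open Cardinality
  open ThetaCoefficients
  open Quaternions
  open Residues
  open LagrangeDescent
  open import Data.Empty using (⊥-elim)
  open import Data.Integer using (ℤ; +_; ∣_∣; 0ℤ; 1ℤ)
  open import Data.Integer.Divisibility.Signed using (divides; ∣⇒∣ᵤ; ∣ᵤ⇒∣) renaming (_∣_ to _∣ℤ_)
  open import Data.Integer.Solver using (module +-*-Solver)
  open import Data.Nat using (ℕ; _≥_; NonZero)
  open import Data.Nat.Divisibility using (∣⇒≤) renaming (_∣_ to _∣ℕ_)
  open import Data.Nat.Primality using (Prime; euclidsLemma; prime⇒nonZero)
  open import Data.Product using (_×_; _,_; ∃; proj₁; proj₂)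
  open import Data.Sum using (inj₁; inj₂; _⊎_)
  open import Relation.Nullary using (¬_)
  open import Relation.Binary.PropositionalEquality
  import Data.Nat.Properties as ℕ
  import Data.Integer as ℤ
  import Data.Integer.Properties as ℤ
  open +-*-Solver using (con; _:*_; :-_)

  iℍ jℍ kℍ : ℍ
  iℍ = quat 0ℤ 1ℤ 0ℤ 0ℤ
  jℍ = quat 0ℤ 0ℤ 1ℤ 0ℤ
  kℍ = quat 0ℤ 0ℤ 0ℤ 1ℤ

  opaque
    unfolding _⊗_

    ∣ℍ⇒∣ : ∀ {k x} → k ∣ℍ x → k ∣ℤ re x × k ∣ℤ im x × k ∣ℤ jm x × k ∣ℤ km x
    ∣ℍ⇒∣ {k} (quat a b c d , refl) =
      divides a (ℤ.*-comm k a) , divides b (ℤ.*-comm k b) , divides c (ℤ.*-comm k c) , divides d (ℤ.*-comm k d)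

    ∣⇒∣ℍ : ∀ {k x} → k ∣ℤ re x → k ∣ℤ im x → k ∣ℤ jm x → k ∣ℤ km x → k ∣ℍ x
    ∣⇒∣ℍ {k} (divides a e) (divides b f) (divides c g) (divides d h) = quat a b c d ,
      quat≡ (trans e (ℤ.*-comm a k)) (trans f (ℤ.*-comm b k)) (trans g (ℤ.*-comm c k)) (trans h (ℤ.*-comm d k))

    re-• : ∀ k x → re (k • x) ≡ k ℤ.* re x
    re-• k x = refl

    im-• : ∀ k x → im (k • x) ≡ k ℤ.* im x
    im-• k x = refl

    jm-• : ∀ k x → jm (k • x) ≡ k ℤ.* jm x
    jm-• k x = refl

    km-• : ∀ k x → km (k • x) ≡ k ℤ.* km x
    km-• k x = refl

    ∣ℍ-cancel : ∀ {k x y} → k ∣ℍ x ⊕ y → k ∣ℍ y → k ∣ℍ x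
    ∣ℍ-cancel {k} {x} (a , e) (b , refl) = a ⊕ (ℤ.- 1ℤ) • b , (begin
      x                                          ≡⟨ sym (⊕-•-cancel k x b) ⟩
      (x ⊕ k • b) ⊕ k • ((ℤ.- 1ℤ) • b)          ≡⟨ cong (_⊕ k • ((ℤ.- 1ℤ) • b)) e ⟩
      k • a ⊕ k • ((ℤ.- 1ℤ) • b)                ≡⟨ sym (•-distrib-⊕ k a ((ℤ.- 1ℤ) • b)) ⟩
      k • (a ⊕ (ℤ.- 1ℤ) • b)                    ∎)
      where open ≡-Reasoning

    ⊗-square : ∀ x → x ⊗ x ≡ (+ 2 ℤ.* re x) • x ⊕ (ℤ.- nm x) • 1ℍ
    ⊗-square x = solveℍ 0ℤ x x x (λ _ x _ _ →
      P.mul x x ≋ P.add (P.scl (con (+ 2) :* re x) x) (P.scl (:- P.nrm x) ⟨ con 1ℤ ⟩)) refl refl refl refl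

    -- Expand the conjugate of yx in two ways: as x̄ȳ with ȳ = 2 re(y) - y, and as 2 re(yx) - yx.
    conj-⊗-swap : ∀ x y → conj x ⊗ y ≡
      (y ⊗ x ⊕ (ℤ.- (+ 2 ℤ.* re (y ⊗ x))) • 1ℍ) ⊕ (+ 2 ℤ.* re y) • conj x
    conj-⊗-swap x y = solveℍ 0ℤ x y y (λ _ x y _ → P.mul (P.cnj x) y ≋
      P.add (P.add (P.mul y x) (P.scl (:- (con (+ 2) :* re (P.mul y x))) ⟨ con 1ℤ ⟩))
            (P.scl (con (+ 2) :* re y) (P.cnj x))) refl refl refl refl

    1ℍ-⊗ : ∀ x → 1ℍ ⊗ x ≡ x
    1ℍ-⊗ x = solveℍ 0ℤ x x x (λ _ x _ _ → P.mul ⟨ con 1ℤ ⟩ x ≋ x) refl refl refl refl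

    -- Up to sign, the real parts of x, xi, xj, xk are the coordinates of x. So a statement about
    -- real parts of all unit multiples reaches every coordinate.
    re-⊗i : ∀ x → re (x ⊗ iℍ) ≡ ℤ.- im x
    re-⊗i x = solveℤ 0ℤ x x x (λ _ x _ _ → re (P.mul x (quat (con 0ℤ) (con 1ℤ) (con 0ℤ) (con 0ℤ))) , :- im x) refl

    re-⊗j : ∀ x → re (x ⊗ jℍ) ≡ ℤ.- jm x
    re-⊗j x = solveℤ 0ℤ x x x (λ _ x _ _ → re (P.mul x (quat (con 0ℤ) (con 0ℤ) (con 1ℤ) (con 0ℤ))) , :- jm x) refl

    re-⊗k : ∀ x → re (x ⊗ kℍ) ≡ ℤ.- km x
    re-⊗k x = solveℤ 0ℤ x x x (λ _ x _ _ → re (P.mul x (quat (con 0ℤ) (con 0ℤ) (con 0ℤ) (con 1ℤ))) , :- km x) refl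

    ⊕-0• : ∀ x y → x ⊕ 0ℤ • y ≡ x
    ⊕-0• x y = solveℍ 0ℤ x y y (λ _ x y _ → P.add x (P.scl (con 0ℤ) y) ≋ x) refl refl refl refl

    0•-⊕ : ∀ x y → 0ℤ • y ⊕ x ≡ x
    0•-⊕ x y = solveℍ 0ℤ x y y (λ _ x y _ → P.add (P.scl (con 0ℤ) y) x ≋ x) refl refl refl refl

    nm-iℍ : nm iℍ ≡ 1ℤ
    nm-iℍ = refl
    nm-jℍ : nm jℍ ≡ 1ℤ
    nm-jℍ = refl
    nm-kℍ : nm kℍ ≡ 1ℤ
    nm-kℍ = refl
    nm-1ℍ : nm 1ℍ ≡ 1ℤ
    nm-1ℍ = refl

  Pure : ℍ → Set
  Pure x = re x ≡ 0ℤ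

  pure-square : ∀ x → Pure x → x ⊗ x ≡ (ℤ.- nm x) • 1ℍ
  pure-square x e = trans (⊗-square x) (trans (cong (λ t → (+ 2 ℤ.* t) • x ⊕ (ℤ.- nm x) • 1ℍ) e) (0•-⊕ _ x))

  pure-square-⊗ : ∀ x y → Pure x → x ⊗ (x ⊗ y) ≡ (ℤ.- nm x) • y
  pure-square-⊗ x y e = trans (sym (⊗-assoc x x y)) (trans (cong (_⊗ y) (pure-square x e))
    (trans (•-⊗ˡ (ℤ.- nm x) 1ℍ y) (cong ((ℤ.- nm x) •_) (1ℍ-⊗ y))))

  pure-swap : ∀ x y → Pure y → conj x ⊗ y ≡ y ⊗ x ⊕ (ℤ.- (+ 2 ℤ.* re (y ⊗ x))) • 1ℍ
  pure-swap x y e = trans (conj-⊗-swap x y)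
      (trans (cong (λ t → (y ⊗ x ⊕ (ℤ.- (+ 2 ℤ.* re (y ⊗ x))) • 1ℍ) ⊕ (+ 2 ℤ.* t) • conj x) e) (⊕-0• _ (conj x)))

  ∣⇒∣ℍ-• : ∀ {k l} x → k ∣ℤ l → k ∣ℍ l • x
  ∣⇒∣ℍ-• {k} x (divides q refl) = q • x , trans (cong (_• x) (ℤ.*-comm q k)) (•-assoc k q x)

  module Local {p : ℕ} (pr : Prime p) (p≥3 : p ≥ 3) where
    private instance
      p≢0 : NonZero p
      p≢0 = prime⇒nonZero pr

    euclid : ∀ a b → + p ∣ℤ a ℤ.* b → + p ∣ℤ a ⊎ + p ∣ℤ b
    euclid a b d with euclidsLemma (∣ a ∣) (∣ b ∣) pr (subst (p ∣ℕ_) (ℤ.abs-* a b) (∣⇒∣ᵤ d))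
    ... | inj₁ q = inj₁ (∣ᵤ⇒∣ q)
    ... | inj₂ q = inj₂ (∣ᵤ⇒∣ q)

    p∤2 : ¬ + p ∣ℤ + 2
    p∤2 d = ℕ.<⇒≱ p≥3 (∣⇒≤ (∣⇒∣ᵤ d))

    p∤1 : ¬ + p ∣ℤ + 1
    p∤1 d = ℕ.<⇒≱ (ℕ.<⇒≤ p≥3) (∣⇒≤ (∣⇒∣ᵤ d))

    halve : ∀ a → + p ∣ℤ + 2 ℤ.* a → + p ∣ℤ a
    halve a d with euclid (+ 2) a d
    ... | inj₁ q = ⊥-elim (p∤2 q)
    ... | inj₂ q = q

    euclidℍ : ∀ k x → + p ∣ℍ k • x → ¬ + p ∣ℤ k → + p ∣ℍ x
    euclidℍ k x d p∤k with ∣ℍ⇒∣ d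
    ... | a , b , c , e = ∣⇒∣ℍ (get (re x) (subst (+ p ∣ℤ_) (re-• k x) a)) (get (im x) (subst (+ p ∣ℤ_) (im-• k x) b))
                                (get (jm x) (subst (+ p ∣ℤ_) (jm-• k x) c)) (get (km x) (subst (+ p ∣ℤ_) (km-• k x) e))
      where
      get : ∀ t → + p ∣ℤ k ℤ.* t → + p ∣ℤ t
      get t d with euclid k t d
      ... | inj₁ q = ⊥-elim (p∤k q)
      ... | inj₂ q = q

    norm-p⇒p∤ : ∀ {α} → nm α ≡ + p → ¬ + p ∣ℍ α
    norm-p⇒p∤ {α} e (z , refl) = p∤1 (divides (nm z) (ℤ.*-cancelˡ-≡ (+ p) _ _
      (trans (ℤ.*-identityʳ (+ p))
          (trans (sym e) (trans (nm-• (+ p) z)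
          (trans (ℤ.*-assoc (+ p) (+ p) (nm z)) (cong (+ p ℤ.*_) (ℤ.*-comm (+ p) (nm z)))))))))

    module _ (y : ℍ) {k : ℤ} (nmy : nm y ≡ + p ℤ.* k) (p∤y : ¬ + p ∣ℍ y) where
      open Descent pr p≥3 y

      private
        found = exists-generator nmy p∤y
        α = proj₁ found
        u = proj₁ (proj₁ (proj₂ found))
        v = proj₁ (proj₂ (proj₁ (proj₂ found)))
        α≡ : α ≡ y ⊗ u ⊕ + p • v
        α≡ = proj₂ (proj₂ (proj₁ (proj₂ found)))
        nmα : nm α ≡ + p
        nmα = proj₂ (proj₂ found)

        -- With α = yu + pv the product is ūȳy + p v̄y; the first summand is nm(y) ū, and p divides
        -- nm(y).
        ᾱy : + p ∣ℍ conj α ⊗ y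
        ᾱy = subst (+ p ∣ℍ_) (sym (begin
          conj α ⊗ y                                      ≡⟨ cong (λ t → conj t ⊗ y) α≡ ⟩
          conj (y ⊗ u ⊕ + p • v) ⊗ y ≡⟨
              cong (_⊗ y) (trans (conj-⊕ (y ⊗ u) (+ p • v)) (cong₂ _⊕_ (conj-⊗ y u) (conj-• (+ p) v))) ⟩
          (conj u ⊗ conj y ⊕ + p • conj v) ⊗ y            ≡⟨ ⊗-distribʳ-⊕ y (conj u ⊗ conj y) (+ p • conj v) ⟩
          (conj u ⊗ conj y) ⊗ y ⊕ (+ p • conj v) ⊗ y      ≡⟨ cong (_⊕ (+ p • conj v) ⊗ y) (⊗-conj-⊗ʳ y (conj u)) ⟩
          nm y • conj u ⊕ (+ p • conj v) ⊗ y              ∎))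
          (∣ℍ-⊕ (∣⇒∣ℍ-• (conj u) (divides k (trans nmy (ℤ.*-comm (+ p) k)))) (∣ℍ-⊗ʳ y (∣ℍ-• (+ p) (conj v))))
          where open ≡-Reasoning

      Divisor : ℍ → Set
      Divisor β = nm β ≡ + p × + p ∣ℍ conj β ⊗ y

      private
        unit-multiple : ∀ {ε} → nm ε ≡ 1ℤ → Divisor (α ⊗ ε)
        unit-multiple {ε} e = trans (nm-⊗ α ε) (trans (cong₂ ℤ._*_ nmα e) (ℤ.*-identityʳ (+ p))) ,
          subst (+ p ∣ℍ_) (sym (trans (cong (_⊗ y) (conj-⊗ α ε)) (⊗-assoc (conj ε) (conj α) y))) (∣ℍ-⊗ˡ (conj ε) ᾱy)

        -- Modulo p, β̄ annihilates both generators y and p of the ideal, hence p ∣ β̄α. Then α =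
        -- βη, and comparing norms makes η a unit.
        associate : ∀ {β} → Divisor β → ∃ λ ε → nm ε ≡ 1ℤ × α ⊗ ε ≡ β
        associate {β} (nmβ , d) = conj η , trans (nm-conj η) nmη ,
          trans (cong (_⊗ conj η) α≡βη) (trans (⊗-⊗-conj η β) (trans (cong (_• β) nmη) (•-identity β)))
          where
          open ≡-Reasoning
          β̄α : + p ∣ℍ conj β ⊗ α
          β̄α = subst (+ p ∣ℍ_) (sym (trans (cong (conj β ⊗_) α≡) (trans (⊗-distribˡ-⊕ (conj β) (y ⊗ u) (+ p • v))
            (cong (_⊕ conj β ⊗ (+ p • v)) (sym (⊗-assoc (conj β) y u))))))
            (∣ℍ-⊕ (∣ℍ-⊗ʳ u d) (∣ℍ-⊗ˡ (conj β) (∣ℍ-• (+ p) v)))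
          η = proj₁ β̄α
          α≡βη : α ≡ β ⊗ η
          α≡βη = •-cancelˡ (+ p) (begin
            + p • α             ≡⟨ cong (_• α) (sym nmβ) ⟩
            nm β • α            ≡⟨ sym (⊗-conj-⊗ β α) ⟩
            β ⊗ (conj β ⊗ α)    ≡⟨ cong (β ⊗_) (proj₂ β̄α) ⟩
            β ⊗ (+ p • η)       ≡⟨ •-⊗ʳ (+ p) β η ⟩
            + p • (β ⊗ η)       ∎)
          nmη : nm η ≡ 1ℤ
          nmη = ℤ.*-cancelˡ-≡ (+ p) _ _ (begin
            + p ℤ.* nm η    ≡⟨ cong (ℤ._* nm η) (sym nmβ) ⟩
            nm β ℤ.* nm η   ≡⟨ sym (nm-⊗ β η) ⟩
            nm (β ⊗ η)      ≡⟨ cong nm (sym α≡βη) ⟩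
            nm α            ≡⟨ nmα ⟩
            + p             ≡⟨ sym (ℤ.*-identityʳ (+ p)) ⟩
            + p ℤ.* 1ℤ      ∎)

      -- The ideal is closed under right multiplication by units, and every divisor is a unit
      -- multiple of the element found by descent. The form β = yu + pv is what
      -- `Card-conjugators-p∤` needs.
      divisor-in-ideal : ∀ {β} → Divisor β → Ideal β
      divisor-in-ideal {β} d = let ε , _ , e = associate d in u ⊗ ε , v ⊗ ε ,
        trans (sym e) (trans (cong (_⊗ ε) α≡) (trans (⊗-distribʳ-⊕ ε (y ⊗ u) (+ p • v))
          (cong₂ _⊕_ (⊗-assoc y u ε) (•-⊗ˡ (+ p) v ε))))

      -- The divisors are αε with ε a unit; the 8 is `r₄ 1`, obtained by evaluation.
      Card-divisors : Card Divisor 8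
      Card-divisors = Card-bijection (α ⊗_) unit-multiple
        (λ {ε} {ε′} _ _ e → •-cancelˡ (+ p) (trans (cong (_• ε) (sym nmα)) (trans (sym (conj-⊗-⊗ α ε))
          (trans (cong (conj α ⊗_) e) (trans (conj-⊗-⊗ α ε′) (cong (_• ε′) nmα))))))
        associate (Card-nm 1)

-- Fibres of the map (α , x) ↦ αxᾱ on pure quaternions.

module Conjugators where
  open Cardinality
  open ThetaCoefficients
  open Quaternions
  open LagrangeDescent
  open NormDivisors
  open import Data.Empty using (⊥-elim)
  open import Data.Integer using (ℤ; +_; 0ℤ; 1ℤ)
  open import Data.Integer.Divisibility.Signed using (divides) renaming (_∣_ to _∣ℤ_; _∣?_ to _∣ℤ?_)
  open import Data.Integer.Solver using (module +-*-Solver)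
  open import Data.Nat using (ℕ; _≥_; NonZero)
  open import Data.Nat.Primality using (Prime; prime⇒nonZero)
  open import Data.Product using (_×_; _,_; proj₁; proj₂)
  open import Data.Sum using (inj₁; inj₂; _⊎_)
  open import Relation.Nullary using (¬_; yes; no)
  open import Relation.Binary.PropositionalEquality
  import Data.Integer as ℤ
  import Data.Integer.Properties as ℤ
  open +-*-Solver using (con; _:*_; :-_)

  private
    neg-p² : ∀ p k → ℤ.- (p ℤ.* (p ℤ.* k)) ≡ p ℤ.* (p ℤ.* ℤ.- k)
    neg-p² p k = trans (ℤ.neg-distribʳ-* p (p ℤ.* k)) (cong (p ℤ.*_) (ℤ.neg-distribʳ-* p k))

  opaque
    unfolding _⊗_

    ⊕-comm : ∀ x y → x ⊕ y ≡ y ⊕ x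
    ⊕-comm x y = solveℍ 0ℤ x y y (λ _ x y _ → P.add x y ≋ P.add y x) refl refl refl refl

    neg-neg : ∀ x → (ℤ.- 1ℤ) • ((ℤ.- 1ℤ) • x) ≡ x
    neg-neg x = solveℍ 0ℤ x x x (λ _ x _ _ → P.scl (:- con 1ℤ) (P.scl (:- con 1ℤ) x) ≋ x) refl refl refl refl

    conj-trace : ∀ x → conj x ≡ (+ 2 ℤ.* re x) • 1ℍ ⊕ (ℤ.- 1ℤ) • x
    conj-trace x = solveℍ 0ℤ x x x (λ _ x _ _ →
      P.cnj x ≋ P.add (P.scl (con (+ 2) :* re x) ⟨ con 1ℤ ⟩) (P.scl (:- con 1ℤ) x)) refl refl refl refl

    •-swap : ∀ k l x → k • (l • x) ≡ l • (k • x)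
    •-swap k l x = solveℍ k x (quat l l l l) x
        (λ k x l _ → P.scl k (P.scl (re l) x) ≋ P.scl (re l) (P.scl k x)) refl refl refl refl

    sandwich-expand : ∀ τ t p y β →
      y ⊗ (τ • β ⊕ (ℤ.- p) • 1ℍ) ⊕ t • β ≡ (τ • (y ⊗ β) ⊕ t • β) ⊕ p • ((ℤ.- 1ℤ) • y)
    sandwich-expand τ t p y β = solveℍ p y β (quat τ t 0ℤ 0ℤ) (λ p y β s →
      P.add (P.mul y (P.add (P.scl (re s) β) (P.scl (:- p) ⟨ con 1ℤ ⟩))) (P.scl (im s) β) ≋
      P.add (P.add (P.scl (re s) (P.mul y β)) (P.scl (im s) β)) (P.scl p (P.scl (:- con 1ℤ) y))) refl refl refl refl

  pure-conj : ∀ x → Pure x → conj x ≡ (ℤ.- 1ℤ) • x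
  pure-conj x e = trans (conj-trace x) (trans (cong (λ r → (+ 2 ℤ.* r) • 1ℍ ⊕ (ℤ.- 1ℤ) • x) e) (0•-⊕ _ 1ℍ))

  sandwich-distrib : ∀ τ t y x β → y ⊗ (τ • x ⊕ t • β) ≡ t • (y ⊗ β) ⊕ τ • (y ⊗ x)
  sandwich-distrib τ t y x β = trans (⊗-distribˡ-⊕ y (τ • x) (t • β))
    (trans (cong₂ _⊕_ (•-⊗ʳ τ y x) (•-⊗ʳ t y β)) (⊕-comm _ _))

  ∣ℍ-•ˡ : ∀ {k x} l → k ∣ℍ x → k ∣ℍ l • x
  ∣ℍ-•ˡ {k} l (z , refl) = l • z , •-swap l k z

  module Fibres {p : ℕ} (pr : Prime p) (p≥3 : p ≥ 3) where
    open Local pr p≥3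
    private instance
      p≢0 : NonZero p
      p≢0 = prime⇒nonZero pr

    ∣ℍ-⊗-unit : ∀ x ε → nm ε ≡ 1ℤ → + p ∣ℍ x ⊗ ε → + p ∣ℍ x
    ∣ℍ-⊗-unit x ε e d = subst (+ p ∣ℍ_) (trans (⊗-⊗-conj ε x) (trans (cong (_• x) e) (•-identity x))) (∣ℍ-⊗ʳ (conj ε) d)

    ∣-neg : ∀ {a} → + p ∣ℤ ℤ.- a → + p ∣ℤ a
    ∣-neg {a} (divides q e) =
        divides (ℤ.- q) (trans (sym (ℤ.neg-involutive a)) (trans (cong ℤ.-_ e) (ℤ.neg-distribˡ-* q (+ p))))

    pure-conj-swap : ∀ y β → Pure y → conj (y ⊗ β) ≡ (ℤ.- 1ℤ) • (conj β ⊗ y)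
    pure-conj-swap y β e = trans (conj-⊗ y β) (trans (cong (conj β ⊗_) (pure-conj y e)) (•-⊗ʳ (ℤ.- 1ℤ) (conj β) y))

    -- With x = y β, both β̄ y = x − tr(x) and β² ≡ tr(β) β (mod p), so the
    -- hypothesis gives tr(β) x ≡ tr(x) β, and multiplication by y yields tr(x) x ≡ 0.
    sandwich-trace : ∀ y β {k} → Pure y → nm y ≡ + p ℤ.* k → nm β ≡ + p →
      + p ∣ℍ (conj β ⊗ y) ⊗ β → + p ∣ℤ re β ⊎ + p ∣ℍ y ⊗ β
    sandwich-trace y β {k} pure nmy nmβ d = conclude
      where
      open ≡-Reasoning
      x = y ⊗ β
      t = ℤ.- (+ 2 ℤ.* re x)
      τ = + 2 ℤ.* re β

      expand : (conj β ⊗ y) ⊗ β ≡ (τ • x ⊕ t • β) ⊕ + p • ((ℤ.- 1ℤ) • y)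
      expand = begin
        (conj β ⊗ y) ⊗ β                               ≡⟨ cong (_⊗ β) (pure-swap β y pure) ⟩
        (x ⊕ t • 1ℍ) ⊗ β                               ≡⟨ ⊗-distribʳ-⊕ β x (t • 1ℍ) ⟩
        x ⊗ β ⊕ (t • 1ℍ) ⊗ β                           ≡⟨
            cong₂ _⊕_ (⊗-assoc y β β) (trans (•-⊗ˡ t 1ℍ β) (cong (t •_) (1ℍ-⊗ β))) ⟩
        y ⊗ (β ⊗ β) ⊕ t • β                            ≡⟨ cong (λ b → y ⊗ b ⊕ t • β)
            (trans (⊗-square β) (cong (λ n → τ • β ⊕ (ℤ.- n) • 1ℍ) nmβ)) ⟩
        y ⊗ (τ • β ⊕ (ℤ.- + p) • 1ℍ) ⊕ t • β           ≡⟨ sandwich-expand τ t (+ p) y β ⟩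
        (τ • x ⊕ t • β) ⊕ + p • ((ℤ.- 1ℤ) • y)         ∎

      relation : + p ∣ℍ τ • x ⊕ t • β
      relation = ∣ℍ-cancel (subst (+ p ∣ℍ_) expand d) (∣ℍ-• (+ p) ((ℤ.- 1ℤ) • y))

      tx : + p ∣ℍ t • x
      tx = ∣ℍ-cancel (subst (+ p ∣ℍ_) (begin
        y ⊗ (τ • x ⊕ t • β)                  ≡⟨ sandwich-distrib τ t y x β ⟩
        t • x ⊕ τ • (y ⊗ x)                  ≡⟨ cong (λ z → t • x ⊕ τ • z) (pure-square-⊗ y β pure) ⟩
        t • x ⊕ τ • ((ℤ.- nm y) • β)         ∎) (∣ℍ-⊗ˡ y relation))
        (∣ℍ-•ˡ τ (∣⇒∣ℍ-• β (divides (ℤ.- k)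
            (trans (cong ℤ.-_ (trans nmy (ℤ.*-comm (+ p) k))) (ℤ.neg-distribˡ-* k (+ p))))))

      conclude : + p ∣ℤ re β ⊎ + p ∣ℍ x
      conclude with + p ∣ℤ? t | + p ∣ℤ? τ
      ... | _       | yes p∣τ = inj₁ (halve (re β) p∣τ)
      ... | no p∤t  | _       = inj₂ (euclidℍ t x tx p∤t)
      ... | yes p∣t | no p∤τ  = inj₂ (euclidℍ τ x (∣ℍ-cancel relation (∣⇒∣ℍ-• β p∣t)) p∤τ)

    -- `sandwich-trace` is applied to β, βi, βj and βk. If the alternative on the real part held all
    -- four times, p would divide every coordinate of β, against nm β = p.
    sandwich : ∀ y β {k} → Pure y → nm y ≡ + p ℤ.* k → nm β ≡ + p →
      + p ∣ℍ (conj β ⊗ y) ⊗ β → + p ∣ℍ conj β ⊗ y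
    sandwich y β {k} pure nmy nmβ d = subst (+ p ∣ℍ_)
      (trans (cong ((ℤ.- 1ℤ) •_) (pure-conj-swap y β pure)) (neg-neg (conj β ⊗ y)))
      (∣ℍ-•ˡ (ℤ.- 1ℤ) (∣ℍ-conj yβ))
      where
      rotate : ∀ ε → nm ε ≡ 1ℤ → + p ∣ℤ re (β ⊗ ε) ⊎ + p ∣ℍ y ⊗ β
      rotate ε e with sandwich-trace y (β ⊗ ε) {k} pure nmy
        (trans (nm-⊗ β ε) (trans (cong₂ ℤ._*_ nmβ e) (ℤ.*-identityʳ (+ p))))
        (subst (+ p ∣ℍ_) (sym (begin
          (conj (β ⊗ ε) ⊗ y) ⊗ (β ⊗ ε)          ≡⟨ cong (λ c → (c ⊗ y) ⊗ (β ⊗ ε)) (conj-⊗ β ε) ⟩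
          ((conj ε ⊗ conj β) ⊗ y) ⊗ (β ⊗ ε)     ≡⟨ cong (_⊗ (β ⊗ ε)) (⊗-assoc (conj ε) (conj β) y) ⟩
          (conj ε ⊗ (conj β ⊗ y)) ⊗ (β ⊗ ε)     ≡⟨ ⊗-assoc (conj ε) (conj β ⊗ y) (β ⊗ ε) ⟩
          conj ε ⊗ ((conj β ⊗ y) ⊗ (β ⊗ ε))     ≡⟨ cong (conj ε ⊗_) (sym (⊗-assoc (conj β ⊗ y) β ε)) ⟩
          conj ε ⊗ (((conj β ⊗ y) ⊗ β) ⊗ ε)     ∎)) (∣ℍ-⊗ˡ (conj ε) (∣ℍ-⊗ʳ ε d)))
        where open ≡-Reasoning
      ... | inj₁ q = inj₁ q
      ... | inj₂ q = inj₂ (∣ℍ-⊗-unit (y ⊗ β) ε e (subst (+ p ∣ℍ_) (sym (⊗-assoc y β ε)) q))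

      yβ : + p ∣ℍ y ⊗ β
      yβ with rotate 1ℍ nm-1ℍ | rotate iℍ nm-iℍ | rotate jℍ nm-jℍ | rotate kℍ nm-kℍ
      ... | inj₂ q | _ | _ | _ = q
      ... | _ | inj₂ q | _ | _ = q
      ... | _ | _ | inj₂ q | _ = q
      ... | _ | _ | _ | inj₂ q = q
      ... | inj₁ a | inj₁ b | inj₁ c | inj₁ e = ⊥-elim (norm-p⇒p∤ nmβ (∣⇒∣ℍ (subst (+ p ∣ℤ_) (cong re (⊗-identityʳ β)) a)
          (∣-neg (subst (+ p ∣ℤ_) (re-⊗i β) b)) (∣-neg (subst (+ p ∣ℤ_) (re-⊗j β) c))
              (∣-neg (subst (+ p ∣ℤ_) (re-⊗k β) e))))

    -- Equivalent to y = βxβ̄ for an integral x, namely x = β̄yβ/p².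
    Conjugator : ℍ → ℍ → Set
    Conjugator y β = nm β ≡ + p × + p ℤ.* + p ∣ℍ (conj β ⊗ y) ⊗ β

    -- The factor p of `+ p • y` accounts for one of the two required; what remains, p ∣ β̄yβ,
    -- amounts to p ∣ β̄y by `sandwich`.
    Card-conjugators-p∣ : ∀ y {k} → Pure y → nm y ≡ + p ℤ.* k → ¬ + p ∣ℍ y → Card (Conjugator (+ p • y)) 8
    Card-conjugators-p∣ y {k} pure nmy p∤y = Card-cong to from (Card-divisors y {k} nmy p∤y)
      where
      pull : ∀ β → (conj β ⊗ (+ p • y)) ⊗ β ≡ + p • ((conj β ⊗ y) ⊗ β)
      pull β = trans (cong (_⊗ β) (•-⊗ʳ (+ p) (conj β) y)) (•-⊗ˡ (+ p) (conj β ⊗ y) β)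
      to : ∀ {β} → Divisor y {k} nmy p∤y β → Conjugator (+ p • y) β
      to {β} (e , d) = let z , q = ∣ℍ-⊗ʳ β d in e , z , trans (pull β) (trans (cong (+ p •_) q) (sym (•-assoc (+ p) (+ p) z)))
      from : ∀ {β} → Conjugator (+ p • y) β → Divisor y {k} nmy p∤y β
      from {β} (e , z , q) = e , sandwich y β {k} pure nmy e
          (z , •-cancelˡ (+ p) (trans (sym (pull β)) (trans q (•-assoc (+ p) (+ p) z))))

    -- If β̄y = pz, then p zy = β̄y² = -nm(y) β̄ with p² ∣ nm(y), so p ∣ zy, and β = yu + pv gives p
    -- ∣ zβ. Conversely, β̄yβ = p²z multiplied by β̄ on the right gives p β̄y = p² zβ̄.
    Card-conjugators-p∤ : ∀ y {k} → Pure y → nm y ≡ + p ℤ.* (+ p ℤ.* k) → ¬ + p ∣ℍ y → Card (Conjugator y) 8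
    Card-conjugators-p∤ y {k} pure nmy p∤y = Card-cong to from (Card-divisors y {+ p ℤ.* k} nmy p∤y)
      where
      open ≡-Reasoning
      to : ∀ {β} → Divisor y {+ p ℤ.* k} nmy p∤y β → Conjugator y β
      to {β} (e , d@(z , q)) = e , proj₁ zβ ,
          trans (cong (_⊗ β) q)
          (trans (•-⊗ˡ (+ p) z β) (trans (cong (+ p •_) (proj₂ zβ)) (sym (•-assoc (+ p) (+ p) (proj₁ zβ)))))
        where
        zβ : + p ∣ℍ z ⊗ β
        zβ = subst (+ p ∣ℍ_) (sym (begin
          z ⊗ β                                 ≡⟨ cong (z ⊗_) (proj₂ (proj₂ ideal)) ⟩
          z ⊗ (y ⊗ u ⊕ + p • v)                 ≡⟨ ⊗-distribˡ-⊕ z (y ⊗ u) (+ p • v) ⟩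
          z ⊗ (y ⊗ u) ⊕ z ⊗ (+ p • v)           ≡⟨ cong (_⊕ z ⊗ (+ p • v)) (sym (⊗-assoc z y u)) ⟩
          (z ⊗ y) ⊗ u ⊕ z ⊗ (+ p • v)           ∎))
          (∣ℍ-⊕ (∣ℍ-⊗ʳ u zy) (∣ℍ-⊗ˡ z (∣ℍ-• (+ p) v)))
          where
          ideal = divisor-in-ideal y {+ p ℤ.* k} nmy p∤y (e , d)
          u = proj₁ ideal
          v = proj₁ (proj₂ ideal)
          zy : + p ∣ℍ z ⊗ y
          zy = (ℤ.- k) • conj β , •-cancelˡ (+ p) (begin
            + p • (z ⊗ y)                        ≡⟨ sym (•-⊗ˡ (+ p) z y) ⟩
            (+ p • z) ⊗ y                        ≡⟨ cong (_⊗ y) (sym q) ⟩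
            (conj β ⊗ y) ⊗ y                     ≡⟨ ⊗-assoc (conj β) y y ⟩
            conj β ⊗ (y ⊗ y)                     ≡⟨ cong (conj β ⊗_) (pure-square y pure) ⟩
            conj β ⊗ ((ℤ.- nm y) • 1ℍ)           ≡⟨ •-⊗ʳ (ℤ.- nm y) (conj β) 1ℍ ⟩
            (ℤ.- nm y) • (conj β ⊗ 1ℍ)           ≡⟨
                cong₂ _•_ (trans (cong ℤ.-_ nmy) (neg-p² (+ p) k)) (⊗-identityʳ (conj β)) ⟩
            (+ p ℤ.* (+ p ℤ.* ℤ.- k)) • conj β ≡⟨
                trans (•-assoc (+ p) (+ p ℤ.* ℤ.- k) (conj β)) (cong (+ p •_) (•-assoc (+ p) (ℤ.- k) (conj β))) ⟩
            + p • (+ p • ((ℤ.- k) • conj β))     ∎)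
      from : ∀ {β} → Conjugator y β → Divisor y {+ p ℤ.* k} nmy p∤y β
      from {β} (e , z , q) = e , z ⊗ conj β , •-cancelˡ (+ p) (begin
        + p • (conj β ⊗ y)             ≡⟨ cong (_• (conj β ⊗ y)) (sym e) ⟩
        nm β • (conj β ⊗ y)            ≡⟨ sym (⊗-⊗-conj β (conj β ⊗ y)) ⟩
        ((conj β ⊗ y) ⊗ β) ⊗ conj β    ≡⟨ cong (_⊗ conj β) q ⟩
        ((+ p ℤ.* + p) • z) ⊗ conj β   ≡⟨ •-⊗ˡ _ z (conj β) ⟩
        (+ p ℤ.* + p) • (z ⊗ conj β)   ≡⟨ •-assoc (+ p) (+ p) (z ⊗ conj β) ⟩
        + p • (+ p • (z ⊗ conj β))     ∎)

-- The projective line over the field of p elements.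

module ProjectiveLine where
  open Cardinality
  open ThetaCoefficients
  open Quaternions
  open Residues
  open LagrangeDescent
  open NormDivisors
  open Conjugators
  open import Data.Empty using (⊥; ⊥-elim)
  open import Data.Integer using (ℤ; +_; -[1+_]; ∣_∣; 0ℤ; 1ℤ)
  open import Data.Integer.Divisibility.Signed using (divides; ∣⇒∣ᵤ; ∣ᵤ⇒∣) renaming (_∣_ to _∣ℤ_; _∣?_ to _∣ℤ?_)
  open import Data.Integer.Solver using (module +-*-Solver)
  open import Data.Nat using (ℕ; _≥_; NonZero; zero; suc)
  open import Data.Nat.Divisibility using (∣⇒≤) renaming (_∣_ to _∣ℕ_)
  open import Data.Nat.Primality using (Prime; prime⇒nonZero)
  open import Data.Product using (_×_; _,_; ∃; proj₁; proj₂)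
  open import Data.Sum using (inj₁; inj₂; _⊎_)
  open import Relation.Nullary using (¬_; yes; no)
  open import Relation.Binary.PropositionalEquality
  import Data.Nat.Properties as ℕ
  import Data.Integer as ℤ
  import Data.Integer.Properties as ℤ
  open import Data.Integer.DivMod using (_/ℕ_; _%ℕ_; n%ℕd<d; a≡a%ℕn+[a/ℕn]*n)
  open import Data.Integer.Divisibility.Signed using (∣m∣n⇒∣m+n; ∣m+n∣n⇒∣m; ∣n⇒∣m*n; ∣m⇒∣m*n)
  open import Data.List using (upTo)
  open import Data.List.Properties using (length-upTo)
  open import Data.List.Membership.Propositional.Properties using (∈-upTo⁺; ∈-upTo⁻)
  open import Data.List.Relation.Unary.Unique.Propositional.Properties using (upTo⁺)
  open import Data.Nat using (_<_; _≤_)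
  open import Data.Nat.Coprimality using (Coprime; coprime-Bézout)
  open import Data.Nat.GCD using (module Bézout)
  open import Data.Nat.Primality using (prime⇒irreducible)
  import Data.Nat as ℕ
  import Data.Nat.DivMod as ℕ

  Card-< : ∀ n → Card (_< n) n
  Card-< n = card (upTo n) (upTo⁺ n) ∈-upTo⁻ ∈-upTo⁺ (length-upTo n)

  ±-abs : ∀ q → q ≡ + ∣ q ∣ ⊎ q ≡ ℤ.- + ∣ q ∣
  ±-abs (+ _) = inj₁ refl
  ±-abs -[1+ _ ] = inj₂ refl

  private
    module S = +-*-Solver

    difference-identity : ∀ {a b} r x y q → a ≡ r ℤ.+ x ℤ.* q → b ≡ r ℤ.+ y ℤ.* q → a ℤ.- b ≡ (x ℤ.- y) ℤ.* q
    difference-identity r x y q refl refl = S.solve 4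
      (λ r x y q → (r S.:+ x S.:* q) S.:- (r S.:+ y S.:* q) S.:= (x S.:- y) S.:* q) refl r x y q

    root-identity : ∀ r q u t w p → r ℤ.* u ≡ t ℤ.+ w ℤ.* p →
      r ℤ.+ q ℤ.* t ≡ r ℤ.* (1ℤ ℤ.+ q ℤ.* u) ℤ.+ (ℤ.- (q ℤ.* w)) ℤ.* p
    root-identity r q u t w p e = begin
      r ℤ.+ q ℤ.* t                                        ≡⟨ S.solve 5 (λ r q t w p → r S.:+ q S.:* t S.:=
                                                                (r S.:+ q S.:* (t S.:+ w S.:* p)) S.:+
                                                                    (S.:- (q S.:* w)) S.:* p) refl r q t w p ⟩
      (r ℤ.+ q ℤ.* (t ℤ.+ w ℤ.* p)) ℤ.+ (ℤ.- (q ℤ.* w)) ℤ.* p ≡⟨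
          cong (λ z → (r ℤ.+ q ℤ.* z) ℤ.+ (ℤ.- (q ℤ.* w)) ℤ.* p) (sym e) ⟩
      (r ℤ.+ q ℤ.* (r ℤ.* u)) ℤ.+ (ℤ.- (q ℤ.* w)) ℤ.* p         ≡⟨ cong (ℤ._+ (ℤ.- (q ℤ.* w)) ℤ.* p) (S.solve 3
                                                                (λ r q u → r S.:+ q S.:*
                                                                    (r S.:* u) S.:= r S.:*
                                                                    (S.con 1ℤ S.:+ q S.:* u)) refl r q u) ⟩
      r ℤ.* (1ℤ ℤ.+ q ℤ.* u) ℤ.+ (ℤ.- (q ℤ.* w)) ℤ.* p          ∎
      where open ≡-Reasoning

    bézout-identity⁺ : ∀ {x y} n p → x ℤ.* n ≡ 1ℤ ℤ.+ y ℤ.* p → 1ℤ ℤ.+ n ℤ.* ℤ.- x ≡ ℤ.- y ℤ.* p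
    bézout-identity⁺ {x} {y} n p e = begin
      1ℤ ℤ.+ n ℤ.* ℤ.- x           ≡⟨
          S.solve 2 (λ n x → S.con 1ℤ S.:+ n S.:* (S.:- x) S.:= S.con 1ℤ S.:- x S.:* n) refl n x ⟩
      1ℤ ℤ.- x ℤ.* n               ≡⟨ cong (λ z → 1ℤ ℤ.- z) e ⟩
      1ℤ ℤ.- (1ℤ ℤ.+ y ℤ.* p)      ≡⟨
          S.solve 2 (λ y p → S.con 1ℤ S.:- (S.con 1ℤ S.:+ y S.:* p) S.:= (S.:- y) S.:* p) refl y p ⟩
      ℤ.- y ℤ.* p                  ∎
      where open ≡-Reasoning

    neg-*-neg : ∀ n v → n ℤ.* v ≡ (ℤ.- n) ℤ.* (ℤ.- v)
    neg-*-neg = S.solve 2 (λ n v → n S.:* v S.:= (S.:- n) S.:* (S.:- v)) refl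

    zero-one-identity : ∀ a b → a ℤ.* 0ℤ ℤ.+ b ℤ.* 1ℤ ≡ b
    zero-one-identity = S.solve 2 (λ a b → a S.:* S.con 0ℤ S.:+ b S.:* S.con 1ℤ S.:= b) refl

    column-difference : ∀ a b t t′ → (t ℤ.- t′) ℤ.* b ≡ 1ℤ ℤ.* (a ℤ.+ b ℤ.* t) ℤ.+ ℤ.- 1ℤ ℤ.* (a ℤ.+ b ℤ.* t′)
    column-difference = S.solve 4 (λ a b t t′ → (t S.:- t′) S.:* b S.:=
      S.con 1ℤ S.:* (a S.:+ b S.:* t) S.:+ S.con (ℤ.- 1ℤ) S.:* (a S.:+ b S.:* t′)) refl

    det-identity₁ : ∀ P Q R S t → Q ℤ.* (R ℤ.+ S ℤ.* t) ≡ S ℤ.* (P ℤ.+ Q ℤ.* t) ℤ.+ ℤ.- 1ℤ ℤ.* (P ℤ.* S ℤ.- Q ℤ.* R)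
    det-identity₁ = S.solve 5 (λ P Q R S t → Q S.:* (R S.:+ S S.:* t) S.:=
      S S.:* (P S.:+ Q S.:* t) S.:+ S.con (ℤ.- 1ℤ) S.:* (P S.:* S S.:- Q S.:* R)) refl

    det-identity₂ : ∀ P Q R S → P ℤ.* S ≡ 1ℤ ℤ.* (P ℤ.* S ℤ.- Q ℤ.* R) ℤ.+ R ℤ.* Q
    det-identity₂ = S.solve 4 (λ P Q R S → P S.:* S S.:= S.con 1ℤ S.:* (P S.:* S S.:- Q S.:* R) S.:+ R S.:* Q) refl

  module Lines {p : ℕ} (pr : Prime p) (p≥3 : p ≥ 3) where
    open Local pr p≥3
    private
      instance
        p≢0 : NonZero p
        p≢0 = prime⇒nonZero pr

    combine : ∀ {a b z} u v → + p ∣ℤ a → + p ∣ℤ b → z ≡ u ℤ.* a ℤ.+ v ℤ.* b → + p ∣ℤ z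
    combine u v pa pb refl = ∣m∣n⇒∣m+n (∣n⇒∣m*n u pa) (∣n⇒∣m*n v pb)

    small-multiple : ∀ z → + p ∣ℤ z → ∣ z ∣ < p → z ≡ 0ℤ
    small-multiple z d lt with ∣ z ∣ in eq
    ... | zero = ℤ.∣i∣≡0⇒i≡0 eq
    ... | suc _ = ⊥-elim (ℕ.<⇒≱ lt (∣⇒≤ (subst (p ∣ℕ_) eq (∣⇒∣ᵤ d))))

    %ℕ-≡⇒∣ : ∀ a b → a %ℕ p ≡ b %ℕ p → + p ∣ℤ a ℤ.- b
    %ℕ-≡⇒∣ a b e = divides (a /ℕ p ℤ.- b /ℕ p) (difference-identity (+ (a %ℕ p)) (a /ℕ p) (b /ℕ p) (+ p)
      (a≡a%ℕn+[a/ℕn]*n a p) (trans (a≡a%ℕn+[a/ℕn]*n b p) (cong (λ r → + r ℤ.+ b /ℕ p ℤ.* + p) (sym e))))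

    ∣-< : ∀ {a b} → a < p → b < p → + p ∣ℤ + a ℤ.- + b → a ≡ b
    ∣-< {a} {b} a<p b<p d = ℤ.+-injective (ℤ.i-j≡0⇒i≡j (+ a) (+ b) (small-multiple _ d
      (ℕ.≤-<-trans (subst (λ z → ∣ z ∣ ≤ a ℕ.⊔ b) (sym (ℤ.m-n≡m⊖n a b)) (ℤ.∣m⊝n∣≤m⊔n a b)) (ℕ.⊔-lub a<p b<p))))

    negative-inverse : ∀ q → ¬ + p ∣ℤ q → ∃ λ u → + p ∣ℤ 1ℤ ℤ.+ q ℤ.* u
    negative-inverse q p∤q with ±-abs q | natural (coprime-Bézout coprime)
      where
      coprime : Coprime (∣ q ∣) p
      coprime (d∣q , d∣p) with prime⇒irreducible pr d∣p
      ... | inj₁ e = e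
      ... | inj₂ refl = ⊥-elim (p∤q (∣ᵤ⇒∣ d∣q))
      natural : ∀ {n} → Bézout.Identity 1 n p → ∃ λ v → + p ∣ℤ 1ℤ ℤ.+ + n ℤ.* v
      natural {n} (Bézout.+- x y e) = ℤ.- + x , divides (ℤ.- + y) (bézout-identity⁺ {+ x} {+ y} (+ n) (+ p)
        (trans (sym (ℤ.pos-* x n)) (trans (cong +_ (sym e)) (cong (λ z → 1ℤ ℤ.+ z) (ℤ.pos-* y p)))))
      natural {n} (Bézout.-+ x y e) = + x ,
          divides (+ y) (trans (cong (λ z → 1ℤ ℤ.+ z) (trans (ℤ.*-comm (+ n) (+ x)) (sym (ℤ.pos-* x n))))
          (trans (cong +_ e) (ℤ.pos-* y p)))
    ... | inj₁ e | v , d = v , subst (λ z → + p ∣ℤ 1ℤ ℤ.+ z ℤ.* v) (sym e) d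
    ... | inj₂ e | v , d = ℤ.- v , subst (λ z → + p ∣ℤ 1ℤ ℤ.+ z)
        (trans (neg-*-neg (+ ∣ q ∣) v) (cong (ℤ._* (ℤ.- v)) (sym e))) d

    linear-root : ∀ r q → ¬ + p ∣ℤ q → ∃ λ t → t < p × + p ∣ℤ r ℤ.+ q ℤ.* + t
    linear-root r q p∤q with negative-inverse q p∤q
    ... | u , d = t , n%ℕd<d (r ℤ.* u) p ,
      combine {1ℤ ℤ.+ q ℤ.* u} {+ p} r (ℤ.- (q ℤ.* w)) d (divides 1ℤ (sym (ℤ.*-identityˡ (+ p))))
        (root-identity r q u (+ t) w (+ p) (a≡a%ℕn+[a/ℕn]*n (r ℤ.* u) p))
      where
      -- `u` is -1/q modulo p, so the root of r + qt is ru.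
      t = (r ℤ.* u) %ℕ p
      w = (r ℤ.* u) /ℕ p

    -- Representatives of the points of the projective line over 𝔽ₚ.
    Line : ℤ × ℤ → Set
    Line w = (∃ λ t → t < p × (1ℤ , + t) ≡ w) ⊎ (0ℤ , 1ℤ) ≡ w

    Card-lines : Card Line (p ℕ.+ 1)
    Card-lines = Card-⊎ (λ { (_ , _ , refl) () })
      (Card-bijection (λ t → 1ℤ , + t) (λ {t} lt → t , lt , refl) (λ { _ _ refl → refl })
          (λ { (t , lt , e) → t , lt , e }) (Card-< p))
      (Card-singleton (0ℤ , 1ℤ))

    -- A nonzero singular 2 by 2 matrix over a field has a kernel of dimension one, that is, exactly
    -- one point of the projective line.
    module Kernel (P Q R S : ℤ) (det : + p ∣ℤ P ℤ.* S ℤ.- Q ℤ.* R)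
      (nonzero : ¬ (+ p ∣ℤ P × + p ∣ℤ Q × + p ∣ℤ R × + p ∣ℤ S)) where

      InKernel : ℤ × ℤ → Set
      InKernel (s , t) = + p ∣ℤ P ℤ.* s ℤ.+ Q ℤ.* t × + p ∣ℤ R ℤ.* s ℤ.+ S ℤ.* t

      private
        one : ∀ a b → + p ∣ℤ a ℤ.+ b → + p ∣ℤ a ℤ.* 1ℤ ℤ.+ b
        one a b = subst (λ z → + p ∣ℤ z ℤ.+ b) (sym (ℤ.*-identityʳ a))
        one⁻ : ∀ a b → + p ∣ℤ a ℤ.* 1ℤ ℤ.+ b → + p ∣ℤ a ℤ.+ b
        one⁻ a b = subst (λ z → + p ∣ℤ z ℤ.+ b) (ℤ.*-identityʳ a)
        zero-one : ∀ a b → + p ∣ℤ b → + p ∣ℤ a ℤ.* 0ℤ ℤ.+ b ℤ.* 1ℤ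
        zero-one a b = subst (+ p ∣ℤ_) (sym (zero-one-identity a b))
        zero-one⁻ : ∀ a b → + p ∣ℤ a ℤ.* 0ℤ ℤ.+ b ℤ.* 1ℤ → + p ∣ℤ b
        zero-one⁻ a b = subst (+ p ∣ℤ_) (zero-one-identity a b)

        trivial-difference : ∀ a b {t t′} → + p ∣ℤ a ℤ.* 1ℤ ℤ.+ b ℤ.* t →
            + p ∣ℤ a ℤ.* 1ℤ ℤ.+ b ℤ.* t′ → + p ∣ℤ t ℤ.- t′ ⊎ + p ∣ℤ b
        trivial-difference a b {t} {t′} x y =
            euclid (t ℤ.- t′) b (combine 1ℤ (ℤ.- 1ℤ) (one⁻ a (b ℤ.* t) x) (one⁻ a (b ℤ.* t′) y)
            (column-difference a b t t′))

        no-second-column : + p ∣ℤ Q → + p ∣ℤ S → ∀ t → + p ∣ℤ P ℤ.+ Q ℤ.* t → + p ∣ℤ R ℤ.+ S ℤ.* t → ⊥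
        no-second-column q s t c d = nonzero (∣m+n∣n⇒∣m c (∣m⇒∣m*n t q) , q ,
                                              ∣m+n∣n⇒∣m d (∣m⇒∣m*n t s) , s)

      line-exists : ∃ λ w → Line w × InKernel w
      line-exists with + p ∣ℤ? Q | + p ∣ℤ? S
      ... | yes p∣Q | yes p∣S = (0ℤ , 1ℤ) , inj₂ refl , zero-one P Q p∣Q , zero-one R S p∣S
      -- The first row determines t. The vanishing determinant gives p ∣ Q (R + St), and Q is
      -- invertible, so the second row vanishes too.
      ... | no p∤Q | _ = (1ℤ , + t) , inj₁ (t , t<p , refl) , one P (Q ℤ.* + t) d ,
          one R (S ℤ.* + t) (second (euclid Q (R ℤ.+ S ℤ.* + t)
              (combine S (ℤ.- 1ℤ) d det (det-identity₁ P Q R S (+ t)))))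
        where
        root = linear-root P Q p∤Q
        t = proj₁ root
        t<p = proj₁ (proj₂ root)
        d = proj₂ (proj₂ root)
        second : ∀ {z} → + p ∣ℤ Q ⊎ + p ∣ℤ z → + p ∣ℤ z
        second (inj₁ q) = ⊥-elim (p∤Q q)
        second (inj₂ z) = z
      -- Now the second row determines t. From p ∣ Q and p ∣ PS - QR with S invertible follows p ∣
      -- P, so the whole first row is zero modulo p.
      ... | yes p∣Q | no p∤S = (1ℤ , + t) , inj₁ (t , t<p , refl) , one P (Q ℤ.* + t) (∣m∣n⇒∣m+n (first (euclid P S
              (combine 1ℤ R det p∣Q (det-identity₂ P Q R S)))) (∣m⇒∣m*n (+ t) p∣Q)) , one R (S ℤ.* + t) d
        where
        root = linear-root R S p∤S
        t = proj₁ root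
        t<p = proj₁ (proj₂ root)
        d = proj₂ (proj₂ root)
        first : ∀ {z} → + p ∣ℤ z ⊎ + p ∣ℤ S → + p ∣ℤ z
        first (inj₁ z) = z
        first (inj₂ s) = ⊥-elim (p∤S s)

      private
        distinct-lines : ∀ t → InKernel (1ℤ , + t) → InKernel (0ℤ , 1ℤ) → ⊥
        distinct-lines t (a , b) (c , d) = no-second-column (zero-one⁻ P Q c) (zero-one⁻ R S d)
            (+ t) (one⁻ P (Q ℤ.* + t) a) (one⁻ R (S ℤ.* + t) b)

      line-unique : ∀ {w w′} → Line w → Line w′ → InKernel w → InKernel w′ → w ≡ w′
      line-unique (inj₂ refl) (inj₂ refl) _ _ = refl
      line-unique (inj₁ (t , _ , refl)) (inj₂ refl) x y = ⊥-elim (distinct-lines t x y)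
      line-unique (inj₂ refl) (inj₁ (t , _ , refl)) x y = ⊥-elim (distinct-lines t y x)
      line-unique (inj₁ (t , t<p , refl)) (inj₁ (t′ , t′<p , refl)) x y =
        separate (trivial-difference P Q {+ t} {+ t′} (proj₁ x) (proj₁ y))
            (trivial-difference R S {+ t} {+ t′} (proj₂ x) (proj₂ y))
        where
        separate : + p ∣ℤ + t ℤ.- + t′ ⊎ + p ∣ℤ Q → + p ∣ℤ + t ℤ.- + t′ ⊎ + p ∣ℤ S → (1ℤ , + t) ≡ (1ℤ , + t′)
        separate (inj₁ e) _ = cong (λ z → 1ℤ , + z) (∣-< {t} {t′} t<p t′<p e)
        separate _ (inj₁ e) = cong (λ z → 1ℤ , + z) (∣-< {t} {t′} t<p t′<p e)
        separate (inj₂ q) (inj₂ s) =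
            ⊥-elim (no-second-column q s (+ t) (one⁻ P (Q ℤ.* + t) (proj₁ x)) (one⁻ R (S ℤ.* + t) (proj₂ x)))

-- Solving a² + b² + 1 ≡ 0, and the left ideal it generates.

module LineIdeals where
  open Cardinality
  open ThetaCoefficients
  open Quaternions
  open Residues
  open LagrangeDescent
  open NormDivisors
  open Conjugators
  open ProjectiveLine
  open import Data.Empty using (⊥; ⊥-elim)
  open import Data.Integer using (ℤ; +_; 0ℤ; 1ℤ)
  open import Data.Integer.Divisibility.Signed using () renaming (_∣_ to _∣ℤ_)
  open import Data.Integer.Solver using (module +-*-Solver)
  open import Data.Nat using (ℕ; _≥_; NonZero; zero; suc)
  open import Data.Nat.Primality using (Prime; prime⇒nonZero)
  open import Data.Product using (_×_; _,_; ∃₂)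
  open import Data.Sum using (inj₁; inj₂; _⊎_)
  open import Relation.Binary.PropositionalEquality
  import Data.Nat.Properties as ℕ
  import Data.Integer as ℤ
  import Data.Integer.Properties as ℤ
  open +-*-Solver using (con; _:+_; _:*_; :-_)
  open import Data.Fin using (Fin; toℕ; fromℕ<; splitAt; join)
  open import Data.Fin.Properties using (pigeonhole; toℕ<n; toℕ-injective; toℕ-fromℕ<; join-splitAt)
  import Data.Fin.Properties as Fin
  open import Data.Integer.DivMod using (n%ℕd<d)
  open import Data.Integer.Divisibility.Signed using (∣m⇒∣-m)
  open import Data.Nat using (_<_; _≤_; s≤s)
  open import Data.Nat.Primality using (prime⇒irreducible)
  import Data.Nat as ℕ
  import Data.Nat.DivMod as ℕ

  private
    module S = +-*-Solver

    square-difference : ∀ a b → a ℤ.* a ℤ.- b ℤ.* b ≡ (a ℤ.- b) ℤ.* (a ℤ.+ b)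
    square-difference = S.solve 2 (λ a b → a :* a S.:- b :* b S.:= (a S.:- b) :* (a :+ b)) refl

    neg-difference : ∀ a b → ℤ.- (1ℤ ℤ.+ a ℤ.* a) ℤ.- ℤ.- (1ℤ ℤ.+ b ℤ.* b) ≡ b ℤ.* b ℤ.- a ℤ.* a
    neg-difference = S.solve 2 (λ a b → :- (con 1ℤ :+ a :* a) S.:- (:- (con 1ℤ :+ b :* b)) S.:= b :* b S.:- a :* a) refl

    mixed₁ : ∀ a b → a ℤ.* a ℤ.- ℤ.- (1ℤ ℤ.+ b ℤ.* b) ≡ 1ℤ ℤ.+ (a ℤ.* a ℤ.+ b ℤ.* b)
    mixed₁ = S.solve 2 (λ a b → a :* a S.:- (:- (con 1ℤ :+ b :* b)) S.:= con 1ℤ :+ (a :* a :+ b :* b)) refl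

    mixed₂ : ∀ a b → ℤ.- (ℤ.- (1ℤ ℤ.+ b ℤ.* b) ℤ.- a ℤ.* a) ≡ 1ℤ ℤ.+ (a ℤ.* a ℤ.+ b ℤ.* b)
    mixed₂ = S.solve 2 (λ a b → :- (:- (con 1ℤ :+ b :* b) S.:- a :* a) S.:= con 1ℤ :+ (a :* a :+ b :* b)) refl

  module SumOfSquares {p : ℕ} (pr : Prime p) (p≥3 : p ≥ 3) where
    open Local pr p≥3
    open Lines pr p≥3
    private
      instance
        p≢0 : NonZero p
        p≢0 = prime⇒nonZero pr

      h : ℕ
      h = p ℕ./ 2

      p≡ : p ≡ suc (h ℕ.+ h)
      p≡ with p ℕ.% 2 in e | ℕ.m%n<n p 2 | ℕ.m≡m%n+[m/n]*n p 2
      ... | 0 | _ | q = ⊥-elim (no-even (prime⇒irreducible pr (Data.Nat.Divisibility.m%n≡0⇒n∣m p 2 e)))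
        where
        import Data.Nat.Divisibility
        no-even : 2 ≡ 1 ⊎ 2 ≡ p → ⊥
        no-even (inj₂ refl) = ℕ.<-irrefl refl p≥3
      ... | 1 | _ | q = trans q (cong suc (trans (ℕ.*-comm h 2) (cong (h ℕ.+_) (ℕ.+-identityʳ h))))
      ... | ℕ.2+ _ | s≤s (s≤s ()) | _

      Half : Set
      Half = Fin (suc h)

      -- Both |a - b| and a + b are below p when a, b ≤ (p - 1)/2, so p ∣ (a - b)(a + b) makes one
      -- of them zero.
      squares-distinct : ∀ (i j : Half) → + p ∣ℤ + toℕ i ℤ.* + toℕ i ℤ.- + toℕ j ℤ.* + toℕ j → i ≡ j
      squares-distinct i j d =
          separate (euclid (+ a ℤ.- + b) (+ a ℤ.+ + b) (subst (+ p ∣ℤ_) (square-difference (+ a) (+ b)) d))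
        where
        a = toℕ i
        b = toℕ j
        a≤h : a ≤ h
        a≤h = ℕ.s≤s⁻¹ (toℕ<n i)
        b≤h : b ≤ h
        b≤h = ℕ.s≤s⁻¹ (toℕ<n j)
        h<p : h < p
        h<p = subst (h <_) (sym p≡) (s≤s (ℕ.m≤m+n h h))
        separate : + p ∣ℤ + a ℤ.- + b ⊎ + p ∣ℤ + (a ℕ.+ b) → i ≡ j
        separate (inj₁ e) = toℕ-injective (∣-< {a} {b} (ℕ.≤-<-trans a≤h h<p) (ℕ.≤-<-trans b≤h h<p) e)
        separate (inj₂ e) = toℕ-injective (trans (ℕ.m+n≡0⇒m≡0 a a+b≡0) (sym (ℕ.m+n≡0⇒n≡0 a a+b≡0)))
          where
          a+b≡0 : a ℕ.+ b ≡ 0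
          a+b≡0 = ℤ.+-injective (small-multiple (+ (a ℕ.+ b)) e (subst (a ℕ.+ b <_) (sym p≡) (s≤s (ℕ.+-mono-≤ a≤h b≤h))))

      -- The (p + 1)/2 squares and the (p + 1)/2 numbers -(1 + b²) are p + 1 values in p classes.
      -- Two values of the same kind never collide, so a collision is mixed and solves the
      -- congruence.
      value : Half ⊎ Half → ℤ
      value (inj₁ i) = + toℕ i ℤ.* + toℕ i
      value (inj₂ j) = ℤ.- (1ℤ ℤ.+ + toℕ j ℤ.* + toℕ j)

      residue : Fin (suc h ℕ.+ suc h) → Fin p
      residue i = fromℕ< (n%ℕd<d (value (splitAt (suc h) i)) p)

      Sum : Set
      Sum = ∃₂ λ a b → + p ∣ℤ 1ℤ ℤ.+ (a ℤ.* a ℤ.+ b ℤ.* b)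

      collision : ∀ x y → x ≢ y → + p ∣ℤ value x ℤ.- value y → Sum
      collision (inj₁ i) (inj₁ j) x≢y d = ⊥-elim (x≢y (cong inj₁ (squares-distinct i j d)))
      collision (inj₂ i) (inj₂ j) x≢y d =
          ⊥-elim (x≢y (cong inj₂ (sym (squares-distinct j i (subst (+ p ∣ℤ_) (neg-difference (+ toℕ i) (+ toℕ j)) d)))))
      collision (inj₁ i) (inj₂ j) _ d = + toℕ i , + toℕ j , subst (+ p ∣ℤ_) (mixed₁ (+ toℕ i) (+ toℕ j)) d
      collision (inj₂ j) (inj₁ i) _ d = + toℕ i , + toℕ j , subst (+ p ∣ℤ_) (mixed₂ (+ toℕ i) (+ toℕ j)) (∣m⇒∣-m d)

    minus-one-sum-of-squares : ∃₂ λ a b → + p ∣ℤ 1ℤ ℤ.+ (a ℤ.* a ℤ.+ b ℤ.* b)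
    minus-one-sum-of-squares =
      let i , j , i<j , e = pigeonhole (subst (_< suc h ℕ.+ suc h) (sym p≡) (s≤s (ℕ.≤-reflexive (sym (ℕ.+-suc h h))))) residue
          si = splitAt (suc h) i ; sj = splitAt (suc h) j
      in collision si sj
        (λ s≡ → Fin.<⇒≢ i<j (trans (sym (join-splitAt (suc h) (suc h) i))
            (trans (cong (join (suc h) (suc h)) s≡) (join-splitAt (suc h) (suc h) j))))
        (%ℕ-≡⇒∣ (value si) (value sj) (trans (sym (toℕ-fromℕ< _)) (trans (cong toℕ e) (toℕ-fromℕ< _))))

  -- Modulo 1 + a² + b² the product ᾱ (s + ti)(a + bi + j) has the form (u + vi)(a + bi + j),
  -- so it is determined by its j- and k-coordinates u and v; m is the matrix (s , t) ↦ (u , v).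
  module LineOps {A : Set} (_+_ _*_ : A → A → A) (-_ : A → A) (one zero : A) where
    private
      diag off : A → A → Quat A → A
      diag a b α = (a * jm α) + (b * km α)
      off a b α = (b * jm α) + (- (a * km α))

    m₁₁ m₁₂ m₂₁ m₂₂ : A → A → Quat A → A
    m₁₁ a b α = re α + (- diag a b α)
    m₁₂ a b α = im α + off a b α
    m₂₁ a b α = (- im α) + off a b α
    m₂₂ a b α = re α + diag a b α

    complex : A → A → Quat A
    complex s t = quat s t zero zero

    generator : A → A → Quat A
    generator a b = quat a b one zero

    norm₀ : A → A → A
    norm₀ a b = one + ((a * a) + (b * b))

  open LineOps ℤ._+_ ℤ._*_ ℤ.-_ 1ℤ 0ℤ public
  private module PL {n} = LineOps {S.Polynomial n} _:+_ _:*_ :-_ (con 1ℤ) (con 0ℤ)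

  line : ℤ → ℤ → ℤ × ℤ → ℍ
  line a b (s , t) = complex s t ⊗ generator a b

  private
    Pℍ : Set
    Pℍ = Quat (S.Polynomial 13)

    lineP : Pℍ → Pℍ
    lineP v = P.mul (PL.complex (jm v) (km v)) (PL.generator (re v) (im v))

    productP : Pℍ → Pℍ → Pℍ
    productP α v = P.mul (P.cnj α) (lineP v)

  opaque
    unfolding _⊗_

    jm-product : ∀ a b s t α → jm (conj α ⊗ line a b (s , t)) ≡ m₁₁ a b α ℤ.* s ℤ.+ m₁₂ a b α ℤ.* t
    jm-product a b s t α = solveℤ 0ℤ α (quat a b s t) α (λ _ α v _ →
      jm (productP α v) , PL.m₁₁ (re v) (im v) α :* jm v :+ PL.m₁₂ (re v) (im v) α :* km v) refl

    km-product : ∀ a b s t α → km (conj α ⊗ line a b (s , t)) ≡ m₂₁ a b α ℤ.* s ℤ.+ m₂₂ a b α ℤ.* t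
    km-product a b s t α = solveℤ 0ℤ α (quat a b s t) α (λ _ α v _ →
      km (productP α v) , PL.m₂₁ (re v) (im v) α :* jm v :+ PL.m₂₂ (re v) (im v) α :* km v) refl

    re-product : ∀ a b s t α → let β = conj α ⊗ line a b (s , t) in
      re β ≡ (a ℤ.* jm β ℤ.+ ℤ.- b ℤ.* km β) ℤ.+ (jm α ℤ.* s ℤ.+ km α ℤ.* t) ℤ.* norm₀ a b
    re-product a b s t α = solveℤ 0ℤ α (quat a b s t) α (λ _ α v _ →
      re (productP α v) , (re v :* jm (productP α v) :+ :- im v :* km (productP α v)) :+
          (jm α :* jm v :+ km α :* km v) :* PL.norm₀ (re v) (im v)) refl

    im-product : ∀ a b s t α → let β = conj α ⊗ line a b (s , t) in
      im β ≡ (b ℤ.* jm β ℤ.+ a ℤ.* km β) ℤ.+ (km α ℤ.* s ℤ.- jm α ℤ.* t) ℤ.* norm₀ a b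
    im-product a b s t α = solveℤ 0ℤ α (quat a b s t) α (λ _ α v _ →
      im (productP α v) , (im v :* jm (productP α v) :+ re v :* km (productP α v)) :+
          (km α :* jm v S.:- jm α :* km v) :* PL.norm₀ (re v) (im v)) refl

    nm-line : ∀ a b s t → nm (line a b (s , t)) ≡ (s ℤ.* s ℤ.+ t ℤ.* t) ℤ.* norm₀ a b
    nm-line a b s t = solveℤ 0ℤ (quat a b s t) (quat a b s t) (quat a b s t) (λ _ v _ _ →
      P.nrm (lineP v) , (jm v :* jm v :+ km v :* km v) :* PL.norm₀ (re v) (im v)) refl

    jm-line : ∀ a b s t → jm (line a b (s , t)) ≡ s
    jm-line a b s t = solveℤ 0ℤ (quat a b s t) (quat a b s t) (quat a b s t) (λ _ v _ _ → jm (lineP v) , jm v) refl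

    km-line : ∀ a b s t → km (line a b (s , t)) ≡ t
    km-line a b s t = solveℤ 0ℤ (quat a b s t) (quat a b s t) (quat a b s t) (λ _ v _ _ → km (lineP v) , km v) refl

    -- When p ∣ 1 + a² + b², the determinant is the norm modulo p, so an α of norm p has a singular
    -- matrix.
    line-determinant : ∀ a b α → m₁₁ a b α ℤ.* m₂₂ a b α ℤ.- m₁₂ a b α ℤ.* m₂₁ a b α ≡
      1ℤ ℤ.* nm α ℤ.+ (ℤ.- (jm α ℤ.* jm α ℤ.+ km α ℤ.* km α)) ℤ.* norm₀ a b
    line-determinant a b α = solveℤ 0ℤ α (quat a b a b) α (λ _ α v _ → let a = re v ; b = im v in
      PL.m₁₁ a b α :* PL.m₂₂ a b α S.:- PL.m₁₂ a b α :* PL.m₂₁ a b α ,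
      con 1ℤ :* P.nrm α :+ (:- (jm α :* jm α :+ km α :* km α)) :* PL.norm₀ a b) refl

    -- If p divides 1 + a² + b² and the matrix, the next four identities give p ∣ 2α.
    re-recover : ∀ a b α → + 2 ℤ.* re α ≡ 1ℤ ℤ.* m₁₁ a b α ℤ.+ 1ℤ ℤ.* m₂₂ a b α
    re-recover a b α = solveℤ 0ℤ α (quat a b a b) α (λ _ α v _ → let a = re v ; b = im v in
      con (+ 2) :* re α , con 1ℤ :* PL.m₁₁ a b α :+ con 1ℤ :* PL.m₂₂ a b α) refl

    im-recover : ∀ a b α → + 2 ℤ.* im α ≡ 1ℤ ℤ.* m₁₂ a b α ℤ.+ ℤ.- 1ℤ ℤ.* m₂₁ a b α
    im-recover a b α = solveℤ 0ℤ α (quat a b a b) α (λ _ α v _ → let a = re v ; b = im v in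
      con (+ 2) :* im α , con 1ℤ :* PL.m₁₂ a b α :+ con (ℤ.- 1ℤ) :* PL.m₂₁ a b α) refl

    jm-recover : ∀ a b α → + 2 ℤ.* jm α ≡
      (+ 2 ℤ.* jm α) ℤ.* norm₀ a b ℤ.+ ℤ.- 1ℤ ℤ.* (a ℤ.* (m₂₂ a b α ℤ.- m₁₁ a b α) ℤ.+ b ℤ.* (m₁₂ a b α ℤ.+ m₂₁ a b α))
    jm-recover a b α = solveℤ 0ℤ α (quat a b a b) α (λ _ α v _ → let a = re v ; b = im v in
      con (+ 2) :* jm α , (con (+ 2) :* jm α) :* PL.norm₀ a b :+
          con (ℤ.- 1ℤ) :* (a :* (PL.m₂₂ a b α S.:- PL.m₁₁ a b α) :+ b :* (PL.m₁₂ a b α :+ PL.m₂₁ a b α))) refl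

    km-recover : ∀ a b α → + 2 ℤ.* km α ≡
      (+ 2 ℤ.* km α) ℤ.* norm₀ a b ℤ.+ ℤ.- 1ℤ ℤ.*
          (b ℤ.* (m₂₂ a b α ℤ.- m₁₁ a b α) ℤ.+ ℤ.- a ℤ.* (m₁₂ a b α ℤ.+ m₂₁ a b α))
    km-recover a b α = solveℤ 0ℤ α (quat a b a b) α (λ _ α v _ → let a = re v ; b = im v in
      con (+ 2) :* km α , (con (+ 2) :* km α) :* PL.norm₀ a b :+
          con (ℤ.- 1ℤ) :* (b :* (PL.m₂₂ a b α S.:- PL.m₁₁ a b α) :+ (:- a) :* (PL.m₁₂ a b α :+ PL.m₂₁ a b α))) refl

-- The number of quaternions of norm p.

module PrimeNorm where
  open Cardinality
  open ThetaCoefficients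
  open Quaternions
  open Residues
  open LagrangeDescent
  open NormDivisors
  open ProjectiveLine
  open LineIdeals
  open import Data.Empty using (⊥)
  open import Data.Integer using (ℤ; +_; 1ℤ)
  open import Data.Integer.Divisibility.Signed using (divides) renaming (_∣_ to _∣ℤ_)
  open import Data.Integer.Solver using (module +-*-Solver)
  open import Data.Nat using (ℕ; _≥_)
  open import Data.Nat.Primality using (Prime)
  open import Data.Product using (_×_; _,_; ∃; proj₁; proj₂)
  open import Data.Sum using (inj₁; inj₂)
  open import Relation.Nullary using (¬_)
  open import Relation.Binary.PropositionalEquality
  import Data.Nat.Properties as ℕ
  import Data.Integer as ℤ
  import Data.Integer.Properties as ℤ
  open import Data.Integer.Divisibility.Signed using (∣m∣n⇒∣m+n; ∣n⇒∣m*n; ∣m∣n⇒∣m-n)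
  import Data.Nat as ℕ

  module NormPrime {p : ℕ} (pr : Prime p) (p≥3 : p ≥ 3) where
    open Local pr p≥3
    open Lines pr p≥3
    open SumOfSquares pr p≥3

    module _ (a b : ℤ) (p∣n₀ : + p ∣ℤ norm₀ a b) where
      private
        Annihilates : ℤ × ℤ → ℍ → Set
        Annihilates w α = nm α ≡ + p × + p ∣ℍ conj α ⊗ line a b w

        line-nonzero : ∀ {w} → Line w → ¬ + p ∣ℍ line a b w
        line-nonzero {s , t} l d = go l
          where
          p∣s : + p ∣ℤ s
          p∣s = subst (+ p ∣ℤ_) (jm-line a b s t) (proj₁ (proj₂ (proj₂ (∣ℍ⇒∣ d))))
          p∣t : + p ∣ℤ t
          p∣t = subst (+ p ∣ℤ_) (km-line a b s t) (proj₂ (proj₂ (proj₂ (∣ℍ⇒∣ d))))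
          go : Line (s , t) → ⊥
          go (inj₁ (_ , _ , e)) = p∤1 (subst (+ p ∣ℤ_) (sym (cong proj₁ e)) p∣s)
          go (inj₂ e) = p∤1 (subst (+ p ∣ℤ_) (sym (cong proj₂ e)) p∣t)

        Card-annihilators : ∀ {w} → Line w → Card (Annihilates w) 8
        Card-annihilators {s , t} l = Card-divisors (line a b (s , t)) {proj₁ nmy} (proj₂ nmy) (line-nonzero l)
          where
          nmy : ∃ λ k → nm (line a b (s , t)) ≡ + p ℤ.* k
          nmy with ∣n⇒∣m*n (s ℤ.* s ℤ.+ t ℤ.* t) p∣n₀
          ... | divides k e = k , trans (nm-line a b s t) (trans e (ℤ.*-comm k (+ p)))

        module _ (α : ℍ) (nmα : nm α ≡ + p) where
          A = m₁₁ a b α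
          B = m₁₂ a b α
          C = m₂₁ a b α
          D = m₂₂ a b α

          matrix-nonzero : ¬ (+ p ∣ℤ A × + p ∣ℤ B × + p ∣ℤ C × + p ∣ℤ D)
          matrix-nonzero (dA , dB , dC , dD) = norm-p⇒p∤ nmα (∣⇒∣ℍ
            (halve (re α) (combine {A} {D} 1ℤ 1ℤ dA dD (re-recover a b α)))
            (halve (im α) (combine {B} {C} 1ℤ (ℤ.- 1ℤ) dB dC (im-recover a b α)))
            (halve (jm α) (combine {norm₀ a b} {a ℤ.* (D ℤ.- A) ℤ.+ b ℤ.* (B ℤ.+ C)} (+ 2 ℤ.* jm α) (ℤ.- 1ℤ) p∣n₀
               (∣m∣n⇒∣m+n (∣n⇒∣m*n a dD-A) (∣n⇒∣m*n b dB+C)) (jm-recover a b α)))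
            (halve (km α) (combine {norm₀ a b} {b ℤ.* (D ℤ.- A) ℤ.+ ℤ.- a ℤ.* (B ℤ.+ C)} (+ 2 ℤ.* km α) (ℤ.- 1ℤ) p∣n₀
               (∣m∣n⇒∣m+n (∣n⇒∣m*n b dD-A) (∣n⇒∣m*n (ℤ.- a) dB+C)) (km-recover a b α))))
            where
            dD-A = ∣m∣n⇒∣m-n dD dA
            dB+C = ∣m∣n⇒∣m+n dB dC

          det : + p ∣ℤ A ℤ.* D ℤ.- B ℤ.* C
          det = combine {nm α} {norm₀ a b} 1ℤ (ℤ.- (jm α ℤ.* jm α ℤ.+ km α ℤ.* km α))
            (divides 1ℤ (trans nmα (sym (ℤ.*-identityˡ (+ p))))) p∣n₀ (line-determinant a b α)

          open Kernel A B C D det matrix-nonzero public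

          kernel⇒annihilates : ∀ w → InKernel w → + p ∣ℍ conj α ⊗ line a b w
          kernel⇒annihilates (s , t) (u , v) = ∣⇒∣ℍ
            (subst (+ p ∣ℤ_) (sym (re-product a b s t α))
                (∣m∣n⇒∣m+n (∣m∣n⇒∣m+n (∣n⇒∣m*n a dj) (∣n⇒∣m*n (ℤ.- b) dk)) (∣n⇒∣m*n (jm α ℤ.* s ℤ.+ km α ℤ.* t) p∣n₀)))
            (subst (+ p ∣ℤ_) (sym (im-product a b s t α))
                (∣m∣n⇒∣m+n (∣m∣n⇒∣m+n (∣n⇒∣m*n b dj) (∣n⇒∣m*n a dk)) (∣n⇒∣m*n (km α ℤ.* s ℤ.- jm α ℤ.* t) p∣n₀)))
            dj dk
            where
            dj = subst (+ p ∣ℤ_) (sym (jm-product a b s t α)) u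
            dk = subst (+ p ∣ℤ_) (sym (km-product a b s t α)) v

          annihilates⇒kernel : ∀ w → + p ∣ℍ conj α ⊗ line a b w → InKernel w
          annihilates⇒kernel (s , t) d =
            subst (+ p ∣ℤ_) (jm-product a b s t α) (proj₁ (proj₂ (proj₂ (∣ℍ⇒∣ d)))) ,
            subst (+ p ∣ℤ_) (km-product a b s t α) (proj₂ (proj₂ (proj₂ (∣ℍ⇒∣ d))))

      -- Count pairs of a line and an α annihilating it: 8 of them lie over each of the p + 1 lines,
      -- while each α has exactly one kernel line and so occurs in exactly one pair.
      Card-norm-p : Card (λ α → nm α ≡ + p) ((p ℕ.+ 1) ℕ.* 8)
      Card-norm-p = Card-bijection proj₂ (λ (_ , e , _) → e)
        (λ { {w , α} {w′ , .α} (l , e , d) (l′ , _ , d′) refl →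
          cong (_, α) (line-unique α e l l′ (annihilates⇒kernel α e w d) (annihilates⇒kernel α e w′ d′)) })
        (λ {α} e → let w , l , k = line-exists α e in (w , α) , (l , e , kernel⇒annihilates α e w k) , refl)
        (Card-fibres {R = Annihilates} Card-lines Card-annihilators)

    opaque
      r₄-prime : r₄ p ≡ (p ℕ.+ 1) ℕ.* 8
      r₄-prime = let a , b , d = minus-one-sum-of-squares in Card-unique (Card-nm p) (Card-norm-p a b d)

-- Double counting of products and conjugates.

module DoubleCounting where
  open Cardinality
  open ThetaCoefficients
  open Quaternions
  open Residues
  open LagrangeDescent
  open NormDivisors
  open Conjugators
  open ProjectiveLine
  open LineIdeals
  open PrimeNorm
  open import Data.Integer using (ℤ; +_; 0ℤ)
  open import Data.Integer.Divisibility.Signed using () renaming (_∣?_ to _∣ℤ?_)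
  open import Data.Integer.Solver using (module +-*-Solver)
  open import Data.Nat using (ℕ; _≥_; NonZero)
  open import Data.Nat.Primality using (Prime; prime⇒nonZero)
  open import Data.Product using (_×_; _,_; ∃₂; proj₁; proj₂)
  open import Data.Sum using (inj₁; inj₂; _⊎_)
  open import Relation.Nullary using (¬_; Dec; yes; no)
  open import Relation.Binary.PropositionalEquality
  import Data.Nat.Properties as ℕ
  import Data.Integer as ℤ
  import Data.Integer.Properties as ℤ
  open +-*-Solver using (_:*_)
  import Data.Nat as ℕ
  import Data.Nat.Solver as ℕ

  Card-fibres-split : ∀ {A B : Set} {P Q : A → Set} {R : A → B → Set} {n c d} → (∀ x → Dec (Q x)) → Card P n →
    (∀ {x} → P x → Q x → Card (R x) c) → (∀ {x} → P x → ¬ Q x → Card (R x) d) →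
    ∃₂ λ k l → Card (λ x → P x × Q x) k × k ℕ.+ l ≡ n × Card (λ (x , y) → P x × R x y) (k ℕ.* c ℕ.+ l ℕ.* d)
  Card-fibres-split {A} {B} {P} {Q} {R} Q? C yes-fibre no-fibre =
    let k , l , K , L , k+l = Card-split Q? C in k , l , K , k+l ,
      Card-cong {P = λ w → In w ⊎ Out w}
        (λ { (inj₁ ((p , _) , r)) → p , r ; (inj₂ ((p , _) , r)) → p , r }) (λ {w} → classify w)
        (Card-⊎ {P = In} {Q = Out} (λ ((_ , q) , _) ((_ , ¬q) , _) → ¬q q)
          (Card-fibres K (λ (p , q) → yes-fibre p q)) (Card-fibres L (λ (p , q) → no-fibre p q)))
    where
    In Out : A × B → Set
    In (x , y) = (P x × Q x) × R x y
    Out (x , y) = (P x × ¬ Q x) × R x y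
    classify : ∀ w → P (proj₁ w) × R (proj₁ w) (proj₂ w) → In w ⊎ Out w
    classify (x , y) (p , r) with Q? x
    ... | yes q = inj₁ ((p , q) , r)
    ... | no ¬q = inj₂ ((p , ¬q) , r)

  infix 4 _∣ℍ?_
  _∣ℍ?_ : ∀ k x → Dec (k ∣ℍ x)
  k ∣ℍ? x = Relation.Nullary.Decidable.map′ (λ (a , b , c , d) → ∣⇒∣ℍ a b c d) ∣ℍ⇒∣
    (k ∣ℤ? re x ×-dec k ∣ℤ? im x ×-dec k ∣ℤ? jm x ×-dec k ∣ℤ? km x)
    where
    import Relation.Nullary.Decidable
    open Relation.Nullary.Decidable using (_×-dec_)

  opaque
    unfolding _⊗_

    re-conjugate : ∀ α x → re ((α ⊗ x) ⊗ conj α) ≡ nm α ℤ.* re x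
    re-conjugate α x = solveℤ 0ℤ α x x (λ _ α x _ → re (P.mul (P.mul α x) (P.cnj α)) , P.nrm α :* re x) refl

    Card-pure : ∀ n → Card (λ x → Pure x × nm x ≡ + n) (r₃ n)
    Card-pure n = Card-bijection (λ (b , c , d) → quat 0ℤ b c d)
      (λ { {b , c , d} e → refl , trans (nm-nmℕ (quat 0ℤ b c d)) (cong +_ e) })
      (λ { _ _ refl → refl })
      (λ { {x} (refl , e) → (im x , jm x , km x) , nmℕ-nm {x} e , refl })
      (Counts-r₃ n)

  module DoubleCount {p : ℕ} (pr : Prime p) (p≥3 : p ≥ 3) where
    open Local pr p≥3
    open Fibres pr p≥3
    open NormPrime pr p≥3
    private
      instance
        p≢0 : NonZero p
        p≢0 = prime⇒nonZero pr
        p²≢0 : ℤ.NonZero (+ p ℤ.* + p)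
        p²≢0 = ℤ.i*j≢0 (+ p) (+ p)

    -- (α , x) goes to (αx , α), and x is recovered as ᾱy/p.
    pairs-product : ∀ n → Card (λ (y , α) → nm y ≡ + (p ℕ.* n) × (nm α ≡ + p × + p ∣ℍ conj α ⊗ y)) (r₄ p ℕ.* r₄ n)
    pairs-product n = Card-bijection (λ (α , x) → α ⊗ x , α)
      (λ { {α , x} (e , e′) → trans (nm-⊗ α x) (trans (cong₂ ℤ._*_ e e′) (sym (ℤ.pos-* p n))) ,
            e , x , trans (conj-⊗-⊗ α x) (cong (_• x) e) })
      (λ { {α , x} {α′ , x′} (e , _) _ q → inj {α} {x} {α′} {x′} e (cong proj₁ q) (cong proj₂ q) })
      (λ { {y , α} (ey , e , z , q) → let αz = factor α y z e q in (α , z) , (e , norm α y z e ey αz) , cong (_, α) αz })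
      (Card-× (Card-nm p) (Card-nm n))
      where
      inj : ∀ {α x α′ x′} → nm α ≡ + p → α ⊗ x ≡ α′ ⊗ x′ → α ≡ α′ → (α , x) ≡ (α′ , x′)
      inj {α} {x} {_} {x′} e q refl = cong (α ,_) (•-cancelˡ (+ p) (trans (cong (_• x) (sym e))
        (trans (sym (conj-⊗-⊗ α x)) (trans (cong (conj α ⊗_) q) (trans (conj-⊗-⊗ α x′) (cong (_• x′) e))))))
      factor : ∀ α y z → nm α ≡ + p → conj α ⊗ y ≡ + p • z → α ⊗ z ≡ y
      factor α y z e q = •-cancelˡ (+ p) (trans (sym (•-⊗ʳ (+ p) α z)) (trans (cong (α ⊗_) (sym q))
        (trans (⊗-conj-⊗ α y) (cong (_• y) e))))
      norm : ∀ α y z → nm α ≡ + p → nm y ≡ + (p ℕ.* n) → α ⊗ z ≡ y → nm z ≡ + n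
      norm α y z e ey q = ℤ.*-cancelˡ-≡ (+ p) _ _ (trans (cong (ℤ._* nm z) (sym e)) (trans (sym (nm-⊗ α z))
        (trans (cong nm q) (trans ey (ℤ.pos-* p n)))))

    -- `k` counts the y divisible by p, over which every α of norm p lies; over each of the other
    -- `l` there are 8.
    r₄-count : ∀ n → ∃₂ λ k l → k ℕ.+ l ≡ r₄ (p ℕ.* n) × r₄ p ℕ.* r₄ n ≡ k ℕ.* r₄ p ℕ.+ l ℕ.* 8
    r₄-count n = let k , l , _ , k+l , C = Card-fibres-split (+ p ∣ℍ?_) (Card-nm (p ℕ.* n))
                       (λ {y} _ d → Card-cong (λ {α} e → e , ∣ℍ-⊗ˡ (conj α) d) proj₁ (Card-nm p))
                       (λ {y} e p∤y → Card-divisors y {+ n} (trans e (ℤ.pos-* p n)) p∤y)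
      in k , l , k+l , Card-unique (pairs-product n) C

    private
      nm-conjugate : ∀ α x {c} → nm α ≡ + p → nm x ≡ c → nm ((α ⊗ x) ⊗ conj α) ≡ + p ℤ.* + p ℤ.* c
      nm-conjugate α x {c} e e′ = trans (nm-⊗ (α ⊗ x) (conj α))
          (trans (cong₂ ℤ._*_ (trans (nm-⊗ α x) (cong₂ ℤ._*_ e e′)) (trans (nm-conj α) e))
        (trans (ℤ.*-assoc (+ p) c (+ p)) (trans (cong (+ p ℤ.*_) (ℤ.*-comm c (+ p))) (sym (ℤ.*-assoc (+ p) (+ p) c)))))

      conjugate-back : ∀ α x → nm α ≡ + p → (conj α ⊗ ((α ⊗ x) ⊗ conj α)) ⊗ α ≡ (+ p ℤ.* + p) • x
      conjugate-back α x e = begin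
        (conj α ⊗ ((α ⊗ x) ⊗ conj α)) ⊗ α     ≡⟨ cong (_⊗ α) (sym (⊗-assoc (conj α) (α ⊗ x) (conj α))) ⟩
        ((conj α ⊗ (α ⊗ x)) ⊗ conj α) ⊗ α     ≡⟨ ⊗-conj-⊗ʳ α (conj α ⊗ (α ⊗ x)) ⟩
        nm α • (conj α ⊗ (α ⊗ x))             ≡⟨ cong₂ _•_ e (trans (conj-⊗-⊗ α x) (cong (_• x) e)) ⟩
        + p • (+ p • x)                       ≡⟨ sym (•-assoc (+ p) (+ p) x) ⟩
        (+ p ℤ.* + p) • x                     ∎
        where open ≡-Reasoning

      conjugate-forth : ∀ α y z → nm α ≡ + p → (conj α ⊗ y) ⊗ α ≡ (+ p ℤ.* + p) • z → (α ⊗ z) ⊗ conj α ≡ y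
      conjugate-forth α y z e q = •-cancelˡ (+ p ℤ.* + p) (begin
        (+ p ℤ.* + p) • ((α ⊗ z) ⊗ conj α)          ≡⟨ sym (•-⊗ˡ _ (α ⊗ z) (conj α)) ⟩
        ((+ p ℤ.* + p) • (α ⊗ z)) ⊗ conj α          ≡⟨ cong (_⊗ conj α) (sym (•-⊗ʳ _ α z)) ⟩
        (α ⊗ ((+ p ℤ.* + p) • z)) ⊗ conj α          ≡⟨ cong (λ t → (α ⊗ t) ⊗ conj α) (sym q) ⟩
        (α ⊗ ((conj α ⊗ y) ⊗ α)) ⊗ conj α           ≡⟨ ⊗-assoc α ((conj α ⊗ y) ⊗ α) (conj α) ⟩
        α ⊗ (((conj α ⊗ y) ⊗ α) ⊗ conj α)           ≡⟨
            cong (α ⊗_) (trans (⊗-⊗-conj α (conj α ⊗ y)) (cong (_• (conj α ⊗ y)) e)) ⟩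
        α ⊗ (+ p • (conj α ⊗ y))                    ≡⟨ •-⊗ʳ (+ p) α (conj α ⊗ y) ⟩
        + p • (α ⊗ (conj α ⊗ y))                    ≡⟨ cong (+ p •_) (trans (⊗-conj-⊗ α y) (cong (_• y) e)) ⟩
        + p • (+ p • y)                             ≡⟨ sym (•-assoc (+ p) (+ p) y) ⟩
        (+ p ℤ.* + p) • y                           ∎)
        where open ≡-Reasoning

      pure-conjugate : ∀ α x → nm α ≡ + p → Pure x → Pure ((α ⊗ x) ⊗ conj α)
      pure-conjugate α x e r = trans (re-conjugate α x) (trans (cong (nm α ℤ.*_) r) (ℤ.*-zeroʳ (nm α)))

      pure-conjugate⁻ : ∀ α x → nm α ≡ + p → Pure ((α ⊗ x) ⊗ conj α) → Pure x
      pure-conjugate⁻ α x e r = ℤ.*-cancelˡ-≡ (+ p) _ _ (trans (cong (ℤ._* re x) (sym e))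
        (trans (sym (re-conjugate α x)) (trans r (sym (ℤ.*-zeroʳ (+ p))))))

    PureNorm : ℤ → ℍ → Set
    PureNorm c y = Pure y × nm y ≡ c

    -- From y = αxᾱ one recovers x = ᾱyα/p². Purity passes both ways because conjugation multiplies
    -- the real part by nm α = p.
    pairs-conjugate : ∀ n → Card (λ (y , α) → PureNorm (+ p ℤ.* + p ℤ.* + n) y × Conjugator y α) (r₄ p ℕ.* r₃ n)
    pairs-conjugate n = Card-bijection (λ (α , x) → (α ⊗ x) ⊗ conj α , α)
      (λ { {α , x} (e , r , e′) → (pure-conjugate α x e r , nm-conjugate α x e e′) , e , x , conjugate-back α x e })
      (λ { {α , x} {α′ , x′} (e , _) _ q → inj {α} {x} {α′} {x′} e (cong proj₁ q) (cong proj₂ q) })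
      (λ { {y , α} ((r , ey) , e , z , q) → let y≡ = conjugate-forth α y z e q in (α , z) ,
           (e , pure-conjugate⁻ α z e (trans (cong re y≡) r) ,
            ℤ.*-cancelˡ-≡ (+ p ℤ.* + p) _ _ (trans (sym (nm-conjugate α z e refl)) (trans (cong nm y≡) ey))) ,
                cong (_, α) y≡ })
      (Card-× (Card-nm p) (Card-pure n))
      where
      inj : ∀ {α x α′ x′} → nm α ≡ + p → (α ⊗ x) ⊗ conj α ≡ (α′ ⊗ x′) ⊗ conj α′ → α ≡ α′ → (α , x) ≡ (α′ , x′)
      inj {α} {x} {_} {x′} e q refl = cong (α ,_) (•-cancelˡ (+ p ℤ.* + p) (trans (sym (conjugate-back α x e))
        (trans (cong (λ t → (conj α ⊗ t) ⊗ α) q) (conjugate-back α x′ e))))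

    pure-•⁻ : ∀ k .{{_ : ℤ.NonZero k}} z → Pure (k • z) → Pure z
    pure-•⁻ k z r = ℤ.*-cancelˡ-≡ k _ _ (trans (sym (re-• k z)) (trans r (sym (ℤ.*-zeroʳ k))))

    -- Either p ∤ y, or y = pz with p ∤ z. The factor m · p of the norm beyond p² is what leaves p ∣
    -- nm z in the second case.
    Card-conjugators : ∀ m {y} → PureNorm (+ p ℤ.* + p ℤ.* + (p ℕ.* m)) y → ¬ (+ p ℤ.* + p ∣ℍ y) → Card (Conjugator y) 8
    Card-conjugators m {y} (r , e) p²∤y = cases (+ p ∣ℍ? y)
      where
      cases : Dec (+ p ∣ℍ y) → Card (Conjugator y) 8
      cases (no p∤y) = Card-conjugators-p∤ y {+ (p ℕ.* m)} r (trans e (ℤ.*-assoc (+ p) (+ p) (+ (p ℕ.* m)))) p∤y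
      cases (yes (z , y≡)) = subst (λ t → Card (Conjugator t) 8) (sym y≡) (Card-conjugators-p∣ z {+ m}
        (pure-•⁻ (+ p) z (trans (cong re (sym y≡)) r))
        (ℤ.*-cancelˡ-≡ (+ p ℤ.* + p) _ _
            (trans (sym (nm-• (+ p) z)) (trans (cong nm (sym y≡)) (trans e (cong (+ p ℤ.* + p ℤ.*_) (ℤ.pos-* p m))))))
        (λ (w , z≡) → p²∤y (w , trans y≡ (trans (cong (+ p •_) z≡) (sym (•-assoc (+ p) (+ p) w))))))

    -- `k` counts the y divisible by p², that is, r₃(n/p²). It is pinned down by any enumeration of
    -- the z with p² nm z = n, which also makes sense when p² ∤ n and the count is 0.
    r₃-count : ∀ m → let n = p ℕ.* m in
      ∃₂ λ k l → (∀ {j} → Card (λ z → Pure z × (+ p ℤ.* + p) ℤ.* nm z ≡ + n) j → j ≡ k) ×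
          k ℕ.+ l ≡ r₃ (p ℕ.* p ℕ.* n) × r₄ p ℕ.* r₃ n ≡ k ℕ.* r₄ p ℕ.+ l ℕ.* 8
    r₃-count m = let k , l , K , k+l , C = Card-fibres-split ((+ p ℤ.* + p) ∣ℍ?_) Card-y
                       (λ {y} _ d → Card-cong (λ {α} e → e , ∣ℍ-⊗ʳ α (∣ℍ-⊗ˡ (conj α) d)) proj₁ (Card-nm p))
                       (Card-conjugators m)
      in k , l , (λ Z → Card-unique (Card-multiples Z) K) , k+l , Card-unique (pairs-conjugate n) C
      where
      n = p ℕ.* m
      Card-y : Card (PureNorm (+ p ℤ.* + p ℤ.* + n)) (r₃ (p ℕ.* p ℕ.* n))
      Card-y = subst (λ c → Card (PureNorm c) (r₃ (p ℕ.* p ℕ.* n)))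
        (trans (ℤ.pos-* (p ℕ.* p) n) (cong (ℤ._* + n) (ℤ.pos-* p p))) (Card-pure (p ℕ.* p ℕ.* n))
      p² = + p ℤ.* + p
      Card-multiples : ∀ {j} → Card (λ z → Pure z × p² ℤ.* nm z ≡ + n) j →
        Card (λ y → PureNorm (p² ℤ.* + n) y × p² ∣ℍ y) j
      Card-multiples = Card-bijection (p² •_)
        (λ {z} (r , e) → (trans (re-• p² z) (trans (cong (p² ℤ.*_) r) (ℤ.*-zeroʳ p²)) ,
                          trans (nm-• p² z) (trans (ℤ.*-assoc p² p² (nm z)) (cong (p² ℤ.*_) e))) , z , refl)
        (λ _ _ → •-cancelˡ p²)
        (λ { ((r , e) , z , refl) → z , (pure-•⁻ p² z r ,
             ℤ.*-cancelˡ-≡ p² _ _ (trans (sym (ℤ.*-assoc p² p² (nm z))) (trans (sym (nm-• p² z)) e))) , refl })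

-- The recurrence for r₃ along odd powers of p, and geometric sums modulo 7.

module HeckeRecurrence where
  open Cardinality
  open ThetaCoefficients
  open Quaternions
  open Residues
  open PrimeNorm
  open NormDivisors
  open DoubleCounting
  open import Data.Integer using (ℤ; +_)
  open import Data.Nat
  open import Data.Nat.DivMod using (m≡m%n+[m/n]*n)
  open import Data.Nat.Divisibility
  open import Data.Nat.Primality using (Prime; prime⇒nonZero)
  open import Data.Nat.Properties
  open import Data.Nat.Solver using (module +-*-Solver)
  open import Data.Product using (_×_; _,_; ∃; ∃₂)
  open import Relation.Nullary using (¬_)
  open import Relation.Binary.PropositionalEquality
  import Data.Integer as ℤ
  import Data.Integer.Properties as ℤ
  open +-*-Solver using (solve; _:+_; _:*_; _:=_; con)

  -- 1 + x + ⋯ + x^j has j + 1 terms; hence the periods `suc q` below.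
  geometric : ℕ → ℕ → ℕ
  geometric x zero    = 1
  geometric x (suc j) = x * geometric x j + 1

  geometric-+ : ∀ x q j → geometric x (suc q + j) ≡ geometric x q + x ^ suc q * geometric x j
  geometric-+ x zero j = solve 2 (λ x g → x :* g :+ con 1 := con 1 :+ (x :* con 1) :* g) refl x (geometric x j)
  geometric-+ x (suc q) j = trans (cong (λ g → x * g + 1) (geometric-+ x q j))
    (solve 4 (λ x g y h → x :* (g :+ y :* h) :+ con 1 := (x :* g :+ con 1) :+ (x :* y) :* h) refl
       x (geometric x q) (x ^ suc q) (geometric x j))

  geometric-shift : ∀ r c j → ∃ λ z → geometric (r + c * 7) j ≡ geometric r j + z * 7
  geometric-shift r c zero = 0 , refl
  geometric-shift r c (suc j) = let z , e = geometric-shift r c j ; g = geometric r j in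
    c * g + r * z + c * 7 * z , trans (cong (λ g → (r + c * 7) * g + 1) e)
      (solve 4 (λ r c g z → (r :+ c :* con 7) :* (g :+ z :* con 7) :+ con 1 :=
         (r :* g :+ con 1) :+ (c :* g :+ r :* z :+ c :* con 7 :* z) :* con 7) refl r c g z)

  -- The sum splits into α + 1 blocks of q + 1 terms, each a power of x times the first block.
  ∣-geometric-periodic : ∀ x q α → 7 ∣ geometric x q → 7 ∣ geometric x (q + α * suc q)
  ∣-geometric-periodic x q zero d = subst (λ j → 7 ∣ geometric x j) (sym (+-identityʳ q)) d
  ∣-geometric-periodic x q (suc α) d = subst (λ j → 7 ∣ geometric x j) shift
    (subst (7 ∣_) (sym (geometric-+ x q (q + α * suc q)))
      (∣m∣n⇒∣m+n d (∣n⇒∣m*n (x ^ suc q) (∣-geometric-periodic x q α d))))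
    where
    shift : suc q + (q + α * suc q) ≡ q + suc α * suc q
    shift = solve 2 (λ q t → (con 1 :+ q) :+ (q :+ t) := q :+ ((con 1 :+ q) :+ t)) refl q (α * suc q)

  ∣-geometric-mod : ∀ x q → 7 ∣ geometric (x % 7) q → 7 ∣ geometric x q
  ∣-geometric-mod x q d = let z , e = geometric-shift (x % 7) (x / 7) q in
    subst (λ y → 7 ∣ geometric y q) (sym (m≡m%n+[m/n]*n x 7)) (subst (7 ∣_) (sym e) (∣m∣n⇒∣m+n d (divides z refl)))

  module Recurrence {p : ℕ} (pr : Prime p) (p≥3 : p ≥ 3) where
    open NormPrime pr p≥3
    open DoubleCount pr p≥3
    private instance
      p≢0 : NonZero p
      p≢0 = prime⇒nonZero pr
      p²≢0 : ℤ.NonZero (+ p ℤ.* + p)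
      p²≢0 = ℤ.i*j≢0 (+ p) (+ p)

    -- Put r₄(p) = 8(p + 1) into the double count and cancel 8; `k` plays the part of r₃(n/p²), with
    -- n = pm.
    r₃-hecke : ∀ m k → Card (λ z → Pure z × (+ p ℤ.* + p) ℤ.* nm z ≡ + (p * m)) k →
      r₃ (p * (p * (p * m))) + p * k ≡ p * r₃ (p * m) + r₃ (p * m)
    r₃-hecke m k Z = combine-counts (r₃-count m)
      where
      open ≡-Reasoning
      n = p * m
      combine-counts : (∃₂ λ k l → (∀ {j} → Card (λ z → Pure z × (+ p ℤ.* + p) ℤ.* nm z ≡ + n) j → j ≡ k) ×
          k + l ≡ r₃ (p * p * n) × r₄ p * r₃ n ≡ k * r₄ p + l * 8) →
        r₃ (p * (p * n)) + p * k ≡ p * r₃ n + r₃ n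
      combine-counts (k′ , l , k≡ , k+l , e) = begin
        r₃ (p * (p * n)) + p * k     ≡⟨ cong₂ (λ a b → r₃ a + p * b) (sym (*-assoc p p n)) (k≡ Z) ⟩
        r₃ (p * p * n) + p * k′      ≡⟨ cong (_+ p * k′) (sym k+l) ⟩
        (k′ + l) + p * k′            ≡⟨ *-cancelʳ-≡ _ _ 8 (begin
            ((k′ + l) + p * k′) * 8 ≡⟨
                solve 3
                (λ k l p → ((k :+ l) :+ p :* k) :* con 8 := k :* ((p :+ con 1) :* con 8) :+ l :* con 8) refl k′ l p ⟩
            k′ * ((p + 1) * 8) + l * 8        ≡⟨ cong (λ r → k′ * r + l * 8) (sym r₄-prime) ⟩
            k′ * r₄ p + l * 8                 ≡⟨ sym e ⟩
            r₄ p * r₃ n                       ≡⟨ cong (_* r₃ n) r₄-prime ⟩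
            (p + 1) * 8 * r₃ n                ≡⟨ rearrange p (r₃ n) ⟩
            (p * r₃ n + r₃ n) * 8             ∎) ⟩
        p * r₃ n + r₃ n              ∎
        where
        rearrange : ∀ p r → (p + 1) * 8 * r ≡ (p * r + r) * 8
        rearrange = solve 2 (λ p r → (p :+ con 1) :* con 8 :* r := (p :* r :+ r) :* con 8) refl

    module _ (N : ℕ) (p∤N : ¬ p ∣ N) where
      index : ℕ → ℕ
      index zero    = p * N
      index (suc j) = p * (p * index j)

      index-^ : ∀ j → index j ≡ p ^ (2 * j + 1) * N
      index-^ zero = cong (_* N) (sym (*-identityʳ p))
      index-^ (suc j) = begin
        p * (p * index j)                     ≡⟨ cong (λ i → p * (p * i)) (index-^ j) ⟩
        p * (p * (p ^ (2 * j + 1) * N))       ≡⟨ trans (cong (p *_) (sym (*-assoc p _ N))) (sym (*-assoc p _ N)) ⟩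
        p ^ (2 + (2 * j + 1)) * N ≡⟨
            cong (λ e → p ^ e * N)
            (solve 1 (λ j → con 2 :+ (con 2 :* j :+ con 1) := con 2 :* (con 1 :+ j) :+ con 1) refl j) ⟩
        p ^ (2 * suc j + 1) * N               ∎
        where open ≡-Reasoning

      private
        none : ∀ {z} → ¬ (Pure z × (+ p ℤ.* + p) ℤ.* nm z ≡ + (p * N))
        none {z} (_ , e) = p∤N (divides (nmℕ z) (*-cancelˡ-≡ N (nmℕ z * p) p (ℤ.+-injective (begin
          + (p * N)                         ≡⟨ sym e ⟩
          (+ p ℤ.* + p) ℤ.* nm z            ≡⟨ cong ((+ p ℤ.* + p) ℤ.*_) (nm-nmℕ z) ⟩
          (+ p ℤ.* + p) ℤ.* + nmℕ z         ≡⟨ cong (ℤ._* + nmℕ z) (sym (ℤ.pos-* p p)) ⟩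
          + (p * p) ℤ.* + nmℕ z             ≡⟨ sym (ℤ.pos-* (p * p) (nmℕ z)) ⟩
          + (p * p * nmℕ z)                 ≡⟨ cong +_ (trans (*-assoc p p (nmℕ z)) (cong (p *_) (*-comm p (nmℕ z)))) ⟩
          + (p * (nmℕ z * p))               ∎))))
          where open ≡-Reasoning

        quotients : ∀ j → Card (λ z → Pure z × (+ p ℤ.* + p) ℤ.* nm z ≡ + index (suc j)) (r₃ (index j))
        quotients j = Card-cong
          (λ (r , e) → r , trans (cong ((+ p ℤ.* + p) ℤ.*_) e) (sym p²-index))
          (λ {z} (r , e) → r , ℤ.*-cancelˡ-≡ (+ p ℤ.* + p) (nm z) (+ index j) (trans e p²-index))
          (Card-pure (index j))
          where
          p²-index : + index (suc j) ≡ (+ p ℤ.* + p) ℤ.* + index j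
          p²-index = trans (cong +_ (sym (*-assoc p p (index j))))
              (trans (ℤ.pos-* (p * p) (index j)) (cong (ℤ._* + index j) (ℤ.pos-* p p)))

      -- Write a(j) for r₃ at `index j`. The recurrence says a(j+2) - p a(j+1) = a(j+1) - p a(j), so
      -- this difference keeps its first value, which is a(0) because by `none` the term r₃(N/p)
      -- contributes 0.
      r₃-index-suc : ∀ j → r₃ (index (suc j)) ≡ p * r₃ (index j) + r₃ (index 0)
      r₃-index-suc zero = trans (sym (trans (cong (λ t → r₃ (index 1) + t) (*-zeroʳ p)) (+-identityʳ (r₃ (index 1)))))
        (r₃-hecke N 0 (Card-∅ (λ {z} → none {z})))
      r₃-index-suc (suc j) = +-cancelʳ-≡ (p * r₃ (index j)) (r₃ (index (2 + j)))
          (p * r₃ (index (suc j)) + r₃ (index 0)) (begin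
        r₃ (index (2 + j)) + p * r₃ (index j) ≡⟨
            r₃-hecke (p * index j) (r₃ (index j)) (quotients j) ⟩
        p * r₃ (index (suc j)) + r₃ (index (suc j)) ≡⟨
            cong (λ t → p * r₃ (index (suc j)) + t) (trans (r₃-index-suc j) (+-comm (p * r₃ (index j)) (r₃ (index 0)))) ⟩
        p * r₃ (index (suc j)) + (r₃ (index 0) + p * r₃ (index j)) ≡⟨
            sym (+-assoc (p * r₃ (index (suc j))) (r₃ (index 0)) (p * r₃ (index j))) ⟩
        p * r₃ (index (suc j)) + r₃ (index 0) + p * r₃ (index j)                ∎)
        where open ≡-Reasoning

      r₃-index : ∀ j → r₃ (index j) ≡ geometric p j * r₃ (index 0)
      r₃-index zero = sym (+-identityʳ (r₃ (index 0)))
      r₃-index (suc j) = trans (r₃-index-suc j) (trans (cong (λ r → p * r + r₃ (index 0)) (r₃-index j))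
        (distribute p (geometric p j) (r₃ (index 0))))
        where
        distribute : ∀ p g r → p * (g * r) + r ≡ (p * g + 1) * r
        distribute = solve 3 (λ p g r → p :* (g :* r) :+ r := (p :* g :+ con 1) :* r) refl

      7∣r₃-powers : ∀ q α → 7 ∣ geometric (p % 7) q → 7 ∣ r₃ (p ^ (2 * (q + α * suc q) + 1) * N)
      7∣r₃-powers q α d = subst (λ n → 7 ∣ r₃ n) (index-^ (q + α * suc q))
        (subst (7 ∣_) (sym (r₃-index (q + α * suc q)))
            (∣m⇒∣m*n (r₃ (index 0)) (∣-geometric-periodic p q α (∣-geometric-mod p q d))))

-- A recurrence for overpartitions with bounded parts.

module BoundedOverpartitions where
  open import Data.Bool using (if_then_else_; true; false)
  open import Data.Empty using (⊥-elim)
  open import Data.Nat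
  open import Data.Nat.Properties
  open import Data.Unit using (tt)
  open import Relation.Nullary using (¬_; yes; no)
  open import Relation.Binary.PropositionalEquality

  ≤ᵇ-true : ∀ {m n} → m ≤ n → (m ≤ᵇ n) ≡ true
  ≤ᵇ-true {m} {n} le with m ≤ᵇ n | ≤⇒≤ᵇ le
  ... | true | _ = refl

  ≤ᵇ-false : ∀ {m n} → ¬ m ≤ n → (m ≤ᵇ n) ≡ false
  ≤ᵇ-false {m} {n} nle with m ≤ᵇ n | ≤ᵇ⇒≤ m n
  ... | false | _ = refl
  ... | true  | f = ⊥-elim (nle (f tt))

  multTerms-zero : ∀ n m fuel k → n < k * suc m → multTerms n m fuel k ≡ 0
  multTerms-zero n m zero k lt = refl
  multTerms-zero n m (suc fuel) k lt rewrite ≤ᵇ-false (<⇒≱ lt) =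
    multTerms-zero n m fuel (suc k) (<-≤-trans lt (m≤n+m (k * suc m) (suc m)))

  -- The extra summand belongs to multiplicity fuel + k > n, too many copies of any part to fit into
  -- n.
  multTerms-fuel : ∀ n m fuel k → n < fuel + k → multTerms n m (suc fuel) k ≡ multTerms n m fuel k
  multTerms-fuel n m zero k lt = multTerms-zero n m 1 k (<-≤-trans lt (m≤m*n k (suc m)))
  multTerms-fuel n m (suc fuel) k lt =
      cong (_ +_) (multTerms-fuel n m fuel (suc k) (subst (n <_) (sym (+-suc fuel k)) lt))

  multTerms-fuel-+ : ∀ d n m fuel k → n < fuel + k → multTerms n m (d + fuel) k ≡ multTerms n m fuel k
  multTerms-fuel-+ zero n m fuel k lt = refl
  multTerms-fuel-+ (suc d) n m fuel k lt = trans
    (multTerms-fuel n m (d + fuel) k (<-≤-trans lt (+-monoˡ-≤ k (m≤n+m fuel d))))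
    (multTerms-fuel-+ d n m fuel k lt)

  -- Removing one copy of the part m + 1 lowers every multiplicity by one. Multiplicity 0 can then
  -- occur, still with its factor 2.
  multTerms-shift : ∀ n m fuel k → multTerms (suc m + n) m fuel (suc k) ≡ multTerms n m fuel k
  multTerms-shift n m zero k = refl
  multTerms-shift n m (suc fuel) k = cong₂ _+_ (head (k * suc m)) (multTerms-shift n m fuel (suc k))
    where
    cancel-≤ᵇ : ∀ a b c → (a + b ≤ᵇ a + c) ≡ (b ≤ᵇ c)
    cancel-≤ᵇ a b c with b ≤? c
    ... | yes le = trans (≤ᵇ-true (+-monoʳ-≤ a le)) (sym (≤ᵇ-true le))
    ... | no nle = trans (≤ᵇ-false (λ le → nle (+-cancelˡ-≤ a b c le))) (sym (≤ᵇ-false nle))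
    head : ∀ t → (if suc m + t ≤ᵇ suc m + n then 2 * ovBounded (suc m + n ∸ (suc m + t)) m else 0)
               ≡ (if t ≤ᵇ n then 2 * ovBounded (n ∸ t) m else 0)
    head t = cong₂ (λ b x → if b then 2 * ovBounded x m else 0) (cancel-≤ᵇ (suc m) t n) ([m+n]∸[m+o]≡n∸o (suc m) n t)

  ovBounded-multTerms : ∀ n m → ovBounded n (suc m) ≡ ovBounded n m + multTerms n m n 1
  ovBounded-multTerms zero m = refl
  ovBounded-multTerms (suc n) m = refl

  ovBounded-< : ∀ {n m} → n < suc m → ovBounded n (suc m) ≡ ovBounded n m
  ovBounded-< {n} {m} lt = trans (ovBounded-multTerms n m)
    (trans (cong (ovBounded n m +_) (multTerms-zero n m n 1 (subst (n <_) (sym (+-identityʳ (suc m))) lt)))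
        (+-identityʳ _))

  -- The coefficient form of (1 − qᴹ) Oᴹ = (1 + qᴹ) Oᴹ⁻¹ for M = m + 1.
  ovBounded-+ : ∀ n m → ovBounded (suc m + n) (suc m) ≡ ovBounded (suc m + n) m + (ovBounded n m + ovBounded n (suc m))
  ovBounded-+ n m = cong (ovBounded (suc m + n) m +_) (begin
    multTerms (suc m + n) m (suc m + n) 1                          ≡⟨ multTerms-shift n m (suc m + n) 0 ⟩
    2 * ovBounded n m + multTerms n m (m + n) 1 ≡⟨
        cong (2 * ovBounded n m +_) (multTerms-fuel-+ m n m n 1 (m<m+n n (s≤s z≤n))) ⟩
    2 * ovBounded n m + multTerms n m n 1                          ≡⟨
        cong (λ t → ovBounded n m + t + multTerms n m n 1) (+-identityʳ (ovBounded n m)) ⟩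
    ovBounded n m + ovBounded n m + multTerms n m n 1              ≡⟨ +-assoc (ovBounded n m) (ovBounded n m) _ ⟩
    ovBounded n m + (ovBounded n m + multTerms n m n 1)            ≡⟨
        cong (ovBounded n m +_) (sym (ovBounded-multTerms n m)) ⟩
    ovBounded n m + ovBounded n (suc m)                            ∎)
    where open ≡-Reasoning

  ovBounded-stable : ∀ d n → ovBounded n (d + n) ≡ overpartitions n
  ovBounded-stable zero n = refl
  ovBounded-stable (suc d) n = trans (ovBounded-< (s≤s (m≤n+m n d))) (ovBounded-stable d n)

-- A ring solver with integer coefficients for any commutative ring.

module IntegerCoefficientSolver where
  open import Algebra.Bundles using (CommutativeRing)
  import Algebra.Solver.Ring as RingSolver
  import Algebra.Solver.Ring.AlmostCommutativeRing as ACR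
  import Algebra.Properties.Ring
  import Algebra.Properties.AbelianGroup
  import Algebra.Properties.Monoid.Mult.TCOptimised
  import Algebra.Properties.Semiring.Mult.TCOptimised
  open import Data.Integer using (ℤ; +_; -[1+_])
  open import Data.Maybe using (Maybe; just; nothing)
  open import Data.Nat using (ℕ; zero; suc)
  open import Relation.Nullary using (yes; no)
  open import Relation.Binary.PropositionalEquality using () renaming (refl to ≡-refl; cong to ≡-cong; sym to ≡-sym)
  import Data.Integer as ℤ
  import Data.Integer.Properties as ℤ
  import Data.Nat as ℕ
  import Data.Nat.Properties as ℕ

  -- Equality of integers is decidable while equality of power series is not, so normal forms take
  -- their coefficients from the integers and are mapped into the ring.
  module IntegerCoefficients {c ℓ} (R : CommutativeRing c ℓ) where
    open CommutativeRing R
    open Algebra.Properties.Ring ring using (-‿distribˡ-*; -‿distribʳ-*; -0#≈0#; -‿involutive)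
    open Algebra.Properties.AbelianGroup +-abelianGroup using (⁻¹-∙-comm)
    open Algebra.Properties.Monoid.Mult.TCOptimised +-monoid using (_×_; ×-homo-+; 1+×)
    open Algebra.Properties.Semiring.Mult.TCOptimised semiring using (×1-homo-*)
    open import Relation.Binary.Reasoning.Setoid setoid

    fromℤ : ℤ → Carrier
    fromℤ (+ n)    = n × 1#
    fromℤ -[1+ n ] = - (suc n × 1#)

    private
      fromℤ-neg : ∀ i → fromℤ (ℤ.- i) ≈ - fromℤ i
      fromℤ-neg (+ zero)    = sym -0#≈0#
      fromℤ-neg (+ suc n)   = refl
      fromℤ-neg -[1+ n ]    = sym (-‿involutive _)

      cancel : ∀ x y → x - y ≈ (1# + x) - (1# + y)
      cancel x y = begin
        x - y                          ≈⟨ +-congʳ (sym (+-identityˡ x)) ⟩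
        (0# + x) - y                   ≈⟨ +-congʳ (+-congʳ (sym (-‿inverseʳ 1#))) ⟩
        ((1# - 1#) + x) - y            ≈⟨
            +-congʳ (trans (+-assoc _ _ _) (trans (+-congˡ (+-comm _ _)) (sym (+-assoc _ _ _)))) ⟩
        ((1# + x) - 1#) - y            ≈⟨ +-assoc _ _ _ ⟩
        (1# + x) + (- 1# - y)          ≈⟨ +-congˡ (⁻¹-∙-comm 1# y) ⟩
        (1# + x) - (1# + y)            ∎

      fromℤ-⊖ : ∀ m n → fromℤ (m ℤ.⊖ n) ≈ m × 1# - n × 1#
      fromℤ-⊖ m zero = sym (trans (+-congˡ -0#≈0#) (+-identityʳ _))
      fromℤ-⊖ zero (suc n) = sym (+-identityˡ _)
      fromℤ-⊖ (suc m) (suc n) = begin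
        fromℤ (suc m ℤ.⊖ suc n)            ≡⟨ ≡-cong fromℤ (ℤ.[1+m]⊖[1+n]≡m⊖n m n) ⟩
        fromℤ (m ℤ.⊖ n)                    ≈⟨ fromℤ-⊖ m n ⟩
        m × 1# - n × 1#                    ≈⟨ cancel _ _ ⟩
        (1# + m × 1#) - (1# + n × 1#)      ≈⟨ +-cong (sym (1+× m 1#)) (-‿cong (sym (1+× n 1#))) ⟩
        suc m × 1# - suc n × 1#            ∎

      fromℤ-+ : ∀ i j → fromℤ (i ℤ.+ j) ≈ fromℤ i + fromℤ j
      fromℤ-+ (+ m) (+ n) = ×-homo-+ 1# m n
      fromℤ-+ (+ m) -[1+ n ] = fromℤ-⊖ m (suc n)
      fromℤ-+ -[1+ m ] (+ n) = trans (fromℤ-⊖ n (suc m)) (+-comm _ _)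
      fromℤ-+ -[1+ m ] -[1+ n ] = begin
        - (suc (suc (m ℕ.+ n)) × 1#)          ≡⟨ ≡-cong (λ k → - (k × 1#)) (≡-sym (ℕ.+-suc (suc m) n)) ⟩
        - ((suc m ℕ.+ suc n) × 1#)            ≈⟨ -‿cong (×-homo-+ 1# (suc m) (suc n)) ⟩
        - (suc m × 1# + suc n × 1#)           ≈⟨ sym (⁻¹-∙-comm _ _) ⟩
        - (suc m × 1#) - suc n × 1#           ∎

      fromℤ-*⁺ : ∀ m n → fromℤ (+ m ℤ.* + n) ≈ (m × 1#) * (n × 1#)
      fromℤ-*⁺ m n = begin
        fromℤ (+ m ℤ.* + n)          ≡⟨ ≡-cong fromℤ (≡-sym (ℤ.pos-* m n)) ⟩
        (m ℕ.* n) × 1#               ≈⟨ ×1-homo-* m n ⟩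
        (m × 1#) * (n × 1#)          ∎
      fromℤ-*ˡ : ∀ m j → fromℤ (+ m ℤ.* j) ≈ (m × 1#) * fromℤ j
      fromℤ-*ˡ m (+ n) = fromℤ-*⁺ m n
      fromℤ-*ˡ m -[1+ n ] = begin
        fromℤ (+ m ℤ.* -[1+ n ])     ≡⟨ ≡-cong fromℤ (≡-sym (ℤ.neg-distribʳ-* (+ m) (+ suc n))) ⟩
        fromℤ (ℤ.- (+ m ℤ.* + suc n)) ≈⟨ fromℤ-neg (+ m ℤ.* + suc n) ⟩
        - fromℤ (+ m ℤ.* + suc n)    ≈⟨ -‿cong (fromℤ-*⁺ m (suc n)) ⟩
        - (m × 1# * (suc n × 1#))    ≈⟨ -‿distribʳ-* _ _ ⟩
        m × 1# * - (suc n × 1#)      ∎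
      fromℤ-* : ∀ i j → fromℤ (i ℤ.* j) ≈ fromℤ i * fromℤ j
      fromℤ-* (+ m) j = fromℤ-*ˡ m j
      fromℤ-* -[1+ m ] j = begin
        fromℤ (-[1+ m ] ℤ.* j)       ≡⟨ ≡-cong fromℤ (≡-sym (ℤ.neg-distribˡ-* (+ suc m) j)) ⟩
        fromℤ (ℤ.- (+ suc m ℤ.* j))  ≈⟨ fromℤ-neg (+ suc m ℤ.* j) ⟩
        - fromℤ (+ suc m ℤ.* j)      ≈⟨ -‿cong (fromℤ-*ˡ (suc m) j) ⟩
        - (suc m × 1# * fromℤ j)     ≈⟨ -‿distribˡ-* _ _ ⟩
        - (suc m × 1#) * fromℤ j     ∎

      morphism : ℤ.+-*-rawRing ACR.-Raw-AlmostCommutative⟶ ACR.fromCommutativeRing R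
      morphism = record
        { ⟦_⟧ = fromℤ ; +-homo = fromℤ-+ ; *-homo = fromℤ-* ; -‿homo = fromℤ-neg
        ; 0-homo = refl ; 1-homo = refl }

      _≟_ : ∀ i j → Maybe (fromℤ i ≈ fromℤ j)
      i ≟ j with i ℤ.≟ j
      ... | yes ≡-refl = just refl
      ... | no _ = nothing

    module Solver = RingSolver ℤ.+-*-rawRing (ACR.fromCommutativeRing R) morphism _≟_

-- Formal power series over a commutative ring.

module FormalPowerSeries where
  open import Algebra.Bundles using (CommutativeRing)
  import Algebra.Properties.CommutativeSemigroup
  open import Data.Nat using (ℕ; zero; suc; _<_; _≤_; s≤s; z≤n)
  open import Data.Product using (_,_)
  open import Function using (_∘_)
  open import Level using (0ℓ)
  import Data.Nat as ℕ
  import Data.Nat.Properties as ℕ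

  module PowerSeries (R : CommutativeRing 0ℓ 0ℓ) where
    open CommutativeRing R
    open Algebra.Properties.CommutativeSemigroup (CommutativeRing.+-commutativeSemigroup R) using (interchange; x∙yz≈y∙xz)
    open import Relation.Binary.Reasoning.Setoid setoid

    Series : Set
    Series = ℕ → Carrier

    infix 4 _≈ˢ_
    _≈ˢ_ : Series → Series → Set
    f ≈ˢ g = ∀ n → f n ≈ g n

    tail : Series → Series
    tail f = f ∘ suc

    infixl 6 _+ˢ_
    infixl 7 _*ˢ_ _·_
    -- The product follows the same recursion as `conv`, so counting convolutions turn into products
    -- of series by a plain induction.
    _+ˢ_ _*ˢ_ : Series → Series → Series
    (f +ˢ g) n = f n + g n
    (f *ˢ g) zero    = f 0 * g 0
    (f *ˢ g) (suc n) = f 0 * g (suc n) + (tail f *ˢ g) n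

    _·_ : Carrier → Series → Series
    (c · f) n = c * f n

    -ˢ_ : Series → Series
    (-ˢ f) n = - f n

    0ˢ 1ˢ : Series
    0ˢ _ = 0#
    1ˢ zero    = 1#
    1ˢ (suc _) = 0#

    *ˢ-cong : ∀ {f f′ g g′} → f ≈ˢ f′ → g ≈ˢ g′ → f *ˢ g ≈ˢ f′ *ˢ g′
    *ˢ-cong p q zero    = *-cong (p 0) (q 0)
    *ˢ-cong p q (suc n) = +-cong (*-cong (p 0) (q (suc n))) (*ˢ-cong (p ∘ suc) q n)

    -- Coefficient n of a product sees the factors only up to n; this is how identities for
    -- truncations pass to the full series.
    *ˢ-cong-≤ : ∀ n {f f′ g g′} → (∀ i → i ≤ n → f i ≈ f′ i) → (∀ i → i ≤ n → g i ≈ g′ i) → (f *ˢ g) n ≈ (f′ *ˢ g′) n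
    *ˢ-cong-≤ zero    p q = *-cong (p 0 z≤n) (q 0 z≤n)
    *ˢ-cong-≤ (suc n) p q = +-cong (*-cong (p 0 z≤n) (q (suc n) ℕ.≤-refl))
      (*ˢ-cong-≤ n (λ i le → p (suc i) (s≤s le)) (λ i le → q i (ℕ.m≤n⇒m≤1+n le)))

    *ˢ-zeroˡ : ∀ g → 0ˢ *ˢ g ≈ˢ 0ˢ
    *ˢ-zeroˡ g zero    = zeroˡ (g 0)
    *ˢ-zeroˡ g (suc n) = trans (+-cong (zeroˡ _) (*ˢ-zeroˡ g n)) (+-identityˡ 0#)

    *ˢ-identityˡ : ∀ g → 1ˢ *ˢ g ≈ˢ g
    *ˢ-identityˡ g zero    = *-identityˡ (g 0)
    *ˢ-identityˡ g (suc n) = trans (+-cong (*-identityˡ _) (*ˢ-zeroˡ g n)) (+-identityʳ _)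

    *ˢ-distribʳ : ∀ h f g → (f +ˢ g) *ˢ h ≈ˢ f *ˢ h +ˢ g *ˢ h
    *ˢ-distribʳ h f g zero    = distribʳ (h 0) (f 0) (g 0)
    *ˢ-distribʳ h f g (suc n) = trans (+-cong (distribʳ _ _ _) (*ˢ-distribʳ h (tail f) (tail g) n)) (interchange _ _ _ _)

    ·-*ˢ : ∀ c f g → (c · f) *ˢ g ≈ˢ c · (f *ˢ g)
    ·-*ˢ c f g zero    = *-assoc c (f 0) (g 0)
    ·-*ˢ c f g (suc n) = trans (+-cong (*-assoc c (f 0) _) (·-*ˢ c (tail f) g n)) (sym (distribˡ c _ _))

    *ˢ-suc : ∀ f g n → (f *ˢ g) (suc n) ≈ f (suc n) * g 0 + (f *ˢ tail g) n
    *ˢ-suc f g zero    = +-comm _ _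
    *ˢ-suc f g (suc n) = trans (+-congˡ (*ˢ-suc (tail f) g n)) (x∙yz≈y∙xz _ _ _)

    *ˢ-comm : ∀ f g → f *ˢ g ≈ˢ g *ˢ f
    *ˢ-comm f g zero    = *-comm (f 0) (g 0)
    *ˢ-comm f g (suc n) = trans (+-cong (*-comm _ _) (*ˢ-comm (tail f) g n)) (sym (*ˢ-suc g f n))

    *ˢ-assoc : ∀ f g h → (f *ˢ g) *ˢ h ≈ˢ f *ˢ (g *ˢ h)
    *ˢ-assoc f g h zero    = *-assoc (f 0) (g 0) (h 0)
    *ˢ-assoc f g h (suc n) = begin
      f 0 * g 0 * h (suc n) + ((f 0 · tail g +ˢ tail f *ˢ g) *ˢ h) n
        ≈⟨ +-cong (*-assoc _ _ _) (*ˢ-distribʳ h (f 0 · tail g) (tail f *ˢ g) n) ⟩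
      f 0 * (g 0 * h (suc n)) + (((f 0 · tail g) *ˢ h) n + ((tail f *ˢ g) *ˢ h) n)
        ≈⟨ +-congˡ (+-cong (·-*ˢ (f 0) (tail g) h n) (*ˢ-assoc (tail f) g h n)) ⟩
      f 0 * (g 0 * h (suc n)) + (f 0 * (tail g *ˢ h) n + (tail f *ˢ (g *ˢ h)) n)
        ≈⟨ trans (sym (+-assoc _ _ _)) (+-congʳ (sym (distribˡ _ _ _))) ⟩
      f 0 * (g *ˢ h) (suc n) + (tail f *ˢ (g *ˢ h)) n ∎

    commutativeRing : CommutativeRing 0ℓ 0ℓ
    commutativeRing = record
      { Carrier = Series ; _≈_ = _≈ˢ_ ; _+_ = _+ˢ_ ; _*_ = _*ˢ_ ; -_ = -ˢ_ ; 0# = 0ˢ ; 1# = 1ˢ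
      ; isCommutativeRing = record
        { isRing = record
          { +-isAbelianGroup = record
            { isGroup = record
              { isMonoid = record
                { isSemigroup = record
                  { isMagma = record
                    { isEquivalence = record { refl = λ _ → refl ; sym = λ p n →
                        sym (p n) ; trans = λ p q n → trans (p n) (q n) }
                    ; ∙-cong = λ p q n → +-cong (p n) (q n) }
                  ; assoc = λ f g h n → +-assoc _ _ _ }
                ; identity = (λ f n → +-identityˡ _) , (λ f n → +-identityʳ _) }
              ; inverse = (λ f n → -‿inverseˡ _) , (λ f n → -‿inverseʳ _)
              ; ⁻¹-cong = λ p n → -‿cong (p n) }
            ; comm = λ f g n → +-comm _ _ }
          ; *-cong = *ˢ-cong
          ; *-assoc = *ˢ-assoc
          ; *-identity = *ˢ-identityˡ , (λ f n → trans (*ˢ-comm f 1ˢ n) (*ˢ-identityˡ f n))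
          ; distrib = (λ f g h n → trans (*ˢ-comm f (g +ˢ h) n)
              (trans (*ˢ-distribʳ f g h n) (+-cong (*ˢ-comm g f n) (*ˢ-comm h f n))))
                    , *ˢ-distribʳ }
        ; *-comm = *ˢ-comm } }

    shift : Series → Series
    shift f zero    = 0#
    shift f (suc n) = f n

    shift-*ˢ : ∀ f g → shift f *ˢ g ≈ˢ shift (f *ˢ g)
    shift-*ˢ f g zero    = zeroˡ (g 0)
    shift-*ˢ f g (suc n) = trans (+-congʳ (zeroˡ _)) (+-identityˡ _)

    shift-cong : ∀ {f g} → f ≈ˢ g → shift f ≈ˢ shift g
    shift-cong p zero    = refl
    shift-cong p (suc n) = p n

    X^_ : ℕ → Series
    X^ zero  = 1ˢ
    X^ suc m = shift (X^ m)

    X^-+ : ∀ m n → X^ (m ℕ.+ n) ≈ˢ X^ m *ˢ X^ n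
    X^-+ zero    n i = sym (*ˢ-identityˡ (X^ n) i)
    X^-+ (suc m) n i = trans (shift-cong (X^-+ m n) i) (sym (shift-*ˢ (X^ m) (X^ n) i))

    X^-coeff-+ : ∀ m f n → (X^ m *ˢ f) (m ℕ.+ n) ≈ f n
    X^-coeff-+ zero    f n = *ˢ-identityˡ f n
    X^-coeff-+ (suc m) f n = trans (shift-*ˢ (X^ m) f (suc (m ℕ.+ n))) (X^-coeff-+ m f n)

    X^-coeff-< : ∀ {m n} f → n < m → (X^ m *ˢ f) n ≈ 0#
    X^-coeff-< {suc m} {zero}  f _        = shift-*ˢ (X^ m) f 0
    X^-coeff-< {suc m} {suc n} f (s≤s lt) = trans (shift-*ˢ (X^ m) f (suc n)) (X^-coeff-< f lt)

    private
      vanishes-below : ∀ m {f} → f ≈ˢ X^ suc m *ˢ f → ∀ n i → i < n → f i ≈ 0#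
      vanishes-below m {f} p (suc n) zero    _        = trans (p 0) (shift-*ˢ (X^ m) f 0)
      vanishes-below m {f} p (suc n) (suc i) (s≤s lt) = begin
        f (suc i)                 ≈⟨ p (suc i) ⟩
        (X^ suc m *ˢ f) (suc i)   ≈⟨ shift-*ˢ (X^ m) f (suc i) ⟩
        (X^ m *ˢ f) i             ≈⟨ *ˢ-comm (X^ m) f i ⟩
        (f *ˢ X^ m) i             ≈⟨ *ˢ-cong-≤ i (λ j le → vanishes-below m p n j (ℕ.≤-<-trans le lt)) (λ _ _ → refl) ⟩
        (0ˢ *ˢ X^ m) i            ≈⟨ *ˢ-zeroˡ (X^ m) i ⟩
        0#                        ∎

    -- Each coefficient is expressed by strictly earlier ones, and the first is zero. This provides
    -- the cancellation of the factor 1 - q^(m+1).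
    fixed-by-X^⇒0 : ∀ m {f} → f ≈ˢ X^ suc m *ˢ f → f ≈ˢ 0ˢ
    fixed-by-X^⇒0 m p n = vanishes-below m p (suc n) n ℕ.≤-refl

    sgn : ℕ → Carrier
    sgn zero    = 1#
    sgn (suc n) = - sgn n

    twist : Series → Series
    twist f n = sgn n * f n

-- A finite form of Gauss' identity.

module GaussIdentity where
  open IntegerCoefficientSolver
  open FormalPowerSeries
  open import Algebra.Bundles using (CommutativeRing)
  open import Data.Integer using (1ℤ; +_)
  open import Data.Nat using (ℕ; zero; suc)
  open import Level using (0ℓ)
  open import Relation.Binary.PropositionalEquality using (_≡_)
  import Relation.Binary.PropositionalEquality as ≡
  import Data.Nat as ℕ
  import Data.Nat.Properties as ℕ

  module Gauss (R : CommutativeRing 0ℓ 0ℓ) where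
    open PowerSeries R
    private
      module K = CommutativeRing commutativeRing
      module KS = IntegerCoefficients.Solver commutativeRing
    open K using (_+_; _*_; _-_; -_; 1#; 0#; _≈_)
    open KS using (_:+_; _:*_; _:-_; :-_; _:=_; con)
    open import Relation.Binary.Reasoning.Setoid K.setoid

    -- Lets the ring solver work modulo known relations: the goal is stated with explicit multiples
    -- of each `l - r` added, which the solver checks as a plain identity, and these multiples are
    -- then removed one by one.
    drop-relation : ∀ {l r} y c → l ≈ r → y + c * (l - r) ≈ y
    drop-relation {l} {r} y c e =
        K.trans (K.+-congˡ {y}
        (K.trans (K.*-congˡ {c} (K.trans (K.+-congʳ {x = - r} e) (K.-‿inverseʳ r))) (K.zeroʳ c))) (K.+-identityʳ y)

    signˢ : ℕ → Series
    signˢ zero    = 1#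
    signˢ (suc k) = - signˢ k

    theta : ℕ → Series
    theta zero    = 1#
    theta (suc n) = theta n + (1# + 1#) * (signˢ (suc n) * X^ (suc n ℕ.* suc n))

    -- `O m` is the product of (1 + q^k)/(1 - q^k) over k ≤ m, described by a recurrence free of
    -- division.
    module _ (O : ℕ → Series) (O-zero : O 0 ≈ 1#)
      (O-suc : ∀ m → O (suc m) ≈ O m + (X^ suc m * O m + X^ suc m * O (suc m))) where

      -- (1 − qⁿ) alternating n − (1 + qⁿ) alternating (n − 1) telescopes, which shows that
      -- alternating n n satisfies the same recurrence as O n * theta n.
      alternating : ℕ → ℕ → Series
      alternating n zero    = 1#
      alternating n (suc k) = alternating n k + signˢ (suc k) * (X^ (suc k ℕ.* n) * (O (suc k) - O k))

      X^-cong : ∀ {m n} → m ≡ n → X^ m ≈ X^ n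
      X^-cong ≡.refl = K.refl

      -- Only a boundary term survives: by the recurrence for `O`, adding the next summand to both
      -- sums moves the boundary term from k to k + 1.
      telescope : ∀ m k → let c = X^ suc m in
        (1# - c) * alternating (suc m) k - (1# + c) * alternating m k ≈ -
            ((1# + 1#) * (signˢ k * (X^ (suc k ℕ.* suc m) * O k)))
      telescope m zero = begin
        (1# - c) * 1# - (1# + c) * 1# ≈⟨
            KS.solve 1 (λ c → (con 1ℤ :- c) :* con 1ℤ :- (con 1ℤ :+ c) :* con 1ℤ :=
            :- ((con 1ℤ :+ con 1ℤ) :* (con 1ℤ :* (c :* con 1ℤ)))) K.refl c ⟩
        - ((1# + 1#) * (1# * (c * 1#)))          ≈⟨
            K.-‿cong (K.*-congˡ {1# + 1#}
            (K.*-congˡ {1#} (K.*-cong (X^-cong {suc m} (≡.sym (ℕ.+-identityʳ (suc m)))) (K.sym O-zero)))) ⟩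
        - ((1# + 1#) * (1# * (X^ (1 ℕ.* suc m) * O 0))) ∎
        where c = X^ suc m
      telescope m (suc k) = begin
        (1# - c) * (t + - e * (X^ (suc k ℕ.* suc m) * (o′ - o))) - (1# + c) * (t′ + - e * (u * (o′ - o)))
          ≈⟨ K.+-congʳ {x = - ((1# + c) * (t′ + - e * (u * (o′ - o))))}
              (K.*-congˡ {1# - c} (K.+-congˡ {t} (K.*-congˡ { - e} (K.*-congʳ {o′ - o} uv)))) ⟩
        (1# - c) * (t + - e * ((u * v) * (o′ - o))) - (1# + c) * (t′ + - e * (u * (o′ - o)))
          ≈⟨ KS.solve 8 (λ c t t′ e u v o o′ →
               (con 1ℤ :- c) :* (t :+ (:- e) :* ((u :* v) :* (o′ :- o))) :- (con 1ℤ :+ c) :*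
                   (t′ :+ (:- e) :* (u :* (o′ :- o))) :=
               (:- ((con 1ℤ :+ con 1ℤ) :* ((:- e) :* ((c :* (u :* v)) :* o′)))
                 :+ con 1ℤ :* (((con 1ℤ :- c) :* t :- (con 1ℤ :+ c) :* t′) :-
                     (:- ((con 1ℤ :+ con 1ℤ) :* (e :* ((u :* v) :* o))))))
                 :+ (e :* u :* (con 1ℤ :+ c)) :* (o′ :- (o :+ (v :* o :+ v :* o′)))) K.refl c t t′ e u v o o′ ⟩
        (goal + 1# * (((1# - c) * t - (1# + c) * t′) - (- ((1# + 1#) * (e * ((u * v) * o)))))) +
            (e * u * (1# + c)) * (o′ - (o + (v * o + v * o′)))
          ≈⟨ drop-relation _ (e * u * (1# + c)) (O-suc k) ⟩
        goal + 1# * (((1# - c) * t - (1# + c) * t′) - (- ((1# + 1#) * (e * ((u * v) * o)))))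
          ≈⟨ drop-relation goal 1#
              (K.trans (telescope m k) (K.-‿cong (K.*-congˡ {1# + 1#} (K.*-congˡ {e} (K.*-congʳ {o} uv))))) ⟩
        goal
          ≈⟨ K.-‿cong (K.*-congˡ {1# + 1#}
              (K.*-congˡ { - e} (K.*-congʳ {o′}
              (K.trans (K.*-congˡ {c} (K.sym uv)) (K.sym (X^-+ (suc m) (suc k ℕ.* suc m))))))) ⟩
        - ((1# + 1#) * (- e * (X^ (suc (suc k) ℕ.* suc m) * o′))) ∎
        where
        c = X^ suc m
        t = alternating (suc m) k
        t′ = alternating m k
        e = signˢ k
        u = X^ (suc k ℕ.* m)
        v = X^ suc k
        o = O k
        o′ = O (suc k)
        goal = - ((1# + 1#) * (- e * ((c * (u * v)) * o′)))
        uv : X^ (suc k ℕ.* suc m) ≈ u * v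
        uv = K.trans (X^-cong (≡.trans (ℕ.*-suc (suc k) m) (ℕ.+-comm (suc k) (suc k ℕ.* m)))) (X^-+ (suc k ℕ.* m) (suc k))

      cancel-1-X^ : ∀ m {f g} → (1# - X^ suc m) * f ≈ (1# - X^ suc m) * g → f ≈ g
      cancel-1-X^ m {f} {g} e = begin
        f                  ≈⟨ KS.solve 2 (λ f g → f := g :+ (f :- g)) K.refl f g ⟩
        g + (f - g)        ≈⟨ K.+-congˡ {g} (fixed-by-X^⇒0 m fixed) ⟩
        g + 0#             ≈⟨ K.+-identityʳ g ⟩
        g                  ∎
        where
        c = X^ suc m
        fixed : f - g ≈ c * (f - g)
        fixed = K.trans (KS.solve 3
            (λ c f g → f :- g := c :* (f :- g) :+ con 1ℤ :* ((con 1ℤ :- c) :* f :- (con 1ℤ :- c) :* g)) K.refl c f g)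
          (drop-relation (c * (f - g)) 1# e)

      -- In the notation of the step, `telescope` at k = m + 1 gives (1 - c) B = (1 + c)(o a + e w
      -- (o′ - o)) - 2 e c² w o′. As (1 + c) o = (1 - c) o′, this equals (1 - c) o′ (a + 2 e c w),
      -- and c w = q^((m+1)²) supplies the next theta term.
      alternating≈product : ∀ n → alternating n n ≈ O n * theta n
      alternating≈product zero = K.sym (K.trans (K.*-congʳ {1#} O-zero) (K.*-identityˡ 1#))
      alternating≈product (suc m) = cancel-1-X^ m (begin
        (1# - c) * B
          ≈⟨ KS.solve 8 (λ c B B′ e w o o′ a → (con 1ℤ :- c) :* B :=
               (((((con 1ℤ :- c) :* (o′ :* (a :+ (con 1ℤ :+ con 1ℤ) :* (e :* (c :* w))))
               :+ con 1ℤ :* (((con 1ℤ :- c) :* B :- (con 1ℤ :+ c) :* (B′ :+ e :* (w :* (o′ :- o)))) :- :-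
                   ((con 1ℤ :+ con 1ℤ) :* (e :* ((c :* (c :* w)) :* o′)))))
               :+ (con 1ℤ :+ c) :* (B′ :- o :* a)))
               :+ (e :* w :- a) :* (o′ :- (o :+ (c :* o :+ c :* o′))))) K.refl c B B′ e w o o′ a ⟩
        ((target + 1# * (((1# - c) * B - (1# + c) * (B′ + e * (w * (o′ - o)))) - -
            ((1# + 1#) * (e * ((c * (c * w)) * o′))))) + (1# + c) * (B′ - o * a))
           + (e * w - a) * (o′ - (o + (c * o + c * o′)))
          ≈⟨ drop-relation _ (e * w - a) (O-suc m) ⟩
        (target + 1# * (((1# - c) * B - (1# + c) * (B′ + e * (w * (o′ - o)))) - -
            ((1# + 1#) * (e * ((c * (c * w)) * o′))))) + (1# + c) * (B′ - o * a)
          ≈⟨ drop-relation _ (1# + c) (alternating≈product m) ⟩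
        target + 1# * (((1# - c) * B - (1# + c) * (B′ + e * (w * (o′ - o)))) - - ((1# + 1#) * (e * ((c * (c * w)) * o′))))
          ≈⟨ drop-relation target 1#
              (K.trans (telescope m (suc m)) (K.-‿cong (K.*-congˡ {1# + 1#} (K.*-congˡ {e} (K.*-congʳ {o′} ccw))))) ⟩
        target
          ≈⟨ K.*-congˡ {1# - c} (K.*-congˡ {o′} (K.+-congˡ {a} (K.*-congˡ {1# + 1#} (K.*-congˡ {e} (K.sym cw))))) ⟩
        (1# - c) * (o′ * theta (suc m)) ∎)
        where
        c = X^ suc m
        B = alternating (suc m) (suc m)
        B′ = alternating m m
        e = signˢ (suc m)
        w = X^ (suc m ℕ.* m)
        o = O m
        o′ = O (suc m)
        a = theta m
        target = (1# - c) * (o′ * (a + (1# + 1#) * (e * (c * w))))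
        cw : X^ (suc m ℕ.* suc m) ≈ c * w
        cw = K.trans (X^-cong (ℕ.*-suc (suc m) m)) (X^-+ (suc m) (suc m ℕ.* m))
        ccw : X^ (suc (suc m) ℕ.* suc m) ≈ c * (c * w)
        ccw = K.trans (X^-+ (suc m) (suc m ℕ.* suc m)) (K.*-congˡ {c} cw)

-- The ring of integers modulo 7 and the signs of the theta series.

module ResiduesModulo7 where
  open IntegerCoefficientSolver
  open FormalPowerSeries
  open GaussIdentity
  open ThetaCoefficients using (squaresUpTo)
  open import Algebra.Bundles using (CommutativeRing)
  open import Data.Bool using (true; false; if_then_else_)
  open import Data.Empty using (⊥-elim)
  open import Data.Integer using (ℤ; +_; 0ℤ; 1ℤ)
  open import Data.Integer.Divisibility.Signed using (divides; ∣m∣n⇒∣m+n; ∣m⇒∣-m; ∣n⇒∣m*n) renaming (_∣_ to _∣ℤ_)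
  open import Data.Nat using (ℕ; zero; suc)
  open import Data.Product using (_,_)
  open import Function using (_∘_)
  open import Level using (0ℓ)
  open import Relation.Binary.PropositionalEquality using (_≡_; _≢_)
  import Relation.Binary.PropositionalEquality as ≡
  import Data.Integer as ℤ
  import Data.Integer.Properties as ℤ
  import Data.Integer.Solver as ℤ-Solver
  import Data.Nat as ℕ
  import Data.Nat.Properties as ℕ

  module Modular (m : ℤ) where
    infix 4 _≈_
    -- A record, so that `a` and `b` can be inferred from a congruence; they are not recoverable
    -- from the difference.
    record _≈_ (a b : ℤ) : Set where
      constructor congruent
      field difference : m ∣ℤ a ℤ.- b

    open ℤ-Solver.+-*-Solver

    reflexive : ∀ {a b} → a ≡ b → a ≈ b
    reflexive {a} ≡.refl = congruent (divides 0ℤ (ℤ.i≡j⇒i-j≡0 {a} ≡.refl))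

    ring : CommutativeRing 0ℓ 0ℓ
    ring = record
      { Carrier = ℤ ; _≈_ = _≈_ ; _+_ = ℤ._+_ ; _*_ = ℤ._*_ ; -_ = ℤ.-_ ; 0# = 0ℤ ; 1# = 1ℤ
      ; isCommutativeRing = record
        { isRing = record
          { +-isAbelianGroup = record
            { isGroup = record
              { isMonoid = record
                { isSemigroup = record
                  { isMagma = record
                    { isEquivalence = record { refl = reflexive ≡.refl ; sym = symm ; trans = transi }
                    ; ∙-cong = +-cong }
                  ; assoc = λ a b c → reflexive (ℤ.+-assoc a b c) }
                ; identity = (λ a → reflexive (ℤ.+-identityˡ a)) , (λ a → reflexive (ℤ.+-identityʳ a)) }
              ; inverse = (λ a → reflexive (ℤ.+-inverseˡ a)) , (λ a → reflexive (ℤ.+-inverseʳ a))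
              ; ⁻¹-cong = neg-cong }
            ; comm = λ a b → reflexive (ℤ.+-comm a b) }
          ; *-cong = *-cong
          ; *-assoc = λ a b c → reflexive (ℤ.*-assoc a b c)
          ; *-identity = (λ a → reflexive (ℤ.*-identityˡ a)) , (λ a → reflexive (ℤ.*-identityʳ a))
          ; distrib = (λ a b c → reflexive (ℤ.*-distribˡ-+ a b c)) , (λ a b c → reflexive (ℤ.*-distribʳ-+ a b c)) }
        ; *-comm = λ a b → reflexive (ℤ.*-comm a b) } }
      where
      symm : ∀ {a b} → a ≈ b → b ≈ a
      symm {a} {b} (congruent d) =
          congruent (≡.subst (m ∣ℤ_) (solve 2 (λ a b → :- (a :- b) := b :- a) ≡.refl a b) (∣m⇒∣-m d))
      transi : ∀ {a b c} → a ≈ b → b ≈ c → a ≈ c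
      transi {a} {b} {c} (congruent d) (congruent e) = congruent (≡.subst (m ∣ℤ_)
        (solve 3 (λ a b c → (a :- b) :+ (b :- c) := a :- c) ≡.refl a b c) (∣m∣n⇒∣m+n d e))
      +-cong : ∀ {a b c d} → a ≈ b → c ≈ d → a ℤ.+ c ≈ b ℤ.+ d
      +-cong {a} {b} {c} {d} (congruent p) (congruent q) = congruent (≡.subst (m ∣ℤ_)
        (solve 4 (λ a b c d → (a :- b) :+ (c :- d) := (a :+ c) :- (b :+ d)) ≡.refl a b c d) (∣m∣n⇒∣m+n p q))
      neg-cong : ∀ {a b} → a ≈ b → ℤ.- a ≈ ℤ.- b
      neg-cong {a} {b} (congruent d) = congruent (≡.subst (m ∣ℤ_)
        (solve 2 (λ a b → :- (a :- b) := (:- a) :- (:- b)) ≡.refl a b) (∣m⇒∣-m d))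
      *-cong : ∀ {a b c d} → a ≈ b → c ≈ d → a ℤ.* c ≈ b ℤ.* d
      *-cong {a} {b} {c} {d} (congruent p) (congruent q) = congruent (≡.subst (m ∣ℤ_)
        (solve 4 (λ a b c d → c :* (a :- b) :+ b :* (c :- d) := a :* c :- b :* d) ≡.refl a b c d)
        (∣m∣n⇒∣m+n (∣n⇒∣m*n c p) (∣n⇒∣m*n b q)))

  open Modular (+ 7) using (_≈_; congruent; reflexive) renaming (ring to ℤ/7)
  open PowerSeries ℤ/7
  open Gauss ℤ/7
  private
    module R = CommutativeRing ℤ/7
    module K = CommutativeRing commutativeRing
    module RS = IntegerCoefficients.Solver ℤ/7
    module KS = IntegerCoefficients.Solver commutativeRing

  open import Relation.Binary.Reasoning.Setoid R.setoid

  sgn-+ : ∀ m n → sgn (m ℕ.+ n) ≡ sgn m ℤ.* sgn n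
  sgn-+ zero n = ≡.sym (ℤ.*-identityˡ (sgn n))
  sgn-+ (suc m) n = ≡.trans (≡.cong ℤ.-_ (sgn-+ m n)) (ℤ.neg-distribˡ-* (sgn m) (sgn n))

  sgn-*-self : ∀ n → sgn n ℤ.* sgn n ≡ 1ℤ
  sgn-*-self zero = ≡.refl
  sgn-*-self (suc n) = ≡.trans (solve 1 (λ s → (:- s) :* (:- s) := s :* s) ≡.refl (sgn n)) (sgn-*-self n)
    where open ℤ-Solver.+-*-Solver

  -- n² and n have the same parity, so the sign of a theta term can be read from its exponent, and
  -- φ(-q) becomes a twist of the unsigned series.
  sgn-square : ∀ n → sgn (n ℕ.* n) ≡ sgn n
  sgn-square zero = ≡.refl
  sgn-square (suc n) = ≡.cong ℤ.-_ (≡.trans (sgn-+ n (n ℕ.* suc n)) (≡.trans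
    (≡.cong (sgn n ℤ.*_) (≡.trans (≡.cong sgn (ℕ.*-suc n n))
        (≡.trans (sgn-+ n (n ℕ.* n)) (≡.trans (≡.cong (sgn n ℤ.*_) (sgn-square n)) (sgn-*-self n)))))
    (ℤ.*-identityʳ (sgn n))))

  sgn-7* : ∀ n → sgn (7 ℕ.* n) ≡ sgn n
  sgn-7* n = ≡.trans (sgn-+ n (6 ℕ.* n)) (≡.trans (≡.cong (sgn n ℤ.*_) six) (ℤ.*-identityʳ (sgn n)))
    where
    six : sgn (6 ℕ.* n) ≡ 1ℤ
    six = ≡.trans (≡.cong sgn (ℕ.*-distribʳ-+ n 3 3)) (≡.trans (sgn-+ (3 ℕ.* n) (3 ℕ.* n)) (sgn-*-self (3 ℕ.* n)))

  X^-diagonal : ∀ m → (X^ m) m ≡ 1ℤ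
  X^-diagonal zero = ≡.refl
  X^-diagonal (suc m) = X^-diagonal m

  X^-off-diagonal : ∀ m i → m ≢ i → (X^ m) i ≡ 0ℤ
  X^-off-diagonal zero zero m≢i = ⊥-elim (m≢i ≡.refl)
  X^-off-diagonal zero (suc i) _ = ≡.refl
  X^-off-diagonal (suc m) zero _ = ≡.refl
  X^-off-diagonal (suc m) (suc i) m≢i = X^-off-diagonal m i (m≢i ∘ ≡.cong suc)

  signˢ-coeff : ∀ k f i → (signˢ k *ˢ f) i ≈ sgn k ℤ.* f i
  signˢ-coeff zero f i = R.trans (*ˢ-identityˡ f i) (reflexive (≡.sym (ℤ.*-identityˡ (f i))))
  signˢ-coeff (suc k) f i = R.trans (KS.solve 2 (λ e f → (KS.:- e) KS.:* f KS.:= KS.:- (e KS.:* f)) K.refl (signˢ k) f i)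
    (R.trans (R.-‿cong (signˢ-coeff k f i)) (reflexive (ℤ.neg-distribˡ-* (sgn k) (f i))))

  theta-coeff : ∀ n i → theta n i ≈ sgn i ℤ.* + squaresUpTo n i
  theta-coeff zero zero = R.refl
  theta-coeff zero (suc i) = reflexive (≡.sym (ℤ.*-zeroʳ (sgn (suc i))))
  theta-coeff (suc n) i = begin
    theta n i ℤ.+ ((1ˢ +ˢ 1ˢ) *ˢ x) i ≈⟨
        R.+-cong (theta-coeff n i) (KS.solve 1 (λ x → KS.con (+ 2) KS.:* x KS.:= x KS.:+ x) K.refl x i) ⟩
    sgn i ℤ.* + s ℤ.+ (x i ℤ.+ x i)                      ≈⟨ R.+-congˡ {sgn i ℤ.* + s} (R.+-cong x-coeff x-coeff) ⟩
    sgn i ℤ.* + s ℤ.+ (sgn i ℤ.* + d ℤ.+ sgn i ℤ.* + d)  ≈⟨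
        RS.solve 3 (λ e s d → e RS.:* s RS.:+ (e RS.:* d RS.:+ e RS.:* d) RS.:= e RS.:* ((d RS.:+ d) RS.:+ s))
        R.refl (sgn i) (+ s) (+ d) ⟩
    sgn i ℤ.* + ((d ℕ.+ d) ℕ.+ s)                        ≡⟨ ≡.cong (λ t → sgn i ℤ.* + (t ℕ.+ s)) double ⟩
    sgn i ℤ.* + squaresUpTo (suc n) i                    ∎
    where
    s = squaresUpTo n i
    k² = suc n ℕ.* suc n
    x = signˢ (suc n) *ˢ X^ k²
    d = if k² ℕ.≡ᵇ i then 1 else 0
    double : d ℕ.+ d ≡ (if k² ℕ.≡ᵇ i then 2 else 0)
    double with k² ℕ.≡ᵇ i
    ... | true = ≡.refl
    ... | false = ≡.refl
    signed : sgn (suc n) ℤ.* (X^ k²) i ≡ sgn i ℤ.* + d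
    signed with k² ℕ.≡ᵇ i | ℕ.≡ᵇ⇒≡ k² i | ℕ.≡⇒≡ᵇ k² i
    ... | true | f | _ with f _
    ...   | ≡.refl = ≡.cong₂ ℤ._*_ (≡.sym (sgn-square (suc n))) (X^-diagonal k²)
    signed | false | _ | g = ≡.trans (≡.cong (sgn (suc n) ℤ.*_) (X^-off-diagonal k² i g))
        (≡.trans (ℤ.*-zeroʳ (sgn (suc n))) (≡.sym (ℤ.*-zeroʳ (sgn i))))
    x-coeff : x i ≈ sgn i ℤ.* + d
    x-coeff = R.trans (signˢ-coeff (suc n) (X^ k²) i) (reflexive signed)

-- The overpartition series as the inverse of φ(-q), modulo 7.

module OverpartitionSeries where
  open FormalPowerSeries
  open GaussIdentity
  open BoundedOverpartitions
  open ResiduesModulo7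
  open ThetaCoefficients using (squaresUpTo; θ)
  open import Algebra.Bundles using (CommutativeRing)
  open import Data.Bool using (true; false)
  open import Data.Empty using (⊥-elim)
  open import Data.Integer using (ℤ; +_; 0ℤ)
  open import Data.Integer.DivMod using (_/ℕ_; _%ℕ_; n%ℕd<d; a≡a%ℕn+[a/ℕn]*n)
  open import Data.Integer.Divisibility.Signed using (divides)
  open import Data.Nat using (ℕ; zero; suc; _<_; _≤_; s≤s)
  open import Relation.Nullary using (yes; no)
  open import Relation.Binary.PropositionalEquality using (_≡_)
  import Relation.Binary.PropositionalEquality as ≡
  import Data.Integer as ℤ
  import Data.Integer.Properties as ℤ
  import Data.Integer.Solver as ℤ-Solver
  import Data.Nat as ℕ
  import Data.Nat.Properties as ℕ
  open Modular (+ 7) using (_≈_; congruent; reflexive) renaming (ring to ℤ/7)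
  open PowerSeries ℤ/7
  open Gauss ℤ/7
  private
    module R = CommutativeRing ℤ/7
    module K = CommutativeRing commutativeRing

  open import Relation.Binary.Reasoning.Setoid R.setoid

  bounded : ℕ → Series
  bounded m n = + ovBounded n m

  bounded-zero : bounded 0 ≈ˢ 1ˢ
  bounded-zero zero    = R.refl
  bounded-zero (suc n) = R.refl

  bounded-suc : ∀ m → bounded (suc m) ≈ˢ bounded m +ˢ ((X^ suc m) *ˢ bounded m +ˢ (X^ suc m) *ˢ bounded (suc m))
  bounded-suc m i with suc m ℕ.≤? i
  ... | no nle = begin
    + ovBounded i (suc m)            ≡⟨ ≡.cong +_ (ovBounded-< (ℕ.≰⇒> nle)) ⟩
    + ovBounded i m                  ≡⟨ ≡.sym (ℤ.+-identityʳ _) ⟩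
    + ovBounded i m ℤ.+ (0ℤ ℤ.+ 0ℤ)  ≈⟨ R.+-congˡ {+ ovBounded i m}
        (R.+-cong (R.sym (X^-coeff-< (bounded m) (ℕ.≰⇒> nle))) (R.sym (X^-coeff-< (bounded (suc m)) (ℕ.≰⇒> nle)))) ⟩
    + ovBounded i m ℤ.+ (((X^ suc m) *ˢ bounded m) i ℤ.+ ((X^ suc m) *ˢ bounded (suc m)) i) ∎
  ... | yes le = ≡.subst
      (λ i → bounded (suc m) i ≈ (bounded m +ˢ ((X^ suc m) *ˢ bounded m +ˢ (X^ suc m) *ˢ bounded (suc m))) i)
      (ℕ.m+[n∸m]≡n le) (begin
    + ovBounded (suc m ℕ.+ n) (suc m)                                      ≡⟨ ≡.cong +_ (ovBounded-+ n m) ⟩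
    + ovBounded (suc m ℕ.+ n) m ℤ.+ (+ ovBounded n m ℤ.+ + ovBounded n (suc m))
       ≈⟨ R.+-congˡ {+ ovBounded (suc m ℕ.+ n) m}
           (R.+-cong (R.sym (X^-coeff-+ (suc m) (bounded m) n)) (R.sym (X^-coeff-+ (suc m) (bounded (suc m)) n))) ⟩
    + ovBounded (suc m ℕ.+ n) m ℤ.+
        (((X^ suc m) *ˢ bounded m) (suc m ℕ.+ n) ℤ.+ ((X^ suc m) *ˢ bounded (suc m)) (suc m ℕ.+ n)) ∎)
    where n = i ℕ.∸ suc m

  cast : (ℕ → ℕ) → Series
  cast f n = + f n

  p̄ φ : Series
  p̄ = cast overpartitions
  φ = twist (cast θ)

  squaresUpTo-stable : ∀ d i → squaresUpTo (d ℕ.+ i) i ≡ θ i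
  squaresUpTo-stable zero i = ≡.refl
  squaresUpTo-stable (suc d) i with k ℕ.≡ᵇ i | ℕ.≡ᵇ⇒≡ k i
    where k = suc (d ℕ.+ i) ℕ.* suc (d ℕ.+ i)
  ... | false | _ = squaresUpTo-stable d i
  ... | true  | f = ⊥-elim
      (ℕ.<-irrefl (≡.sym (f _)) (ℕ.≤-trans (s≤s (ℕ.m≤n+m i d)) (ℕ.m≤m*n (suc (d ℕ.+ i)) (suc (d ℕ.+ i)))))

  -- Every summand after the leading 1 carries a factor q^(jn) with j ≥ 1, invisible below degree n.
  alternating-coeff : ∀ n k i → i < n → alternating bounded bounded-zero bounded-suc n k i ≈ 1ˢ i
  alternating-coeff n zero i lt = R.refl
  alternating-coeff n (suc k) i lt = begin
    a i ℤ.+ (e *ˢ (x *ˢ w)) i ≈⟨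
        R.+-cong (alternating-coeff n k i lt)
        (K.trans (K.sym (*ˢ-assoc e x w)) (K.trans (*ˢ-cong (*ˢ-comm e x) (λ _ → R.refl)) (*ˢ-assoc x e w)) i) ⟩
    1ˢ i ℤ.+ (x *ˢ (e *ˢ w)) i   ≈⟨ R.+-congˡ {1ˢ i} (X^-coeff-< (e *ˢ w) (ℕ.<-≤-trans lt (ℕ.m≤m+n n (k ℕ.* n)))) ⟩
    1ˢ i ℤ.+ 0ℤ                  ≡⟨ ℤ.+-identityʳ (1ˢ i) ⟩
    1ˢ i                         ∎
    where
    a = alternating bounded bounded-zero bounded-suc n k
    e = signˢ (suc k)
    x = X^ (suc k ℕ.* n)
    w = bounded (suc k) K.- bounded k

  -- Coefficient i is unchanged when both factors are truncated at i + 1. There the finite identity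
  -- applies, and i < i + 1 makes its corrections vanish.
  p̄*φ≈1 : p̄ *ˢ φ ≈ˢ 1ˢ
  p̄*φ≈1 i = begin
    (p̄ *ˢ φ) i                                         ≈⟨ *ˢ-cong-≤ i p̄-stable φ-stable ⟩
    (bounded (suc i) *ˢ theta (suc i)) i ≈⟨
        R.sym (alternating≈product bounded bounded-zero bounded-suc (suc i) i) ⟩
    alternating bounded bounded-zero bounded-suc (suc i) (suc i) i  ≈⟨ alternating-coeff (suc i) (suc i) i ℕ.≤-refl ⟩
    1ˢ i                                               ∎
    where
    p̄-stable : ∀ j → j ≤ i → p̄ j ≈ bounded (suc i) j
    p̄-stable j le = reflexive
        (≡.cong +_ (≡.trans (≡.sym (ovBounded-stable (suc i ℕ.∸ j) j))
        (≡.cong (ovBounded j) (ℕ.m∸n+n≡m (ℕ.m≤n⇒m≤1+n le)))))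
    φ-stable : ∀ j → j ≤ i → φ j ≈ theta (suc i) j
    φ-stable j le = R.trans
        (reflexive (≡.cong (λ t → sgn j ℤ.* + t)
        (≡.trans (≡.sym (squaresUpTo-stable (suc i ℕ.∸ j) j))
        (≡.cong (λ k → squaresUpTo k j) (ℕ.m∸n+n≡m (ℕ.m≤n⇒m≤1+n le))))))
      (R.sym (theta-coeff (suc i) j))

  infix 8 _^7
  _^7 : Series → Series
  f ^7 = f *ˢ f *ˢ f *ˢ f *ˢ f *ˢ f *ˢ f

  constant : ℤ → Series
  constant a = a · 1ˢ

  constant-*ˢ : ∀ a f → constant a *ˢ f ≈ˢ a · f
  constant-*ˢ a f n = R.trans (·-*ˢ a 1ˢ f n) (R.*-congˡ {a} (*ˢ-identityˡ f n))

  fermat : ∀ a → a ℤ.* a ℤ.* a ℤ.* a ℤ.* a ℤ.* a ℤ.* a ≈ a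
  fermat a = begin
    pow a          ≈⟨ pow-cong a≈r ⟩
    pow (+ r)      ≈⟨ residues r (n%ℕd<d a 7) ⟩
    + r            ≈⟨ R.sym a≈r ⟩
    a              ∎
    where
    pow : ℤ → ℤ
    pow a = a ℤ.* a ℤ.* a ℤ.* a ℤ.* a ℤ.* a ℤ.* a
    pow-cong : ∀ {a b} → a ≈ b → pow a ≈ pow b
    pow-cong e = R.*-cong (R.*-cong (R.*-cong (R.*-cong (R.*-cong (R.*-cong e e) e) e) e) e) e
    r = a %ℕ 7
    a≈r : a ≈ + r
    a≈r = congruent (divides (a /ℕ 7) (≡.trans (≡.cong (ℤ._- + r) (a≡a%ℕn+[a/ℕn]*n a 7))
      (solve 2 (λ r q → (r :+ q) :- r := q) ≡.refl (+ r) ((a /ℕ 7) ℤ.* + 7))))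
      where open ℤ-Solver.+-*-Solver
    residues : ∀ r → r < 7 → pow (+ r) ≈ + r
    -- The witnesses are (r⁷ - r)/7.
    residues 0 _ = congruent (divides (+ 0) ≡.refl)
    residues 1 _ = congruent (divides (+ 0) ≡.refl)
    residues 2 _ = congruent (divides (+ 18) ≡.refl)
    residues 3 _ = congruent (divides (+ 312) ≡.refl)
    residues 4 _ = congruent (divides (+ 2340) ≡.refl)
    residues 5 _ = congruent (divides (+ 11160) ≡.refl)
    residues 6 _ = congruent (divides (+ 39990) ≡.refl)
    residues (suc (suc (suc (suc (suc (suc (suc _))))))) (s≤s (s≤s (s≤s (s≤s (s≤s (s≤s (s≤s ())))))))

-- Seventh powers modulo 7 and extraction of every seventh coefficient.

module Frobenius where
  open IntegerCoefficientSolver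
  open FormalPowerSeries
  open GaussIdentity
  open ResiduesModulo7
  open OverpartitionSeries
  open ThetaCoefficients using (conv)
  open import Algebra.Bundles using (CommutativeRing)
  open import Data.Integer using (ℤ; +_; 0ℤ; 1ℤ)
  open import Data.Integer.Divisibility.Signed using (divides)
  open import Data.Nat using (ℕ; zero; suc; s≤s; z≤n)
  open import Function using (_∘_)
  open import Relation.Binary.PropositionalEquality using (_≡_)
  import Relation.Binary.PropositionalEquality as ≡
  import Data.Integer as ℤ
  import Data.Integer.Properties as ℤ
  import Data.Integer.Solver as ℤ-Solver
  import Data.Nat as ℕ
  import Data.Nat.Properties as ℕ
  open Modular (+ 7) using (_≈_; congruent; reflexive) renaming (ring to ℤ/7)
  open PowerSeries ℤ/7
  open Gauss ℤ/7
  private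
    module R = CommutativeRing ℤ/7
    module K = CommutativeRing commutativeRing
    module KS = IntegerCoefficients.Solver commutativeRing

  import Relation.Binary.Reasoning.Setoid as SetoidReasoning
  module RR = SetoidReasoning R.setoid
  module KR = SetoidReasoning K.setoid

  7ˢ : Series
  7ˢ = 1ˢ +ˢ 1ˢ +ˢ 1ˢ +ˢ 1ˢ +ˢ 1ˢ +ˢ 1ˢ +ˢ 1ˢ

  7ˢ≈0 : 7ˢ ≈ˢ 0ˢ
  7ˢ≈0 zero    = congruent (divides 1ℤ ≡.refl)
  7ˢ≈0 (suc _) = R.refl

  -- (a + b)⁷ = a⁷ + b⁷ + 7ab(a + b)(a² + ab + b²)².
  ^7-+ : ∀ f g → (f +ˢ g) ^7 ≈ˢ f ^7 +ˢ g ^7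
  ^7-+ f g = begin
    (f +ˢ g) ^7                ≈⟨ KS.solve 2 (λ a b → seven (a :+ b) := (seven a :+ seven b) :+ con (+ 7) :*
                                    (a :* b :* (a :+ b) :*
                                        ((a :* a :+ a :* b :+ b :* b) :* (a :* a :+ a :* b :+ b :* b)))) K.refl f g ⟩
    f ^7 +ˢ g ^7 +ˢ 7ˢ *ˢ h    ≈⟨ K.+-congˡ {f ^7 +ˢ g ^7} (K.trans (K.*-congʳ {h} 7ˢ≈0) (K.zeroˡ h)) ⟩
    f ^7 +ˢ g ^7 +ˢ 0ˢ         ≈⟨ K.+-identityʳ _ ⟩
    f ^7 +ˢ g ^7               ∎
    where
    open KR
    open KS using (Polynomial; _:+_; _:*_; _:=_; con)
    seven : ∀ {n} → Polynomial n → Polynomial n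
    seven x = x :* x :* x :* x :* x :* x :* x
    q = f *ˢ f +ˢ f *ˢ g +ˢ g *ˢ g
    h = f *ˢ g *ˢ (f +ˢ g) *ˢ (q *ˢ q)

  ^7-cong : ∀ {f g} → f ≈ˢ g → f ^7 ≈ˢ g ^7
  ^7-cong e = *ˢ-cong (*ˢ-cong (*ˢ-cong (*ˢ-cong (*ˢ-cong (*ˢ-cong e e) e) e) e) e) e

  constant-^7 : ∀ a → constant a ^7 ≈ˢ constant a
  constant-^7 a = K.trans (multiply a⁶ (multiply a⁵ (multiply a⁴ (multiply a³ (multiply a² (multiply a K.refl))))))
    (λ n → R.*-congʳ {1ˢ n} (fermat a))
    where
    a² = a ℤ.* a
    a³ = a² ℤ.* a
    a⁴ = a³ ℤ.* a
    a⁵ = a⁴ ℤ.* a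
    a⁶ = a⁵ ℤ.* a
    multiply : ∀ {f} b → f ≈ˢ constant b → f *ˢ constant a ≈ˢ constant (b ℤ.* a)
    multiply b e = K.trans (K.*-congʳ {constant a} e)
        (K.trans (constant-*ˢ b (constant a)) (λ n → R.sym (R.*-assoc b a (1ˢ n))))

  shift-^7 : ∀ f → shift f ^7 ≈ˢ (X^ 7) *ˢ f ^7
  shift-^7 f = begin
    shift f ^7                  ≈⟨ ^7-cong (K.sym (K.trans (shift-*ˢ 1ˢ f) (shift-cong (*ˢ-identityˡ f)))) ⟩
    (x *ˢ f) ^7                 ≈⟨ KS.solve 2 (λ x f → seven (x :* f) := seven x :* seven f) K.refl x f ⟩
    x ^7 *ˢ f ^7                ≈⟨ K.*-congʳ {f ^7} x^7 ⟩
    (X^ 7) *ˢ f ^7              ∎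
    where
    open KR
    open KS using (Polynomial; _:*_; _:=_)
    seven : ∀ {n} → Polynomial n → Polynomial n
    seven x = x :* x :* x :* x :* x :* x :* x
    x = X^ 1
    step : ∀ {f} n → f ≈ˢ X^ n → f *ˢ x ≈ˢ X^ (n ℕ.+ 1)
    step n e = K.trans (K.*-congʳ {x} e) (K.sym (X^-+ n 1))
    x^7 : x ^7 ≈ˢ X^ 7
    x^7 = step 6 (step 5 (step 4 (step 3 (step 2 (step 1 K.refl)))))

  head-tail : ∀ f → f ≈ˢ constant (f 0) +ˢ shift (tail f)
  head-tail f zero    = reflexive (≡.sym (≡.trans (ℤ.+-identityʳ _) (ℤ.*-identityʳ (f 0))))
  head-tail f (suc n) =
      reflexive (≡.sym (≡.trans (≡.cong (ℤ._+ f (suc n)) (ℤ.*-zeroʳ (f 0))) (ℤ.+-identityˡ (f (suc n)))))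

  -- The congruence f⁷ ≡ f(q⁷) unrolled by one coefficient, from f = f(0) + q · `tail f`; the
  -- substitution q ↦ q⁷ itself never has to be defined.
  ^7-head-tail : ∀ f g → f ^7 *ˢ g ≈ˢ (f 0 · g) +ˢ (X^ 7) *ˢ (tail f ^7 *ˢ g)
  ^7-head-tail f g = begin
    f ^7 *ˢ g                                              ≈⟨
        K.*-congʳ {g} (K.trans (^7-cong (head-tail f)) (^7-+ (constant (f 0)) (shift (tail f)))) ⟩
    (constant (f 0) ^7 +ˢ shift (tail f) ^7) *ˢ g          ≈⟨ K.distribʳ g (constant (f 0) ^7) (shift (tail f) ^7) ⟩
    constant (f 0) ^7 *ˢ g +ˢ shift (tail f) ^7 *ˢ g ≈⟨
        K.+-cong (K.trans (K.*-congʳ {g} (constant-^7 (f 0))) (constant-*ˢ (f 0) g))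
                                                               (K.trans (K.*-congʳ {g} (shift-^7 (tail f)))
                                                                   (K.*-assoc (X^ 7) (tail f ^7) g)) ⟩
    (f 0 · g) +ˢ (X^ 7) *ˢ (tail f ^7 *ˢ g)                ∎
    where open KR

  U : Series → Series
  U f n = f (7 ℕ.* n)

  -- Since f⁷ ≡ f(q⁷) involves only exponents divisible by 7, it passes through `U`. Unrolling it
  -- coefficient by coefficient reproduces the recursion of the product.
  U-^7-*ˢ : ∀ f g → U (f ^7 *ˢ g) ≈ˢ f *ˢ U g
  U-^7-*ˢ f g zero = begin
    (f ^7 *ˢ g) 0                                          ≈⟨ ^7-head-tail f g 0 ⟩
    f 0 ℤ.* g 0 ℤ.+ ((X^ 7) *ˢ (tail f ^7 *ˢ g)) 0 ≈⟨
        R.+-congˡ {f 0 ℤ.* g 0} (X^-coeff-< {7} (tail f ^7 *ˢ g) (s≤s z≤n)) ⟩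
    f 0 ℤ.* g 0 ℤ.+ 0ℤ                                     ≡⟨ ℤ.+-identityʳ _ ⟩
    f 0 ℤ.* g 0                                            ∎
    where open RR
  U-^7-*ˢ f g (suc n) = begin
    (f ^7 *ˢ g) (7 ℕ.* suc n)                              ≈⟨ ^7-head-tail f g (7 ℕ.* suc n) ⟩
    f 0 ℤ.* U g (suc n) ℤ.+ ((X^ 7) *ˢ (tail f ^7 *ˢ g)) (7 ℕ.* suc n) ≡⟨
        ≡.cong (λ k → f 0 ℤ.* U g (suc n) ℤ.+ ((X^ 7) *ˢ (tail f ^7 *ˢ g)) k) (ℕ.*-suc 7 n) ⟩
    f 0 ℤ.* U g (suc n) ℤ.+ ((X^ 7) *ˢ (tail f ^7 *ˢ g)) (7 ℕ.+ 7 ℕ.* n)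
        ≈⟨ R.+-congˡ {f 0 ℤ.* U g (suc n)} (X^-coeff-+ 7 (tail f ^7 *ˢ g) (7 ℕ.* n)) ⟩
    f 0 ℤ.* U g (suc n) ℤ.+ U (tail f ^7 *ˢ g) n           ≈⟨ R.+-congˡ {f 0 ℤ.* U g (suc n)} (U-^7-*ˢ (tail f) g n) ⟩
    f 0 ℤ.* U g (suc n) ℤ.+ (tail f *ˢ U g) n              ∎
    where open RR

  cast-conv : ∀ f g → cast (conv f g) ≈ˢ cast f *ˢ cast g
  cast-conv f g zero = reflexive (ℤ.pos-* (f 0) (g 0))
  cast-conv f g (suc n) = R.+-cong (reflexive (ℤ.pos-* (f 0) (g (suc n)))) (cast-conv (f ∘ suc) g n)

  twist-*ˢ : ∀ f g → twist f *ˢ twist g ≈ˢ twist (f *ˢ g)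
  twist-*ˢ f g = general 0 f
    where
    -- The tail of a twisted series has its signs shifted, so the induction carries an offset `k`.
    general : ∀ k f n → ((λ i → sgn (k ℕ.+ i) ℤ.* f i) *ˢ twist g) n ≈ sgn (k ℕ.+ n) ℤ.* (f *ˢ g) n
    general k f zero = reflexive
        (≡.trans (solve 3 (λ s a b → (s :* a) :* (con 1ℤ :* b) := s :* (a :* b)) ≡.refl
        (sgn (k ℕ.+ 0)) (f 0) (g 0)) ≡.refl)
      where open ℤ-Solver.+-*-Solver
    general k f (suc n) = begin
      sgn (k ℕ.+ 0) ℤ.* f 0 ℤ.* (sgn (suc n) ℤ.* g (suc n)) ℤ.+ ((λ i → sgn (k ℕ.+ suc i) ℤ.* f (suc i)) *ˢ twist g) n
        ≈⟨ R.+-cong (reflexive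
            (≡.trans (solve 4 (λ s a t b → s :* a :* (t :* b) := (s :* t) :* (a :* b)) ≡.refl
            (sgn (k ℕ.+ 0)) (f 0) (sgn (suc n)) (g (suc n)))
              (≡.cong (ℤ._* (f 0 ℤ.* g (suc n))) sign)))
            (R.trans (*ˢ-cong (λ i → reflexive (≡.cong (λ j → sgn j ℤ.* f (suc i)) (ℕ.+-suc k i)))
                (λ _ → R.refl) n) (general (suc k) (tail f) n)) ⟩
      sgn (k ℕ.+ suc n) ℤ.* (f 0 ℤ.* g (suc n)) ℤ.+ sgn (suc k ℕ.+ n) ℤ.* (tail f *ˢ g) n
        ≡⟨ ≡.cong (λ j → sgn (k ℕ.+ suc n) ℤ.* (f 0 ℤ.* g (suc n)) ℤ.+ sgn j ℤ.* (tail f *ˢ g) n) (≡.sym (ℕ.+-suc k n)) ⟩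
      sgn (k ℕ.+ suc n) ℤ.* (f 0 ℤ.* g (suc n)) ℤ.+ sgn (k ℕ.+ suc n) ℤ.* (tail f *ˢ g) n
        ≡⟨ ≡.sym (ℤ.*-distribˡ-+ (sgn (k ℕ.+ suc n)) (f 0 ℤ.* g (suc n)) ((tail f *ˢ g) n)) ⟩
      sgn (k ℕ.+ suc n) ℤ.* (f *ˢ g) (suc n) ∎
      where
      open RR
      open ℤ-Solver.+-*-Solver
      sign : sgn (k ℕ.+ 0) ℤ.* sgn (suc n) ≡ sgn (k ℕ.+ suc n)
      sign = ≡.trans (≡.cong (λ j → sgn j ℤ.* sgn (suc n)) (ℕ.+-identityʳ k)) (≡.sym (sgn-+ k (suc n)))

  φ³ φ⁴ : Series
  φ³ = φ *ˢ (φ *ˢ φ)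
  φ⁴ = φ *ˢ φ³

  U-P³ : U φ⁴ ≈ˢ φ⁴ → U (p̄ *ˢ (p̄ *ˢ p̄)) ≈ˢ φ³
  U-P³ Uφ⁴ = begin
    U (p̄ *ˢ (p̄ *ˢ p̄))                 ≈⟨ (λ n → cube (7 ℕ.* n)) ⟩
    U (p̄ ^7 *ˢ φ⁴)                    ≈⟨ U-^7-*ˢ p̄ φ⁴ ⟩
    p̄ *ˢ U φ⁴                         ≈⟨ K.*-congˡ {p̄} Uφ⁴ ⟩
    p̄ *ˢ (φ *ˢ φ³)                    ≈⟨ K.sym (K.*-assoc p̄ φ φ³) ⟩
    p̄ *ˢ φ *ˢ φ³                      ≈⟨ K.*-congʳ {φ³} p̄*φ≈1 ⟩
    1ˢ *ˢ φ³                          ≈⟨ *ˢ-identityˡ φ³ ⟩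
    φ³                                ∎
    where
    open KR
    ones : 1ˢ ≈ˢ p̄ *ˢ φ
    ones = K.sym p̄*φ≈1
    cube : p̄ *ˢ (p̄ *ˢ p̄) ≈ˢ p̄ ^7 *ˢ φ⁴
    cube = begin
      p̄ *ˢ (p̄ *ˢ p̄)                                               ≈⟨
          KS.solve 1 (λ p → p :* (p :* p) := p :* (p :* p) :* (con 1ℤ :* (con 1ℤ :* (con 1ℤ :* con 1ℤ)))) K.refl p̄ ⟩
      p̄ *ˢ (p̄ *ˢ p̄) *ˢ (1ˢ *ˢ (1ˢ *ˢ (1ˢ *ˢ 1ˢ)))                 ≈⟨
          K.*-congˡ {p̄ *ˢ (p̄ *ˢ p̄)} (K.*-cong ones (K.*-cong ones (K.*-cong ones ones))) ⟩
      p̄ *ˢ (p̄ *ˢ p̄) *ˢ (y *ˢ (y *ˢ (y *ˢ y)))                     ≈⟨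
          KS.solve 2 (λ p f → p :* (p :* p) :* ((p :* f) :* ((p :* f) :* ((p :* f) :* (p :* f)))) :=
                                                                       p :* p :* p :* p :* p :* p :* p :*
                                                                           (f :* (f :* (f :* f)))) K.refl p̄ φ ⟩
      p̄ ^7 *ˢ φ⁴                                                  ∎
      where
      open KS using (_:*_; _:=_; con)
      y = p̄ *ˢ φ

-- Overpartition triples at multiples of 7, and the three congruences.

open FormalPowerSeries
open GaussIdentity
open ResiduesModulo7
open OverpartitionSeries
open Frobenius
open PrimeNorm
open DoubleCounting
open HeckeRecurrence
open ThetaCoefficients using (conv; θ; r₃; r₄)
open import Algebra.Bundles using (CommutativeRing)
open import Data.Integer using (ℤ; +_)
open import Data.Integer.Divisibility.Signed using (divides; ∣⇒∣ᵤ; ∣ᵤ⇒∣; ∣m+n∣n⇒∣m; ∣m⇒∣-m; ∣n⇒∣m*n)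
open import Data.List using ([]; _∷_; map; upTo; applyUpTo)
open import Data.List.Properties using (map-upTo; map-cong)
open import Data.Nat using (ℕ; zero; suc; s≤s; z≤n; _+_; _*_; _^_; _%_; _≥_; _∸_)
open import Data.Nat.Coprimality using (Coprime)
open import Data.Nat.Divisibility using (_∣_; _∣?_; ∣-refl)
open import Data.Nat.ListAction using (sum)
open import Data.Nat.Primality using (Prime; prime?)
open import Data.Product using (_×_; _,_)
open import Data.Sum using (_⊎_; inj₁; inj₂)
open import Function using (_∘_)
open import Relation.Nullary using (¬_)
open import Relation.Nullary.Decidable using (from-yes)
open import Relation.Binary.PropositionalEquality using (_≡_)
import Relation.Binary.PropositionalEquality as ≡
import Data.Integer as ℤ
import Data.Integer.Properties as ℤ
import Data.Integer.Solver as ℤ-Solver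
import Data.Nat as ℕ
import Data.Nat.Properties as ℕ
import Data.Nat.Solver as ℕ-Solver
open Modular (+ 7) using (_≈_; congruent; reflexive) renaming (ring to ℤ/7)
open PowerSeries ℤ/7
private
  module R = CommutativeRing ℤ/7
  module K = CommutativeRing commutativeRing

φ³-coeff : φ³ ≈ˢ twist (cast r₃)
φ³-coeff = twisted θ (conv θ θ) K.refl (twisted θ θ K.refl K.refl)
  where
  twisted : ∀ f g {F G} → F ≈ˢ twist (cast f) → G ≈ˢ twist (cast g) → F *ˢ G ≈ˢ twist (cast (conv f g))
  twisted f g e e′ = K.trans (*ˢ-cong e e′)
      (K.trans (twist-*ˢ (cast f) (cast g)) (λ n → R.*-congˡ {sgn n} (R.sym (cast-conv f g n))))

φ⁴-coeff : φ⁴ ≈ˢ twist (cast r₄)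
φ⁴-coeff = K.trans (K.*-congˡ {φ} φ³-coeff)
    (K.trans (twist-*ˢ (cast θ) (cast r₃)) (λ n → R.*-congˡ {sgn n} (R.sym (cast-conv θ r₃ n))))

7-prime : Prime 7
7-prime = from-yes (prime? 7)

-- Dividing by 8 gives 8r = 8k + l = x + 7k, whence x - r = 7(r - k).
congruent-count : ∀ k l r x → k + l ≡ x → 64 * r ≡ k * 64 + l * 8 → + x ≈ + r
congruent-count k l r x k+l e = congruent (divides (+ r ℤ.- + k) (begin
  + x ℤ.- + r                                      ≡⟨
      solve 3 (λ x r k → x :- r := ((x :+ con (+ 7) :* k) :- r) :- con (+ 7) :* k) ≡.refl (+ x) (+ r) (+ k) ⟩
  (+ x ℤ.+ + 7 ℤ.* + k ℤ.- + r) ℤ.- + 7 ℤ.* + k    ≡⟨ ≡.cong (λ t → (t ℤ.- + r) ℤ.- + 7 ℤ.* + k) eightfold ⟩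
  (+ 8 ℤ.* + r ℤ.- + r) ℤ.- + 7 ℤ.* + k ≡⟨
      solve 2 (λ r k → (con (+ 8) :* r :- r) :- con (+ 7) :* k := (r :- k) :* con (+ 7)) ≡.refl (+ r) (+ k) ⟩
  (+ r ℤ.- + k) ℤ.* + 7                            ∎))
  where
  open ≡.≡-Reasoning
  open ℤ-Solver.+-*-Solver
  module S = ℕ-Solver.+-*-Solver
  count : x + 7 * k ≡ 8 * r
  count = ℕ.*-cancelʳ-≡ (x + 7 * k) (8 * r) 8 (≡.trans (≡.cong (λ x → (x + 7 * k) * 8) (≡.sym k+l))
    (≡.trans (S.solve 2 (λ k l →
        ((k S.:+ l) S.:+ S.con 7 S.:* k) S.:* S.con 8 S.:= k S.:* S.con 64 S.:+ l S.:* S.con 8) ≡.refl k l)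
    (≡.trans (≡.sym e) (S.solve 1 (λ r → S.con 64 S.:* r S.:= S.con 8 S.:* r S.:* S.con 8) ≡.refl r))))
  eightfold : + x ℤ.+ + 7 ℤ.* + k ≡ + 8 ℤ.* + r
  eightfold = ≡.trans (≡.cong (λ t → + x ℤ.+ t) (≡.sym (ℤ.pos-* 7 k))) (≡.trans (≡.cong +_ count) (ℤ.pos-* 8 r))

-- The double count for r₄ is applied with the prime 7 itself, where r₄(7) = 64 by evaluation.
r₄-7* : ∀ n → + r₄ (7 * n) ≈ + r₄ n
r₄-7* n = let k , l , k+l , e = DoubleCount.r₄-count 7-prime (s≤s (s≤s (s≤s z≤n))) n in
  congruent-count k l (r₄ n) (r₄ (7 * n)) k+l (≡.subst (λ c → c * r₄ n ≡ k * c + l * 8) r₄-7 e)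
  where
  r₄-7 : r₄ 7 ≡ 64
  r₄-7 = ≡.refl

U-φ⁴ : U φ⁴ ≈ˢ φ⁴
U-φ⁴ n = begin
  φ⁴ (7 * n)                         ≈⟨ φ⁴-coeff (7 * n) ⟩
  sgn (7 * n) ℤ.* + r₄ (7 * n)       ≈⟨ R.*-cong (reflexive (sgn-7* n)) (r₄-7* n) ⟩
  sgn n ℤ.* + r₄ n                   ≈⟨ R.sym (φ⁴-coeff n) ⟩
  φ⁴ n                               ∎
  where open import Relation.Binary.Reasoning.Setoid R.setoid

sum-conv : ∀ f g n → sum (map (λ i → f i * g (n ∸ i)) (upTo (suc n))) ≡ conv f g n
sum-conv f g n = ≡.trans (≡.cong sum (map-upTo (λ i → f i * g (n ∸ i)) (suc n))) (go f n)
  where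
  go : ∀ f n → sum (applyUpTo (λ i → f i * g (n ∸ i)) (suc n)) ≡ conv f g n
  go f zero    = ℕ.+-identityʳ _
  go f (suc n) = ≡.cong (λ x → f 0 * g (suc n) + x) (go (f ∘ suc) n)

pbar3-conv : ∀ n → pbar3 n ≡ conv overpartitions (conv overpartitions overpartitions) n
pbar3-conv n = ≡.trans (≡.cong sum (map-cong inner (upTo (suc n)))) (sum-conv o (conv o o) n)
  where
  o = overpartitions
  inner : ∀ a → sum (map (λ b → o a * o b * o (n ∸ a ∸ b)) (upTo (suc (n ∸ a)))) ≡ o a * conv o o (n ∸ a)
  inner a = ≡.trans (scale (upTo (suc (n ∸ a)))) (≡.cong (o a *_) (sum-conv o o (n ∸ a)))
    where
    scale : ∀ xs → sum (map (λ b → o a * o b * o (n ∸ a ∸ b)) xs) ≡ o a * sum (map (λ b → o b * o (n ∸ a ∸ b)) xs)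
    scale [] = ≡.sym (ℕ.*-zeroʳ (o a))
    scale (b ∷ xs) = ≡.trans (≡.cong₂ _+_ (ℕ.*-assoc (o a) (o b) _) (scale xs)) (≡.sym (ℕ.*-distribˡ-+ (o a) _ _))

pbar3-7* : ∀ n → + pbar3 (7 * n) ≈ sgn n ℤ.* + r₃ n
pbar3-7* n = begin
  + pbar3 (7 * n)                    ≡⟨ ≡.cong +_ (pbar3-conv (7 * n)) ⟩
  + conv o (conv o o) (7 * n)        ≈⟨ K.trans (cast-conv o (conv o o)) (K.*-congˡ {p̄} (cast-conv o o)) (7 * n) ⟩
  U (p̄ *ˢ (p̄ *ˢ p̄)) n                ≈⟨ U-P³ U-φ⁴ n ⟩
  φ³ n                               ≈⟨ φ³-coeff n ⟩
  sgn n ℤ.* + r₃ n                   ∎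
  where
  open import Relation.Binary.Reasoning.Setoid R.setoid
  o = overpartitions

∣-transfer : ∀ a s r → + a ≈ s ℤ.* + r → 7 ∣ r → 7 ∣ a
∣-transfer a s r (congruent e) d = ∣⇒∣ᵤ {+ 7} {+ a} (∣m+n∣n⇒∣m {+ 7} {+ a} {ℤ.- (s ℤ.* + r)} e
  (∣m⇒∣-m {+ 7} {s ℤ.* + r} (∣n⇒∣m*n s (∣ᵤ⇒∣ {+ 7} {+ r} d))))

7∣r₃⇒7∣pbar3 : ∀ n → 7 ∣ r₃ n → 7 ∣ pbar3 (7 * n)
7∣r₃⇒7∣pbar3 n = ∣-transfer (pbar3 (7 * n)) (sgn n) (r₃ n) (pbar3-7* n)

theorem4p4 : (p N α : ℕ) → Prime p → p ≥ 3 → N ≥ 1 → Coprime N p →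
    ((p % 7 ≡ 1 → 7 ∣ pbar3 (7 * p ^ (14 * α + 13) * N))
    × ((p % 7 ≡ 2 ⊎ p % 7 ≡ 3 ⊎ p % 7 ≡ 4 ⊎ p % 7 ≡ 5 ⊎ p % 7 ≡ 6) → 7 ∣ pbar3 (7 * p ^ (12 * α + 11) * N))
    × (p % 7 ≡ 6 → 7 ∣ pbar3 (7 * p ^ 3 * N)))
theorem4p4 p N α pr p≥3 _ coprime =
  -- Seven terms, each congruent to 1. The exponent is 2j + 1 with j = 6 + 7α.
  (λ r → divisible 6 α (14 * α + 13)
      (S.solve 1 (λ α → S.con 2 S.:* (S.con 6 S.:+ α S.:* S.con 7) S.:+ S.con 1 S.:=
      S.con 14 S.:* α S.:+ S.con 13) ≡.refl α)
           (≡.subst (λ r → 7 ∣ geometric r 6) (≡.sym r) (from-yes (7 ∣? geometric 1 6)))) ,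
  -- Six terms: for r prime to 7 and not 1, the sum (r⁶ - 1)/(r - 1) vanishes modulo 7 by Fermat.
  -- The exponent is 2j + 1 with j = 5 + 6α.
  (λ r → divisible 5 α (12 * α + 11)
      (S.solve 1 (λ α → S.con 2 S.:* (S.con 5 S.:+ α S.:* S.con 6) S.:+ S.con 1 S.:=
      S.con 12 S.:* α S.:+ S.con 11) ≡.refl α)
           (six-terms (p % 7) r)) ,
  -- Two terms suffice for r = 6, as 1 + 6 = 7; here j = 1.
  (λ r → divisible 1 0 3 ≡.refl (≡.subst (λ r → 7 ∣ geometric r 1) (≡.sym r) ∣-refl))
  where
  module S = ℕ-Solver.+-*-Solver
  p∤N : ¬ p ∣ N
  p∤N p∣N with coprime (p∣N , ∣-refl)
  ... | ≡.refl = ℕ.<⇒≱ p≥3 (s≤s z≤n)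
  divisible : ∀ q β e → 2 * (q + β * suc q) + 1 ≡ e → 7 ∣ geometric (p % 7) q → 7 ∣ pbar3 (7 * p ^ e * N)
  divisible q β e ≡.refl d = ≡.subst (λ n → 7 ∣ pbar3 n) (≡.sym (ℕ.*-assoc 7 (p ^ e) N))
    (7∣r₃⇒7∣pbar3 (p ^ e * N) (Recurrence.7∣r₃-powers pr p≥3 N p∤N q β d))
  six-terms : ∀ r → (r ≡ 2 ⊎ r ≡ 3 ⊎ r ≡ 4 ⊎ r ≡ 5 ⊎ r ≡ 6) → 7 ∣ geometric r 5
  six-terms _ (inj₁ ≡.refl) = from-yes (7 ∣? geometric 2 5)
  six-terms _ (inj₂ (inj₁ ≡.refl)) = from-yes (7 ∣? geometric 3 5)
  six-terms _ (inj₂ (inj₂ (inj₁ ≡.refl))) = from-yes (7 ∣? geometric 4 5)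
  six-terms _ (inj₂ (inj₂ (inj₂ (inj₁ ≡.refl)))) = from-yes (7 ∣? geometric 5 5)
  six-terms _ (inj₂ (inj₂ (inj₂ (inj₂ ≡.refl)))) = from-yes (7 ∣? geometric 6 5)
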